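{- Let $n\geq 3$ and let $q=p^h$ with $p$ prime, $h\geq 2$ and $q>27$. Let $c\in\mathcal{C}_{n-1}(n,q)$ and suppose that \begin{itemize} \item $\mathrm{wt}(c)\leq \left(\left\lfloor\frac{1}{2^{n-2}}\sqrt{q}\right\rfloor-1\right)\theta_{n-1}$, when $h>2$, or \item $\mathrm{wt}(c)\leq \left(\left\lfloor\frac{p}{2^n}\right\rfloor-1\right)\theta_{n-1}$, when $h=2$. \end{itemize} Then $c$ is a linear combination of exactly $\left\lceil\frac{\mathrm{wt}(c)}{\theta_{n-1}}\right\rceil$ different hyperplanes of $\mathrm{PG}(n,q)$.
   Context: $\mathrm{PG}(n,q)$ is the Desarguesian projective space of dimension $n$ over $\mathbb{F}_q$. For integers $m\geq -1$, $\theta_m:=\frac{q^{m+1}-1}{q-1}$ (the number of points of an $m$-space). $\mathcal{C}_{n-1}(n,q)$ is the $p$-ary linear code consisting of the $\mathbb{F}_p$-linear span of the characteristic functions (with values in $\mathbb{F}_p$) of the hyperplanes of $\mathrm{PG}(n,q)$, viewed as functions from the point set of $\mathrm{PG}(n,q)$ to $\mathbb{F}_p$. A "linear combination of hyperplanes" means an $\mathbb{F}_p$-linear combination of their characteristic functions. The support $\mathrm{supp}(c)$ of $c$ is the set of points $P$ with $c(P)\neq 0$, and $\mathrm{wt}(c):=|\mathrm{supp}(c)|$. -}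

module Defs where

open import Level using (0ℓ)
open import Algebra.Bundles using (CommutativeRing)
open import Data.Bool using (Bool; true; false; _∧_; _∨_; not; T)
open import Data.Nat using (ℕ; zero; suc; _+_; _*_; _∸_; _≤_; _/_; _%_)
open import Data.List using (List; []; _∷_; map; concatMap; length; filterᵇ; foldr)
open import Data.List.Relation.Unary.All using (All)
open import Data.List.Relation.Unary.Any using (Any)
open import Data.List.Relation.Unary.AllPairs using (AllPairs)
open import Data.Vec using (Vec; []; _∷_; zipWith)
open import Data.Vec.Relation.Binary.Pointwise.Inductive using (Pointwise)
open import Data.Product using (Σ; ∃; _×_; _,_; proj₁; proj₂)
open import Relation.Nullary using (¬_; does)
open import Relation.Binary using (Decidable)
open import Relation.Binary.PropositionalEquality using (_≡_)

record FiniteField : Set₁ where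
  field
    ring : CommutativeRing 0ℓ 0ℓ
  open CommutativeRing ring public
    using (Carrier; _≈_; 0#; 1#)
    renaming (_*_ to _*F_; _+_ to _+F_)
  field
    _≟_      : Decidable _≈_
    0≉1      : ¬ (0# ≈ 1#)
    inverse  : ∀ x → ¬ (x ≈ 0#) → ∃ λ y → (x *F y) ≈ 1#
    elems    : List Carrier
    complete : ∀ x → Any (x ≈_) elems
    distinct : AllPairs (λ x y → ¬ (x ≈ y)) elems

  order : ℕ
  order = length elems

θ : ℕ → ℕ → ℕ
θ q zero    = 1
θ q (suc m) = suc (q * θ q m)

-- ⌈ a / b ⌉ (b ≠ 0; value 0 for b = 0, never used)
ceilDiv : ℕ → ℕ → ℕ
ceilDiv a zero    = 0
ceilDiv a (suc b) = (a + b) / suc b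

-- x mod p (p ≠ 0; identity for p = 0, never used)
_mod_ : ℕ → ℕ → ℕ
x mod zero    = x
x mod (suc p) = x % suc p

_div2^_ : ℕ → ℕ → ℕ
x div2^ zero  = x
x div2^ suc k = (x div2^ k) / 2

private
  sqrtAux : ℕ → ℕ → ℕ
  sqrtAux zero    x = zero
  sqrtAux (suc k) x with does ((suc k * suc k) Data.Nat.≤? x)
  ... | true  = suc k
  ... | false = sqrtAux k x

floorSqrt : ℕ → ℕ
floorSqrt x = sqrtAux x x

module Projective (F : FiniteField) (n : ℕ) where
  open FiniteField F

  -- coordinates of PG(n,q): vectors in F^(n+1)
  Vect : Set
  Vect = Vec Carrier (suc n)

  allVecs : (k : ℕ) → List (Vec Carrier k)
  allVecs zero    = [] ∷ []
  allVecs (suc k) = concatMap (λ x → map (x ∷_) (allVecs k)) elems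

  -- normalized (canonical) representative of a projective point:
  -- nonzero vector whose first nonzero coordinate equals 1
  isNorm : ∀ {k} → Vec Carrier k → Bool
  isNorm []       = false
  isNorm (x ∷ xs) = does (x ≟ 1#) ∨ (does (x ≟ 0#) ∧ isNorm xs)

  points : List Vect
  points = filterᵇ isNorm (allVecs (suc n))

  SameVec : Vect → Vect → Set
  SameVec = Pointwise _≈_

  dot : ∀ {k} → Vec Carrier k → Vec Carrier k → Carrier
  dot []       []       = 0#
  dot (x ∷ xs) (y ∷ ys) = (x *F y) +F dot xs ys

  -- the hyperplane with normalized dual coordinates u contains the point v
  incident : Vect → Vect → Bool
  incident u v = does (dot u v ≟ 0#)

  charH : Vect → Vect → ℕ
  charH u v with incident u v
  ... | true  = 1
  ... | false = 0

  -- Functions from points to F_p are represented by ℕ-valued functions read mod p.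
  -- The combination Σ a_i · χ_{H_i} for a list of (coefficient, hyperplane) pairs:
  combo : List (ℕ × Vect) → Vect → ℕ
  combo hs v = foldr (λ ah s → proj₁ ah * charH (proj₂ ah) v + s) 0 hs

  Represents : (p : ℕ) → (Vect → ℕ) → List (ℕ × Vect) → Set
  Represents p c hs = ∀ v → T (isNorm v) → (c v mod p) ≡ (combo hs v mod p)

  ValidHyps : List (ℕ × Vect) → Set
  ValidHyps hs = All (λ ah → T (isNorm (proj₂ ah))) hs

  InCode : (p : ℕ) → (Vect → ℕ) → Set
  InCode p c = Σ (List (ℕ × Vect)) λ hs → ValidHyps hs × Represents p c hs

  wt : (p : ℕ) → (Vect → ℕ) → ℕ
  wt p c = length (filterᵇ (λ v → not (does ((c v mod p) Data.Nat.≟ 0))) points)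

  LinCombOfExactly : (p : ℕ) → (Vect → ℕ) → ℕ → Set
  LinCombOfExactly p c k =
    Σ (List (ℕ × Vect)) λ hs →
      (length hs ≡ k) × ValidHyps hs
      × AllPairs (λ ah bh → ¬ SameVec (proj₂ ah) (proj₂ bh)) hs
      × All (λ ah → ¬ ((proj₁ ah mod p) ≡ 0)) hs
      × Represents p c hs

{-# OPTIONS --safe #-}
module Submission where

-- View a codeword as the function f(v) = Σ aᵢ [uᵢ·v = 0] on V = K^(n+1), K the field with q elements. Along parallel
-- lines v + xw, the moments Σ_x f(v + yv′ + xw) x^k are polynomials of degree at most k in y, since Σ_x x^k = 0 for
-- k < q − 1. A polynomial V(X,Y) vanishing on the support then yields, by counting coefficients, the inequality
-- s(q + 1 − s) ≤ |supp| for a line with s support points in a plane, and the same for f shifted by a constant on that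
-- line. Averaged over all planes through the line, a codeword of weight at most B θ_(n−1) with 4(B+1)² ≤ q differs from
-- any given constant a in at most B or at least q − B points of every line. As f has at most p ≤ √q values, every line
-- has a dominant value, and so has every subspace, because two random points span a random line. Starting from a point
-- of the support, subspaces with nonzero dominant value can be enlarged until they are hyperplanes; subtracting such a
-- hyperplane lowers the weight substantially. After at most 2B steps f is written with k ≤ 2B hyperplanes, and
-- inclusion–exclusion with k(k − 1) < q gives (k − 1) θ_(n−1) < wt(f) ≤ k θ_(n−1).

open import Defs
open import Algebra.Bundles using (CommutativeRing)
open import Algebra.Bundles.Raw using (RawRing)
open import Algebra.Morphism.Structures using (IsRingMonomorphism)
import Algebra.Morphism.RingMonomorphism as RingMonomorphism
import Algebra.Properties.Ring as RingProperties
import Algebra.Solver.Ring as RingSolver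
open import Algebra.Solver.Ring.AlmostCommutativeRing using (AlmostCommutativeRing; fromCommutativeRing; _-Raw-AlmostCommutative⟶_)
open import Algebra.Structures using (IsCommutativeMonoid; IsCommutativeRing)
open import Data.Bool using (Bool; true; false; T; _∧_; _∨_; not; if_then_else_)
open import Data.Empty using (⊥; ⊥-elim)
open import Data.Fin using (Fin; zero; suc)
import Data.Fin.Properties as Finₚ
open import Data.List using (List; []; _∷_; map; length; _++_; filter; filterᵇ; concatMap; cartesianProduct; cartesianProductWith; allFin; lookup)
open import Data.List.Membership.Propositional using (_∈_; _∉_; find; lose)
open import Data.List.Membership.Propositional.Properties using (∈-map⁺; ∈-map⁻; ∈-filter⁺; ∈-filter⁻; ∈-cartesianProduct⁺; ∈-cartesianProductWith⁺; ∈-++⁺ˡ; ∈-++⁺ʳ; ∈-allFin)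
open import Data.List.Properties using (length-++; length-map; length-tabulate; tabulate-lookup; map-tabulate)
open import Data.List.Relation.Unary.All as All using (All; []; _∷_)
import Data.List.Relation.Unary.All.Properties as Allₚ
open import Data.List.Relation.Unary.AllPairs as AllPairs using (AllPairs; []; _∷_)
import Data.List.Relation.Unary.AllPairs.Properties as AllPairsₚ
open import Data.List.Relation.Unary.Any as Any using (Any; here; there)
import Data.List.Relation.Unary.Any.Properties as Anyₚ
open import Data.List.Relation.Unary.Unique.Propositional using (Unique)
import Data.List.Relation.Unary.Unique.Propositional.Properties as Uniqueₚ
open import Data.Maybe using (Maybe; just; nothing)
open import Data.Nat using (ℕ; zero; suc; _+_; _*_; _∸_; _^_; _≤_; _<_; z≤n; s≤s; NonZero; pred; >-nonZero; >-nonZero⁻¹; _/_; _%_; _≤?_; _<ᵇ_)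
open import Data.Nat.Coprimality using (prime⇒coprime; coprime-Bézout)
open import Data.Nat.Divisibility using (divides-refl)
open import Data.Nat.DivMod using (m≡m%n+[m/n]*n; m%n<n; m<n*o⇒m/o<n; [m+kn]%n≡m%n; m<n⇒m%n≡m; m<n⇒m/n≡0; +-distrib-/-∣ʳ; m*n/n≡m; /-monoˡ-≤; m/n*n≤m; m/n≤m)
open import Data.Nat.GCD using (module Bézout)
open import Data.Nat.Induction using (<-rec)
open import Data.Nat.Primality using (Prime; prime⇒nonZero)
import Data.Nat.Properties as ℕₚ
open import Data.Nat.Solver using (module +-*-Solver)
open import Data.Product using (Σ; ∃; _×_; _,_; proj₁; proj₂)
open import Data.Sum using (_⊎_; inj₁; inj₂)
open import Data.Unit using (tt)
open import Data.Vec as Vec using (Vec; []; _∷_; zipWith)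
import Data.Vec.Properties as Vecₚ
open import Data.Vec.Relation.Binary.Pointwise.Inductive using (Pointwise; []; _∷_)
open import Function using (_∘_; id)
open import Level using (0ℓ)
open import Relation.Binary using (DecidableEquality)
open import Relation.Binary.Definitions using (tri<; tri≈; tri>)
open import Relation.Binary.PropositionalEquality using (_≡_; _≢_; refl; sym; trans; cong; cong₂; subst; module ≡-Reasoning)
open import Relation.Nullary using (¬_; Dec; yes; no; does)
open import Relation.Nullary.Decidable using (¬?; decidable-stable; _×-dec_)
open import Relation.Unary using (Decidable)

-- Finite sums

-- Counts run over all vectors of K^(n+1), the zero vector and degenerate planes included:
-- translations and scalings by nonzero factors are then bijections of the index set, and no
-- subspaces have to be enumerated. The zero vector lies on every hyperplane and is split off only
-- when vectors are compared with points, through the factor q - 1. Codewords enter the plane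
-- inequality only through their moments, a property closed under sums, scaling and restriction to
-- affine subspaces. The shift by a constant on one line makes all values a comparable: the case a =
-- 0 alone would give lines with many support points, but no common value on them. The main obstacle
-- is the passage from lines to hyperplanes: f is sparse, so most larger subspaces may have dominant
-- value 0, and one that keeps a nonzero value has to be found by contradiction. The bound 4(B + 1)²
-- ≤ q provides three margins: for the gap between B and q - B, for the pair count in this
-- contradiction, and for inclusion-exclusion with up to 2B hyperplanes.

record Enum (A : Set) : Set where
  infix 4 _≟_
  field
    list     : List A
    _≟_      : DecidableEquality A
    complete : ∀ x → x ∈ list
    unique   : Unique list

  search : {P : A → Set} → (∀ x → Dec (P x)) → Dec (∃ P)
  search P? with Any.any? P? list
  ... | yes a = let (x , _ , px) = find a in yes (x , px)
  ... | no ¬a = no λ { (x , px) → ¬a (lose (complete x) px) }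

  size : ℕ
  size = length list

-- General monoids, because both natural numbers and field elements are summed.
module Sum {C : Set} {_⊕_ : C → C → C} {ε : C} (M : IsCommutativeMonoid _≡_ _⊕_ ε) where
  open IsCommutativeMonoid M using (assoc; comm; identityˡ; identityʳ)

  infix 5 ∑
  ∑ : {A : Set} → List A → (A → C) → C
  ∑ []       f = ε
  ∑ (x ∷ xs) f = f x ⊕ ∑ xs f

  interchange : ∀ a b c d → (a ⊕ b) ⊕ (c ⊕ d) ≡ (a ⊕ c) ⊕ (b ⊕ d)
  interchange a b c d = begin
    (a ⊕ b) ⊕ (c ⊕ d) ≡⟨ assoc a b _ ⟩
    a ⊕ (b ⊕ (c ⊕ d)) ≡⟨ cong (a ⊕_) (sym (assoc b c d)) ⟩
    a ⊕ ((b ⊕ c) ⊕ d) ≡⟨ cong (λ t → a ⊕ (t ⊕ d)) (comm b c) ⟩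
    a ⊕ ((c ⊕ b) ⊕ d) ≡⟨ cong (a ⊕_) (assoc c b d) ⟩
    a ⊕ (c ⊕ (b ⊕ d)) ≡⟨ sym (assoc a c _) ⟩
    (a ⊕ c) ⊕ (b ⊕ d) ∎
    where open ≡-Reasoning

  module _ {A : Set} where
    ∑-cong-∈ : ∀ (xs : List A) {f g} → (∀ x → x ∈ xs → f x ≡ g x) → ∑ xs f ≡ ∑ xs g
    ∑-cong-∈ []       e = refl
    ∑-cong-∈ (x ∷ xs) e = cong₂ _⊕_ (e x (here refl)) (∑-cong-∈ xs λ y y∈ → e y (there y∈))

    ∑-cong : ∀ (xs : List A) {f g} → (∀ x → f x ≡ g x) → ∑ xs f ≡ ∑ xs g
    ∑-cong xs e = ∑-cong-∈ xs λ x _ → e x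

    ∑-ε : ∀ (xs : List A) → ∑ xs (λ _ → ε) ≡ ε
    ∑-ε []       = refl
    ∑-ε (x ∷ xs) = trans (identityˡ _) (∑-ε xs)

    ∑-zero : ∀ (xs : List A) {f} → (∀ x → x ∈ xs → f x ≡ ε) → ∑ xs f ≡ ε
    ∑-zero xs e = trans (∑-cong-∈ xs e) (∑-ε xs)

    ∑-⊕ : ∀ (xs : List A) f g → ∑ xs (λ x → f x ⊕ g x) ≡ ∑ xs f ⊕ ∑ xs g
    ∑-⊕ []       f g = sym (identityˡ ε)
    ∑-⊕ (x ∷ xs) f g = trans (cong ((f x ⊕ g x) ⊕_) (∑-⊕ xs f g)) (interchange _ _ _ _)

    ∑-++ : ∀ (xs ys : List A) f → ∑ (xs ++ ys) f ≡ ∑ xs f ⊕ ∑ ys f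
    ∑-++ []       ys f = sym (identityˡ _)
    ∑-++ (x ∷ xs) ys f = trans (cong (f x ⊕_) (∑-++ xs ys f)) (sym (assoc _ _ _))

    ∑-single : ∀ {xs : List A} {f a} → a ∈ xs → Unique xs → (∀ x → x ∈ xs → x ≢ a → f x ≡ ε) → ∑ xs f ≡ f a
    ∑-single {x ∷ xs} {f} (here refl) (x# ∷ _) z =
      trans (cong (f x ⊕_) (∑-zero xs λ y y∈ → z y (there y∈) λ { refl → All.lookup x# y∈ refl })) (identityʳ _)
    ∑-single {x ∷ xs} {f} (there a∈) (x# ∷ xs!) z =
      trans (cong₂ _⊕_ (z x (here refl) λ { refl → All.lookup x# a∈ refl })
                       (∑-single a∈ xs! λ y y∈ → z y (there y∈))) (identityˡ _)

  module _ {A B : Set} where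
    ∑-map : ∀ (h : A → B) xs f → ∑ (map h xs) f ≡ ∑ xs (f ∘ h)
    ∑-map h []       f = refl
    ∑-map h (x ∷ xs) f = cong (f (h x) ⊕_) (∑-map h xs f)

    ∑-swap : ∀ (xs : List A) (ys : List B) (f : A → B → C) → ∑ xs (λ x → ∑ ys (f x)) ≡ ∑ ys (λ y → ∑ xs (λ x → f x y))
    ∑-swap []       ys f = sym (∑-ε ys)
    ∑-swap (x ∷ xs) ys f = trans (cong (∑ ys (f x) ⊕_) (∑-swap xs ys f)) (sym (∑-⊕ ys (f x) _))

  ∑-product : ∀ {A B D : Set} (h : A → B → D) xs ys f →
              ∑ (cartesianProductWith h xs ys) f ≡ ∑ xs (λ x → ∑ ys (λ y → f (h x y)))
  ∑-product h []       ys f = refl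
  ∑-product h (x ∷ xs) ys f = trans (∑-++ (map (h x) ys) _ f)
    (cong₂ _⊕_ (∑-map (h x) ys f) (∑-product h xs ys f))

  module _ {A : Set} (E : Enum A) where
    open Enum E

    pick : A → (A → C) → A → C
    pick a f x = if does (x ≟ a) then f x else ε

    pick-same : ∀ a f → pick a f a ≡ f a
    pick-same a f with a ≟ a
    ... | yes _ = refl
    ... | no ne = ⊥-elim (ne refl)

    pick-other : ∀ a f x → x ≢ a → pick a f x ≡ ε
    pick-other a f x ne with x ≟ a
    ... | yes e = ⊥-elim (ne e)
    ... | no _ = refl

    ∑-pick : ∀ a f → ∑ list (pick a f) ≡ f a
    ∑-pick a f = trans (∑-single (complete a) unique λ x _ → pick-other a f x) (pick-same a f)

    -- Double counting: f (σ x) is spread out as a sum over z supported at z = σ x, and then the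
    -- column of z has its only entry at x = τ z.
    ∑-bijection : ∀ (σ τ : A → A) → (∀ x → σ (τ x) ≡ x) → (∀ x → τ (σ x) ≡ x) →
                  ∀ f → ∑ list (f ∘ σ) ≡ ∑ list f
    ∑-bijection σ τ στ τσ f = begin
      ∑ list (f ∘ σ)  ≡⟨ ∑-cong list (λ x → sym (∑-pick (σ x) f)) ⟩
      ∑ list (λ x → ∑ list (λ z → pick (σ x) f z))  ≡⟨ ∑-swap list list _ ⟩
      ∑ list (λ z → ∑ list (λ x → pick (σ x) f z))  ≡⟨ ∑-cong list column ⟩
      ∑ list f ∎
      where
      open ≡-Reasoning
      column : ∀ z → ∑ list (λ x → pick (σ x) f z) ≡ f z
      column z = trans (∑-single (complete (τ z)) unique
          λ x _ ne → pick-other (σ x) f z λ e → ne (trans (sym (τσ x)) (cong τ (sym e))))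
        (trans (cong (λ a → pick a f z) (στ z)) (pick-same z f))

open Sum ℕₚ.+-0-isCommutativeMonoid public

∑-*ˡ : {A : Set} (xs : List A) (c : ℕ) (f : A → ℕ) → ∑ xs (λ x → c * f x) ≡ c * ∑ xs f
∑-*ˡ []       c f = sym (ℕₚ.*-zeroʳ c)
∑-*ˡ (x ∷ xs) c f = trans (cong (c * f x +_) (∑-*ˡ xs c f)) (sym (ℕₚ.*-distribˡ-+ c (f x) _))

∑-*ʳ : {A : Set} (xs : List A) (c : ℕ) (f : A → ℕ) → ∑ xs (λ x → f x * c) ≡ ∑ xs f * c
∑-*ʳ xs c f = trans (∑-cong xs λ x → ℕₚ.*-comm (f x) c) (trans (∑-*ˡ xs c f) (ℕₚ.*-comm c _))

∑-const : {A : Set} (xs : List A) (c : ℕ) → ∑ xs (λ _ → c) ≡ length xs * c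
∑-const []       c = refl
∑-const (x ∷ xs) c = cong (c +_) (∑-const xs c)

∑-mono : {A : Set} (xs : List A) {f g : A → ℕ} → (∀ x → f x ≤ g x) → ∑ xs f ≤ ∑ xs g
∑-mono []       le = z≤n
∑-mono (x ∷ xs) le = ℕₚ.+-mono-≤ (le x) (∑-mono xs le)

∑-≤-const : {A : Set} (xs : List A) {f : A → ℕ} {c : ℕ} → (∀ x → f x ≤ c) → ∑ xs f ≤ length xs * c
∑-≤-const xs {c = c} le = subst (_ ≤_) (∑-const xs c) (∑-mono xs le)

term≤∑ : {A : Set} {xs : List A} {f : A → ℕ} {a : A} → a ∈ xs → f a ≤ ∑ xs f
term≤∑ (here refl) = ℕₚ.m≤m+n _ _
term≤∑ (there a∈)  = ℕₚ.≤-trans (term≤∑ a∈) (ℕₚ.m≤n+m _ _)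

[_] : Bool → ℕ
[ true ]  = 1
[ false ] = 0

[yes] : {P : Set} (P? : Dec P) → P → [ does P? ] ≡ 1
[yes] (yes _) p = refl
[yes] (no ¬p) p = ⊥-elim (¬p p)

[no] : {P : Set} (P? : Dec P) → ¬ P → [ does P? ] ≡ 0
[no] (yes p) ¬p = ⊥-elim (¬p p)
[no] (no _)  ¬p = refl

[]≤1 : ∀ b → [ b ] ≤ 1
[]≤1 true  = ℕₚ.≤-refl
[]≤1 false = z≤n

[¬]+[] : {P : Set} (P? : Dec P) → [ does (¬? P?) ] + [ does P? ] ≡ 1
[¬]+[] (yes _) = refl
[¬]+[] (no _)  = refl

[_]-mono : {P Q : Set} (P? : Dec P) (Q? : Dec Q) → (P → Q) → [ does P? ] ≤ [ does Q? ]
[ no _ ]-mono Q? h = z≤n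
[ yes p ]-mono Q? h = ℕₚ.≤-reflexive (sym ([yes] Q? (h p)))

[_]-cong : {P Q : Set} (P? : Dec P) (Q? : Dec Q) → (P → Q) → (Q → P) → [ does P? ] ≡ [ does Q? ]
[ P? ]-cong Q? h k = ℕₚ.≤-antisym ([ P? ]-mono Q? h) ([ Q? ]-mono P? k)

vecs : {A : Set} → List A → (k : ℕ) → List (Vec A k)
vecs xs zero    = [] ∷ []
vecs xs (suc k) = cartesianProductWith _∷_ xs (vecs xs k)

length-product : ∀ {A B D : Set} (h : A → B → D) xs ys → length (cartesianProductWith h xs ys) ≡ length xs * length ys
length-product h []       ys = refl
length-product h (x ∷ xs) ys = trans (length-++ (map (h x) ys)) (cong₂ _+_ (length-map (h x) ys) (length-product h xs ys))

length-vecs : {A : Set} (xs : List A) (k : ℕ) → length (vecs xs k) ≡ length xs ^ k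
length-vecs xs zero    = refl
length-vecs xs (suc k) = trans (length-product _∷_ xs (vecs xs k)) (cong (length xs *_) (length-vecs xs k))

Vec-enum : {A : Set} → Enum A → (k : ℕ) → Enum (Vec A k)
Vec-enum {A} E k = record
  { list = vecs list k ; _≟_ = Vecₚ.≡-dec _≟_ ; complete = all ; unique = uniq k }
  where
  open Enum E
  all : ∀ {k} (v : Vec A k) → v ∈ vecs list k
  all []      = here refl
  all (x ∷ v) = ∈-cartesianProductWith⁺ _∷_ (complete x) (all v)
  uniq : ∀ k → Unique (vecs list k)
  uniq zero    = [] ∷ []
  uniq (suc k) = Uniqueₚ.cartesianProductWith⁺ _∷_ Vecₚ.∷-injective unique (uniq k)

-- Finite fields

-- Propositional equality, unlike the setoid equality of `FiniteField`, allows rewriting under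
-- arbitrary functions on K; `Transfer` supplies such a copy.
record Field : Set₁ where
  infixl 6 _⊕_
  infixl 7 _⊗_
  infix  8 ⊖_
  field
    K                 : Set
    _⊕_ _⊗_           : K → K → K
    ⊖_                : K → K
    𝟘 𝟙               : K
    isCommutativeRing : IsCommutativeRing _≡_ _⊕_ _⊗_ ⊖_ 𝟘 𝟙
    enum              : Enum K
    𝟘≢𝟙               : 𝟘 ≢ 𝟙
    invertible        : ∀ x → x ≢ 𝟘 → ∃ λ y → x ⊗ y ≡ 𝟙

  open Enum enum public using (_≟_) renaming (list to elems; complete to ∈-elems; unique to elems-unique; size to q)
  open IsCommutativeRing isCommutativeRing public
    using (+-isCommutativeMonoid; +-assoc; +-comm; +-identityˡ; +-identityʳ; *-assoc; *-comm;
           *-identityˡ; *-identityʳ; distribˡ; distribʳ; zeroˡ; zeroʳ; -‿inverseˡ; -‿inverseʳ)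

  commutativeRing : CommutativeRing 0ℓ 0ℓ
  commutativeRing = record { isCommutativeRing = isCommutativeRing }

  ι : ℕ → K
  ι zero    = 𝟘
  ι (suc m) = 𝟙 ⊕ ι m

  ι-+ : ∀ m n → ι (m + n) ≡ ι m ⊕ ι n
  ι-+ zero    n = sym (+-identityˡ _)
  ι-+ (suc m) n = trans (cong (𝟙 ⊕_) (ι-+ m n)) (sym (+-assoc _ _ _))

  ι-* : ∀ m n → ι (m * n) ≡ ι m ⊗ ι n
  ι-* zero    n = sym (zeroˡ _)
  ι-* (suc m) n = begin
    ι (n + m * n)  ≡⟨ ι-+ n (m * n) ⟩
    ι n ⊕ ι (m * n)  ≡⟨ cong₂ _⊕_ (sym (*-identityˡ _)) (ι-* m n) ⟩
    𝟙 ⊗ ι n ⊕ ι m ⊗ ι n  ≡⟨ sym (distribʳ _ _ _) ⟩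
    (𝟙 ⊕ ι m) ⊗ ι n ∎
    where open ≡-Reasoning

module Solver (𝔽 : Field) where
  open Field 𝔽
  open RingProperties (CommutativeRing.ring commutativeRing) using (-‿+-comm; -‿involutive; -‿distribˡ-*; -‿distribʳ-*; -0#≈0#)
  open Sum +-isCommutativeMonoid using () renaming (interchange to ⊕-interchange)

  -- Formal differences, so that the ring solver can cancel opposite terms.
  differences : RawRing 0ℓ 0ℓ
  differences = record
    { Carrier = ℕ × ℕ
    ; _≈_     = _≡_
    ; _+_     = λ (a , b) (c , d) → a + c , b + d
    ; _*_     = λ (a , b) (c , d) → a * c + b * d , a * d + b * c
    ; -_      = λ (a , b) → b , a
    ; 0#      = 0 , 0
    ; 1#      = 1 , 0
    }

  ⟦_⟧ : ℕ × ℕ → K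
  ⟦ a , b ⟧ = ι a ⊕ ⊖ ι b

  target : AlmostCommutativeRing 0ℓ 0ℓ
  target = fromCommutativeRing commutativeRing

  open ≡-Reasoning

  ⟦⟧-morphism : differences -Raw-AlmostCommutative⟶ target
  ⟦⟧-morphism = record
    { ⟦_⟧    = ⟦_⟧
    ; +-homo = λ (a , b) (c , d) → begin
        ι (a + c) ⊕ ⊖ ι (b + d)  ≡⟨ cong₂ (λ x y → x ⊕ ⊖ y) (ι-+ a c) (ι-+ b d) ⟩
        (ι a ⊕ ι c) ⊕ ⊖ (ι b ⊕ ι d)  ≡⟨ cong ((ι a ⊕ ι c) ⊕_) (sym (-‿+-comm _ _)) ⟩
        (ι a ⊕ ι c) ⊕ (⊖ ι b ⊕ ⊖ ι d)  ≡⟨ ⊕-interchange _ _ _ _ ⟩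
        (ι a ⊕ ⊖ ι b) ⊕ (ι c ⊕ ⊖ ι d) ∎
    ; *-homo = λ (a , b) (c , d) → begin
        ι (a * c + b * d) ⊕ ⊖ ι (a * d + b * c)
          ≡⟨ cong₂ (λ x y → x ⊕ ⊖ y) (ι-+*+* a c b d) (ι-+*+* a d b c) ⟩
        (ι a ⊗ ι c ⊕ ι b ⊗ ι d) ⊕ ⊖ (ι a ⊗ ι d ⊕ ι b ⊗ ι c)
          ≡⟨ cong ((ι a ⊗ ι c ⊕ ι b ⊗ ι d) ⊕_) (sym (-‿+-comm _ _)) ⟩
        (ι a ⊗ ι c ⊕ ι b ⊗ ι d) ⊕ (⊖ (ι a ⊗ ι d) ⊕ ⊖ (ι b ⊗ ι c))
          ≡⟨ cong₂ (λ x y → (ι a ⊗ ι c ⊕ x) ⊕ (y ⊕ ⊖ (ι b ⊗ ι c)))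
               (trans (sym (-‿involutive _)) (trans (cong ⊖_ (-‿distribˡ-* _ _)) (-‿distribʳ-* _ _)))
               (-‿distribʳ-* _ _) ⟩
        (ι a ⊗ ι c ⊕ ⊖ ι b ⊗ ⊖ ι d) ⊕ (ι a ⊗ ⊖ ι d ⊕ ⊖ (ι b ⊗ ι c))
          ≡⟨ cong ((ι a ⊗ ι c ⊕ ⊖ ι b ⊗ ⊖ ι d) ⊕_) (cong (ι a ⊗ ⊖ ι d ⊕_) (-‿distribˡ-* _ _)) ⟩
        (ι a ⊗ ι c ⊕ ⊖ ι b ⊗ ⊖ ι d) ⊕ (ι a ⊗ ⊖ ι d ⊕ ⊖ ι b ⊗ ι c)
          ≡⟨ cong ((ι a ⊗ ι c ⊕ ⊖ ι b ⊗ ⊖ ι d) ⊕_) (+-comm _ _) ⟩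
        (ι a ⊗ ι c ⊕ ⊖ ι b ⊗ ⊖ ι d) ⊕ (⊖ ι b ⊗ ι c ⊕ ι a ⊗ ⊖ ι d)
          ≡⟨ ⊕-interchange _ _ _ _ ⟩
        (ι a ⊗ ι c ⊕ ⊖ ι b ⊗ ι c) ⊕ (⊖ ι b ⊗ ⊖ ι d ⊕ ι a ⊗ ⊖ ι d)
          ≡⟨ cong₂ _⊕_ (sym (distribʳ _ _ _)) (trans (+-comm _ _) (sym (distribʳ _ _ _))) ⟩
        (ι a ⊕ ⊖ ι b) ⊗ ι c ⊕ (ι a ⊕ ⊖ ι b) ⊗ ⊖ ι d
          ≡⟨ sym (distribˡ _ _ _) ⟩
        (ι a ⊕ ⊖ ι b) ⊗ (ι c ⊕ ⊖ ι d) ∎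
    ; -‿homo = λ (a , b) → begin
        ι b ⊕ ⊖ ι a  ≡⟨ +-comm _ _ ⟩
        ⊖ ι a ⊕ ι b  ≡⟨ cong (⊖ ι a ⊕_) (sym (-‿involutive _)) ⟩
        ⊖ ι a ⊕ ⊖ ⊖ ι b  ≡⟨ -‿+-comm _ _ ⟩
        ⊖ (ι a ⊕ ⊖ ι b) ∎
    ; 0-homo = -‿inverseʳ 𝟘
    ; 1-homo = trans (cong₂ _⊕_ (+-identityʳ _) -0#≈0#) (+-identityʳ _)
    }
    where
    ι-+*+* : ∀ a c b d → ι (a * c + b * d) ≡ ι a ⊗ ι c ⊕ ι b ⊗ ι d
    ι-+*+* a c b d = trans (ι-+ (a * c) _) (cong₂ _⊕_ (ι-* a c) (ι-* b d))

  -- Only equality as integers is tested: coefficients that agree merely modulo the characteristic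
  -- count as undecided.
  decide : ∀ x y → Maybe (⟦ x ⟧ ≡ ⟦ y ⟧)
  decide (a , b) (c , d) with a + d ℕₚ.≟ c + b
  ... | no _  = nothing
  ... | yes e = just (begin
    ι a ⊕ ⊖ ι b  ≡⟨ cong (_⊕ ⊖ ι b) (sym (trans (cong (ι a ⊕_) (-‿inverseʳ _)) (+-identityʳ _))) ⟩
    ι a ⊕ (ι d ⊕ ⊖ ι d) ⊕ ⊖ ι b  ≡⟨ cong (_⊕ ⊖ ι b) (sym (+-assoc _ _ _)) ⟩
    ι a ⊕ ι d ⊕ ⊖ ι d ⊕ ⊖ ι b  ≡⟨ cong (λ t → t ⊕ ⊖ ι d ⊕ ⊖ ι b) (trans (sym (ι-+ a d)) (trans (cong ι e) (ι-+ c b))) ⟩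
    ι c ⊕ ι b ⊕ ⊖ ι d ⊕ ⊖ ι b  ≡⟨ +-assoc _ _ _ ⟩
    ι c ⊕ ι b ⊕ (⊖ ι d ⊕ ⊖ ι b)  ≡⟨ ⊕-interchange _ _ _ _ ⟩
    ι c ⊕ ⊖ ι d ⊕ (ι b ⊕ ⊖ ι b)  ≡⟨ trans (cong (ι c ⊕ ⊖ ι d ⊕_) (-‿inverseʳ _)) (+-identityʳ _) ⟩
    ι c ⊕ ⊖ ι d ∎)

  open RingSolver differences target ⟦⟧-morphism decide public
    using (solve; _:=_; _:+_; _:*_; :-_; con)

range : ℕ → List ℕ
range zero    = []
range (suc n) = zero ∷ map suc (range n)

length-range : ∀ n → length (range n) ≡ n
length-range zero    = refl
length-range (suc n) = cong suc (trans (length-map suc (range n)) (length-range n))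

∈-range⁺ : ∀ {i n} → i < n → i ∈ range n
∈-range⁺ {zero}  {suc n} _         = here refl
∈-range⁺ {suc i} {suc n} (s≤s i<n) = there (∈-map⁺ suc (∈-range⁺ i<n))

∈-range⁻ : ∀ {i n} → i ∈ range n → i < n
∈-range⁻ {n = suc n} (here refl) = s≤s z≤n
∈-range⁻ {n = suc n} (there i∈) with ∈-map⁻ suc i∈
... | _ , j∈ , refl = s≤s (∈-range⁻ j∈)

-- The last component stands in for a permutation of the list: what holds at the chosen element and
-- on the rest holds everywhere.
extract : {A : Set} {P : A → Set} {xs : List A} → Any P xs →
          ∃ λ x → ∃ λ rest → P x × length xs ≡ suc (length rest) × (∀ {Q : A → Set} → Q x → All Q rest → All Q xs)
extract {xs = x ∷ xs} (here px) = x , xs , px , refl , _∷_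
extract {xs = y ∷ xs} (there a) =
  let (x , rest , px , len , back) = extract a
  in x , y ∷ rest , px , cong suc len , λ { qx (qy ∷ qs) → qy ∷ back qx qs }

remove : {A : Set} {z : A} {xs : List A} → z ∈ xs → Unique xs →
         ∃ λ rest → length xs ≡ suc (length rest) × z ∉ rest × (∀ w → w ∈ xs → w ≢ z → w ∈ rest)
remove {xs = z ∷ xs} (here refl) (z# ∷ _) = xs , refl , (λ z∈ → All.lookup z# z∈ refl) ,
  λ { w (here refl) w≢z → ⊥-elim (w≢z refl) ; w (there w∈) _ → w∈ }
remove {xs = x ∷ xs} (there z∈) (x# ∷ xs!) =
  let (rest , len , z∉ , keep) = remove z∈ xs!
  in x ∷ rest , cong suc len ,
     (λ { (here refl) → All.lookup x# z∈ refl ; (there z∈′) → z∉ z∈′ }) ,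
     λ { w (here refl) _ → here refl ; w (there w∈) w≢z → there (keep w w∈ w≢z) }

-- Polynomials and linear systems over a finite field

module Polynomials (𝔽 : Field) where
  open Field 𝔽
  open Solver 𝔽
  module Σᴷ = Sum +-isCommutativeMonoid
  open ≡-Reasoning

  ⊗-cancel : ∀ {x y} → x ≢ 𝟘 → x ⊗ y ≡ 𝟘 → y ≡ 𝟘
  ⊗-cancel {x} {y} x≢0 xy≡0 = let (i , xi≡1) = invertible x x≢0 in begin
    y  ≡⟨ sym (*-identityˡ y) ⟩
    𝟙 ⊗ y  ≡⟨ cong (_⊗ y) (sym xi≡1) ⟩
    x ⊗ i ⊗ y  ≡⟨ solve 3 (λ x i y → x :* i :* y := i :* (x :* y)) refl x i y ⟩
    i ⊗ (x ⊗ y) ≡⟨ trans (cong (i ⊗_) xy≡0) (zeroʳ i) ⟩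
    𝟘 ∎

  ⊗-≢𝟘 : ∀ {x y} → x ≢ 𝟘 → y ≢ 𝟘 → x ⊗ y ≢ 𝟘
  ⊗-≢𝟘 x≢0 y≢0 e = y≢0 (⊗-cancel x≢0 e)

  ⊖-≡𝟘 : ∀ {x y} → x ⊕ ⊖ y ≡ 𝟘 → x ≡ y
  ⊖-≡𝟘 {x} {y} e = begin
    x  ≡⟨ solve 2 (λ x y → x := (x :+ :- y) :+ y) refl x y ⟩
    x ⊕ ⊖ y ⊕ y ≡⟨ trans (cong (_⊕ y) e) (+-identityˡ y) ⟩
    y ∎

  ⊗-cancel-difference : ∀ {x y z} → x ≢ y → x ⊗ z ≡ y ⊗ z → z ≡ 𝟘
  ⊗-cancel-difference {x} {y} {z} x≢y e = ⊗-cancel (x≢y ∘ ⊖-≡𝟘) (begin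
    (x ⊕ ⊖ y) ⊗ z  ≡⟨ solve 3 (λ x y z → (x :+ :- y) :* z := x :* z :+ :- (y :* z)) refl x y z ⟩
    x ⊗ z ⊕ ⊖ (y ⊗ z)  ≡⟨ cong (_⊕ ⊖ (y ⊗ z)) e ⟩
    y ⊗ z ⊕ ⊖ (y ⊗ z)  ≡⟨ -‿inverseʳ _ ⟩
    𝟘 ∎)

  Σᴷ-⊗ˡ : {A : Set} (xs : List A) (c : K) (f : A → K) → Σᴷ.∑ xs (λ x → c ⊗ f x) ≡ c ⊗ Σᴷ.∑ xs f
  Σᴷ-⊗ˡ []       c f = sym (zeroʳ c)
  Σᴷ-⊗ˡ (x ∷ xs) c f = trans (cong (c ⊗ f x ⊕_) (Σᴷ-⊗ˡ xs c f)) (sym (distribˡ c _ _))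

  Σᴷ-⊗ʳ : {A : Set} (xs : List A) (c : K) (f : A → K) → Σᴷ.∑ xs (λ x → f x ⊗ c) ≡ Σᴷ.∑ xs f ⊗ c
  Σᴷ-⊗ʳ xs c f = trans (Σᴷ.∑-cong xs λ x → *-comm (f x) c) (trans (Σᴷ-⊗ˡ xs c f) (*-comm c _))

  Σᴷ-one : {A : Set} (xs : List A) → Σᴷ.∑ xs (λ _ → 𝟙) ≡ ι (length xs)
  Σᴷ-one []       = refl
  Σᴷ-one (x ∷ xs) = cong (𝟙 ⊕_) (Σᴷ-one xs)

  ∑< : ℕ → (ℕ → K) → K
  ∑< n f = Σᴷ.∑ (range n) f

  ∑<-suc : ∀ n f → ∑< (suc n) f ≡ f 0 ⊕ ∑< n (f ∘ suc)
  ∑<-suc n f = cong (f 0 ⊕_) (Σᴷ.∑-map suc (range n) f)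

  ∑<-cong : ∀ n {f g} → (∀ i → i < n → f i ≡ g i) → ∑< n f ≡ ∑< n g
  ∑<-cong n e = Σᴷ.∑-cong-∈ (range n) λ i i∈ → e i (∈-range⁻ i∈)

  ∑<-zero : ∀ n {f} → (∀ i → i < n → f i ≡ 𝟘) → ∑< n f ≡ 𝟘
  ∑<-zero n e = Σᴷ.∑-zero (range n) λ i i∈ → e i (∈-range⁻ i∈)

  -- Gaussian elimination. If no equation involves the first unknown, it is set to 1 and all others
  -- to 0; otherwise a pivot equation eliminates it from the rest, and both numbers drop by one.
  underdetermined : ∀ m (rows : List (ℕ → K)) → length rows < m →
    Σ (ℕ → K) λ x → (∃ λ k → k < m × x k ≢ 𝟘) × All (λ φ → ∑< m (λ k → φ k ⊗ x k) ≡ 𝟘) rows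
  underdetermined (suc m) rows len with Any.any? (λ φ → ¬? (φ 0 ≟ 𝟘)) rows
  ... | no none = x , (0 , s≤s z≤n , λ e → 𝟘≢𝟙 (sym e)) ,
          All.tabulate λ {φ} φ∈ → trans (∑<-suc m _) (begin
            φ 0 ⊗ 𝟙 ⊕ ∑< m (λ k → φ (suc k) ⊗ 𝟘)
              ≡⟨ cong₂ _⊕_ (trans (*-identityʳ _) (decidable-stable (φ 0 ≟ 𝟘) λ ne → none (lose φ∈ ne)))
                           (∑<-zero m λ k _ → zeroʳ _) ⟩
            𝟘 ⊕ 𝟘 ≡⟨ +-identityˡ 𝟘 ⟩
            𝟘 ∎)
    where
    x : ℕ → K
    x zero    = 𝟙
    x (suc _) = 𝟘
  ... | yes some with extract some
  ... | φ , rest , φ0≢0 , len≡ , back = x , (suc k₀ , s≤s k₀< , xk₀≢0) ,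
          back (trans (∑<-suc m _) pivot) (All.tabulate λ {ψ} ψ∈ → trans (∑<-suc m _) (other ψ (All.lookup sols (∈-map⁺ reduce ψ∈))))
    where
    i = proj₁ (invertible (φ 0) φ0≢0)
    φ0i≡1 = proj₂ (invertible (φ 0) φ0≢0)
    c : (ℕ → K) → K
    c ψ = ⊖ (ψ 0 ⊗ i)
    reduce : (ℕ → K) → ℕ → K
    reduce ψ k = ψ (suc k) ⊕ c ψ ⊗ φ (suc k)
    rec = underdetermined m (map reduce rest)
            (subst (_< m) (sym (length-map reduce rest)) (ℕₚ.≤-pred (subst (_< suc m) len≡ len)))
    x′ = proj₁ rec
    k₀ = proj₁ (proj₁ (proj₂ rec))
    k₀< = proj₁ (proj₂ (proj₁ (proj₂ rec)))
    xk₀≢0 = proj₂ (proj₂ (proj₁ (proj₂ rec)))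
    sols = proj₂ (proj₂ rec)
    tail : (ℕ → K) → K
    tail ψ = ∑< m (λ k → ψ (suc k) ⊗ x′ k)
    x : ℕ → K
    x zero    = ⊖ (i ⊗ tail φ)
    x (suc k) = x′ k
    pivot : φ 0 ⊗ ⊖ (i ⊗ tail φ) ⊕ tail φ ≡ 𝟘
    pivot = begin
      φ 0 ⊗ ⊖ (i ⊗ tail φ) ⊕ tail φ  ≡⟨ solve 3 (λ a i t → a :* :- (i :* t) :+ t := :- (a :* i :* t) :+ t) refl _ _ _ ⟩
      ⊖ (φ 0 ⊗ i ⊗ tail φ) ⊕ tail φ  ≡⟨ cong (λ a → ⊖ (a ⊗ tail φ) ⊕ tail φ) φ0i≡1 ⟩
      ⊖ (𝟙 ⊗ tail φ) ⊕ tail φ  ≡⟨ cong (λ a → ⊖ a ⊕ tail φ) (*-identityˡ _) ⟩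
      ⊖ tail φ ⊕ tail φ  ≡⟨ -‿inverseˡ _ ⟩
      𝟘 ∎
    other : ∀ ψ → ∑< m (λ k → reduce ψ k ⊗ x′ k) ≡ 𝟘 → ψ 0 ⊗ ⊖ (i ⊗ tail φ) ⊕ tail ψ ≡ 𝟘
    other ψ e = begin
      ψ 0 ⊗ ⊖ (i ⊗ tail φ) ⊕ tail ψ  ≡⟨ solve 4 (λ a i t u → a :* :- (i :* t) :+ u := u :+ :- (a :* i) :* t) refl _ _ _ _ ⟩
      tail ψ ⊕ c ψ ⊗ tail φ  ≡⟨ cong (tail ψ ⊕_) (sym (Σᴷ-⊗ˡ (range m) (c ψ) _)) ⟩
      tail ψ ⊕ ∑< m (λ k → c ψ ⊗ (φ (suc k) ⊗ x′ k))  ≡⟨ sym (Σᴷ.∑-⊕ (range m) _ _) ⟩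
      ∑< m (λ k → ψ (suc k) ⊗ x′ k ⊕ c ψ ⊗ (φ (suc k) ⊗ x′ k))
        ≡⟨ ∑<-cong m (λ k _ → solve 4 (λ a c b x → a :* x :+ c :* (b :* x) := (a :+ c :* b) :* x) refl _ _ _ _) ⟩
      ∑< m (λ k → reduce ψ k ⊗ x′ k)  ≡⟨ e ⟩
      𝟘 ∎

  pow : K → ℕ → K
  pow x zero    = 𝟙
  pow x (suc i) = x ⊗ pow x i

  pow-+ : ∀ x i j → pow x (i + j) ≡ pow x i ⊗ pow x j
  pow-+ x zero    j = sym (*-identityˡ _)
  pow-+ x (suc i) j = trans (cong (x ⊗_) (pow-+ x i j)) (sym (*-assoc _ _ _))

  pow-⊗ : ∀ x y i → pow (x ⊗ y) i ≡ pow x i ⊗ pow y i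
  pow-⊗ x y zero    = sym (*-identityˡ _)
  pow-⊗ x y (suc i) = trans (cong (x ⊗ y ⊗_) (pow-⊗ x y i))
    (solve 4 (λ x y a b → x :* y :* (a :* b) := x :* a :* (y :* b)) refl x y _ _)

  -- eval n a is the polynomial function with coefficients a 0, …, a (n − 1).
  eval : ℕ → (ℕ → K) → K → K
  eval n a x = ∑< n (λ i → a i ⊗ pow x i)

  eval-suc : ∀ n a x → eval (suc n) a x ≡ a 0 ⊕ x ⊗ eval n (a ∘ suc) x
  eval-suc n a x = trans (∑<-suc n _) (cong₂ _⊕_ (*-identityʳ _)
    (trans (∑<-cong n λ i _ → solve 3 (λ a x p → a :* (x :* p) := x :* (a :* p)) refl _ x _) (Σᴷ-⊗ˡ (range n) x _)))

  eval-zero : ∀ n {a} x → (∀ i → i < n → a i ≡ 𝟘) → eval n a x ≡ 𝟘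
  eval-zero n x e = ∑<-zero n λ i i< → trans (cong (_⊗ pow x i) (e i i<)) (zeroˡ _)

  -- Division by X − y, with the negative terms moved across.
  division : ∀ n a y → ∃ λ b → (∀ x → eval (suc n) a x ⊕ y ⊗ eval n b x ≡ x ⊗ eval n b x ⊕ eval (suc n) a y)
    × ((∀ i → i < n → b i ≡ 𝟘) → ∀ i → i < n → a (suc i) ≡ 𝟘)
  division zero    a y = a , (λ x → trans (cong (eval 1 a x ⊕_) (zeroʳ y))
                                     (trans (+-comm _ _) (cong (_⊕ eval 1 a x) (sym (zeroʳ x))))) , λ _ _ ()
  division (suc n) a y = b , divides , vanishes
    where
    a′ = a ∘ suc
    rec = division n a′ y
    b′ = proj₁ rec
    b : ℕ → K
    b zero    = eval (suc n) a′ y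
    b (suc i) = b′ i
    divides : ∀ x → eval (2 + n) a x ⊕ y ⊗ eval (suc n) b x ≡ x ⊗ eval (suc n) b x ⊕ eval (2 + n) a y
    divides x = begin
      eval (2 + n) a x ⊕ y ⊗ eval (suc n) b x
        ≡⟨ cong₂ (λ s t → s ⊕ y ⊗ t) (eval-suc (suc n) a x) (eval-suc n b x) ⟩
      a 0 ⊕ x ⊗ A x ⊕ y ⊗ (A y ⊕ x ⊗ B)
        ≡⟨ solve 6 (λ a x y Ax Ay B → a :+ x :* Ax :+ y :* (Ay :+ x :* B) := a :+ y :* Ay :+ x :* (Ax :+ y :* B)) refl _ _ _ _ _ _ ⟩
      a 0 ⊕ y ⊗ A y ⊕ x ⊗ (A x ⊕ y ⊗ B)
        ≡⟨ cong (λ t → a 0 ⊕ y ⊗ A y ⊕ x ⊗ t) (proj₁ (proj₂ rec) x) ⟩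
      a 0 ⊕ y ⊗ A y ⊕ x ⊗ (x ⊗ B ⊕ A y)
        ≡⟨ solve 5 (λ a x y Ay B → a :+ y :* Ay :+ x :* (x :* B :+ Ay) := x :* (Ay :+ x :* B) :+ (a :+ y :* Ay)) refl _ _ _ _ _ ⟩
      x ⊗ (A y ⊕ x ⊗ B) ⊕ (a 0 ⊕ y ⊗ A y)
        ≡⟨ sym (cong₂ (λ s t → x ⊗ s ⊕ t) (eval-suc n b x) (eval-suc (suc n) a y)) ⟩
      x ⊗ eval (suc n) b x ⊕ eval (2 + n) a y ∎
      where
      A = eval (suc n) a′
      B = eval n b′ x
    vanishes : (∀ i → i < suc n → b i ≡ 𝟘) → ∀ i → i < suc n → a (suc i) ≡ 𝟘
    vanishes b≡0 (suc i) (s≤s i<) = proj₂ (proj₂ rec) (λ j j< → b≡0 (suc j) (s≤s j<)) i i<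
    vanishes b≡0 zero    _        = begin
      a 1  ≡⟨ sym (+-identityʳ _) ⟩
      a 1 ⊕ 𝟘  ≡⟨ cong (a 1 ⊕_) (sym (zeroʳ y)) ⟩
      a 1 ⊕ y ⊗ 𝟘  ≡⟨ cong (λ t → a 1 ⊕ y ⊗ t) (sym (eval-zero n y λ j j< →
                        proj₂ (proj₂ rec) (λ l l< → b≡0 (suc l) (s≤s l<)) j j<)) ⟩
      a 1 ⊕ y ⊗ eval n (a′ ∘ suc) y  ≡⟨ sym (eval-suc n a′ y) ⟩
      eval (suc n) a′ y  ≡⟨ b≡0 0 (s≤s z≤n) ⟩
      𝟘 ∎

  -- After division by X - y for one root y, the quotient vanishes at the other roots, so its
  -- coefficients are zero by induction; only the constant term is left, and the root y kills it.
  roots⇒zero : ∀ n a {xs} → Unique xs → n ≤ length xs → (∀ x → x ∈ xs → eval n a x ≡ 𝟘) → ∀ i → i < n → a i ≡ 𝟘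
  roots⇒zero (suc n) a {y ∷ ys} (y# ∷ ys!) (s≤s n≤) root = λ
    { (suc i) (s≤s i<) → tail≡0 i i<
    ; zero    _ → begin
        a 0  ≡⟨ sym (trans (cong (a 0 ⊕_) (trans (cong (y ⊗_) (eval-zero n y tail≡0)) (zeroʳ y))) (+-identityʳ _)) ⟩
        a 0 ⊕ y ⊗ eval n (a ∘ suc) y  ≡⟨ sym (eval-suc n a y) ⟩
        eval (suc n) a y  ≡⟨ root y (here refl) ⟩
        𝟘 ∎ }
    where
    div = division n a y
    b = proj₁ div
    root′ : ∀ x → x ∈ ys → eval n b x ≡ 𝟘
    root′ x x∈ = ⊗-cancel-difference {y} {x} (λ { refl → All.lookup y# x∈ refl }) (begin
      y ⊗ eval n b x  ≡⟨ sym (+-identityˡ _) ⟩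
      𝟘 ⊕ y ⊗ eval n b x  ≡⟨ cong (_⊕ y ⊗ eval n b x) (sym (root x (there x∈))) ⟩
      eval (suc n) a x ⊕ y ⊗ eval n b x  ≡⟨ proj₁ (proj₂ div) x ⟩
      x ⊗ eval n b x ⊕ eval (suc n) a y  ≡⟨ trans (cong (x ⊗ eval n b x ⊕_) (root y (here refl))) (+-identityʳ _) ⟩
      x ⊗ eval n b x ∎)
    tail≡0 = proj₂ (proj₂ div) (roots⇒zero n b ys! n≤ root′)

-- Interpolation, Vandermonde systems and power sums

module Interpolation (𝔽 : Field) where
  open Field 𝔽
  open Solver 𝔽
  open Polynomials 𝔽 public
  open ≡-Reasoning

  -- `eval n` ignores the coefficients from index n on; setting them to zero makes degree bounds
  -- visible in the coefficient sequence itself.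
  truncate : ℕ → (ℕ → K) → ℕ → K
  truncate zero    a i       = 𝟘
  truncate (suc n) a zero    = a 0
  truncate (suc n) a (suc i) = truncate n (a ∘ suc) i

  truncate-≥ : ∀ n a i → n ≤ i → truncate n a i ≡ 𝟘
  truncate-≥ zero    a i       _         = refl
  truncate-≥ (suc n) a (suc i) (s≤s n≤i) = truncate-≥ n (a ∘ suc) i n≤i

  eval-truncate : ∀ n m a x → n ≤ m → eval m (truncate n a) x ≡ eval n a x
  eval-truncate zero    m       a x _         = eval-zero m x λ _ _ → refl
  eval-truncate (suc n) (suc m) a x (s≤s n≤m) = begin
    eval (suc m) (truncate (suc n) a) x  ≡⟨ eval-suc m _ x ⟩
    a 0 ⊕ x ⊗ eval m (truncate n (a ∘ suc)) x  ≡⟨ cong (λ t → a 0 ⊕ x ⊗ t) (eval-truncate n m (a ∘ suc) x n≤m) ⟩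
    a 0 ⊕ x ⊗ eval n (a ∘ suc) x  ≡⟨ sym (eval-suc n a x) ⟩
    eval (suc n) a x ∎

  -- φ is a polynomial function of degree less than n.
  record Poly (n : ℕ) (φ : K → K) : Set where
    constructor poly
    field
      coefficient : ℕ → K
      evaluates   : ∀ x → φ x ≡ eval n coefficient x
  open Poly public

  poly-cong : ∀ {n φ ψ} → (∀ x → φ x ≡ ψ x) → Poly n ψ → Poly n φ
  poly-cong e (poly a h) = poly a λ x → trans (e x) (h x)

  poly-mono : ∀ {n m φ} → n ≤ m → Poly n φ → Poly m φ
  poly-mono {n} {m} n≤m (poly a h) = poly (truncate n a) λ x → trans (h x) (sym (eval-truncate n m a x n≤m))

  poly-zero : ∀ n → Poly n (λ _ → 𝟘)
  poly-zero n = poly (λ _ → 𝟘) λ x → sym (eval-zero n x λ _ _ → refl)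

  poly-⊕ : ∀ {n φ ψ} → Poly n φ → Poly n ψ → Poly n (λ x → φ x ⊕ ψ x)
  poly-⊕ {n} (poly a h) (poly b k) = poly (λ i → a i ⊕ b i) λ x → trans (cong₂ _⊕_ (h x) (k x))
    (trans (sym (Σᴷ.∑-⊕ (range n) _ _)) (∑<-cong n λ i _ → sym (distribʳ _ _ _)))

  poly-scale : ∀ {n φ} c → Poly n φ → Poly n (λ x → c ⊗ φ x)
  poly-scale {n} c (poly a h) = poly (λ i → c ⊗ a i) λ x → trans (cong (c ⊗_) (h x))
    (trans (sym (Σᴷ-⊗ˡ (range n) c _)) (∑<-cong n λ i _ → sym (*-assoc _ _ _)))

  poly-∑ : ∀ {n} {A : Set} (xs : List A) (φ : A → K → K) → (∀ a → Poly n (φ a)) → Poly n (λ x → Σᴷ.∑ xs (λ a → φ a x))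
  poly-∑ []       φ h = poly-zero _
  poly-∑ (a ∷ xs) φ h = poly-⊕ (h a) (poly-∑ xs φ h)

  poly-one : Poly 1 (λ _ → 𝟙)
  poly-one = poly (λ _ → 𝟙) λ x → sym (trans (+-identityʳ _) (*-identityʳ _))

  poly-linear : ∀ {n φ} α β → Poly n φ → Poly (suc n) (λ x → (α ⊕ β ⊗ x) ⊗ φ x)
  poly-linear {n} α β (poly a h) = let (b , k) = go n a in poly b λ x → trans (cong ((α ⊕ β ⊗ x) ⊗_) (h x)) (sym (k x))
    where
    go : ∀ n a → Σ (ℕ → K) λ b → ∀ x → eval (suc n) b x ≡ (α ⊕ β ⊗ x) ⊗ eval n a x
    go zero    a = (λ _ → 𝟘) , λ x → trans (eval-zero 1 x λ _ _ → refl) (sym (zeroʳ _))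
    go (suc n) a = b , λ x → begin
        eval (2 + n) b x  ≡⟨ trans (eval-suc (suc n) b x) (cong (λ t → b 0 ⊕ x ⊗ t) (eval-suc n _ x)) ⟩
        α ⊗ a 0 ⊕ x ⊗ (β ⊗ a 0 ⊕ b′ 0 ⊕ x ⊗ E x)  ≡⟨ cong (λ t → α ⊗ a 0 ⊕ x ⊗ t) (+-assoc _ _ _) ⟩
        α ⊗ a 0 ⊕ x ⊗ (β ⊗ a 0 ⊕ (b′ 0 ⊕ x ⊗ E x))  ≡⟨ cong (λ t → α ⊗ a 0 ⊕ x ⊗ (β ⊗ a 0 ⊕ t)) (trans (sym (eval-suc n b′ x)) (proj₂ rec x)) ⟩
        α ⊗ a 0 ⊕ x ⊗ (β ⊗ a 0 ⊕ (α ⊕ β ⊗ x) ⊗ eval n (a ∘ suc) x)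
          ≡⟨ solve 5 (λ α β x a E → α :* a :+ x :* (β :* a :+ (α :+ β :* x) :* E) := (α :+ β :* x) :* (a :+ x :* E)) refl _ _ _ _ _ ⟩
        (α ⊕ β ⊗ x) ⊗ (a 0 ⊕ x ⊗ eval n (a ∘ suc) x)  ≡⟨ cong ((α ⊕ β ⊗ x) ⊗_) (sym (eval-suc n a x)) ⟩
        (α ⊕ β ⊗ x) ⊗ eval (suc n) a x ∎
      where
      rec = go n (a ∘ suc)
      b′ = proj₁ rec
      E = eval n (b′ ∘ suc)
      b : ℕ → K
      b zero          = α ⊗ a 0
      b (suc zero)    = β ⊗ a 0 ⊕ b′ 0
      b (suc (suc i)) = b′ (suc i)

  poly-linear-pow : ∀ α β k → Poly (suc k) (λ x → pow (α ⊕ β ⊗ x) k)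
  poly-linear-pow α β zero    = poly-one
  poly-linear-pow α β (suc k) = poly-linear α β (poly-linear-pow α β k)

  vanishing : ∀ ys → Σ (K → K) λ φ → Poly (suc (length ys)) φ × (∀ y → y ∈ ys → φ y ≡ 𝟘) × (∀ x → x ∉ ys → φ x ≢ 𝟘)
  vanishing []       = (λ _ → 𝟙) , poly-one , (λ _ ()) , λ _ _ e → 𝟘≢𝟙 (sym e)
  vanishing (y ∷ ys) =
    let (φ , P , zero-on , nonzero-off) = vanishing ys in
    (λ x → (⊖ y ⊕ 𝟙 ⊗ x) ⊗ φ x) , poly-linear (⊖ y) 𝟙 P ,
    (λ { z (here refl) → trans (cong (λ t → (⊖ y ⊕ t) ⊗ φ y) (*-identityˡ y)) (trans (cong (_⊗ φ y) (-‿inverseˡ y)) (zeroˡ _))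
       ; z (there z∈) → trans (cong (_ ⊗_) (zero-on z z∈)) (zeroʳ _) }) ,
    λ x x∉ → ⊗-≢𝟘 (λ e → x∉ (here (⊖-≡𝟘 (trans (+-comm _ _) (trans (cong (⊖ y ⊕_) (sym (*-identityˡ x))) e)))))
                  (nonzero-off x (x∉ ∘ there))

  -- The Lagrange basis polynomial of z for the nodes xs.
  separating : ∀ {z xs} → z ∈ xs → Unique xs → Σ (K → K) λ φ → Poly (length xs) φ × φ z ≡ 𝟙 × (∀ x → x ∈ xs → x ≢ z → φ x ≡ 𝟘)
  separating {z} {xs} z∈ xs! =
    let (rest , len , z∉ , keep) = remove z∈ xs!
        (φ , P , zero-on , nonzero-off) = vanishing rest
        (i , φzi≡1) = invertible (φ z) (nonzero-off z z∉)
    in (λ x → i ⊗ φ x) , subst (λ n → Poly n (λ x → i ⊗ φ x)) (sym len) (poly-scale i P) ,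
       trans (*-comm _ _) φzi≡1 , λ x x∈ x≢z → trans (cong (i ⊗_) (zero-on x (keep x x∈ x≢z))) (zeroʳ i)

  interpolation : ∀ φ → Poly q φ
  interpolation φ = poly-cong expand (poly-∑ elems (λ z x → φ z ⊗ L z x) λ z → poly-scale (φ z) (proj₁ (proj₂ (sep z))))
    where
    sep = λ z → separating (∈-elems z) elems-unique
    L = λ z → proj₁ (sep z)
    expand : ∀ x → φ x ≡ Σᴷ.∑ elems (λ z → φ z ⊗ L z x)
    expand x = sym (trans (Σᴷ.∑-single (∈-elems x) elems-unique
        λ z _ z≢x → trans (cong (φ z ⊗_) (proj₂ (proj₂ (proj₂ (sep z))) x (∈-elems x) (z≢x ∘ sym))) (zeroʳ _))
      (trans (cong (φ x ⊗_) (proj₁ (proj₂ (proj₂ (sep x))))) (*-identityʳ _)))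

  -- Invertibility of the Vandermonde matrix: the Lagrange polynomial of z is a combination of the
  -- powers below s, and pairing it with w leaves only w z.
  moments⇒zero : ∀ {s xs} (w : K → K) → Unique xs → length xs ≤ s →
    (∀ i → i < s → Σᴷ.∑ xs (λ x → w x ⊗ pow x i) ≡ 𝟘) → ∀ z → z ∈ xs → w z ≡ 𝟘
  moments⇒zero {s} {xs} w xs! len moment z z∈ = begin
    w z  ≡⟨ sym (*-identityʳ _) ⟩
    w z ⊗ 𝟙  ≡⟨ cong (w z ⊗_) (sym φz≡1) ⟩
    w z ⊗ φ z  ≡⟨ sym (Σᴷ.∑-single z∈ xs! λ x x∈ x≢z →
                        trans (cong (w x ⊗_) (proj₂ (proj₂ (proj₂ sep)) x x∈ x≢z)) (zeroʳ _)) ⟩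
    Σᴷ.∑ xs (λ x → w x ⊗ φ x)  ≡⟨ Σᴷ.∑-cong xs (λ x → trans (cong (w x ⊗_) (evaluates P x)) (sym (Σᴷ-⊗ˡ (range s) _ _))) ⟩
    Σᴷ.∑ xs (λ x → ∑< s (λ i → w x ⊗ (a i ⊗ pow x i))) ≡⟨ Σᴷ.∑-swap xs (range s) _ ⟩
    ∑< s (λ i → Σᴷ.∑ xs (λ x → w x ⊗ (a i ⊗ pow x i))) ≡⟨ ∑<-zero s (λ i i< → trans (Σᴷ.∑-cong xs λ x →
                        solve 3 (λ w a p → w :* (a :* p) := a :* (w :* p)) refl _ _ _)
                        (trans (Σᴷ-⊗ˡ xs (a i) _) (trans (cong (a i ⊗_) (moment i i<)) (zeroʳ _)))) ⟩
    𝟘 ∎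
    where
    sep = separating z∈ xs!
    φ = proj₁ sep
    P = poly-mono len (proj₁ (proj₂ sep))
    a = coefficient P
    φz≡1 = proj₁ (proj₂ (proj₂ sep))

  -- Translation by 1 permutes K, so Σ x = Σ (x + 1) = Σ x + q · 1.
  ι-q : ι q ≡ 𝟘
  ι-q = begin
    ι q  ≡⟨ sym (Σᴷ-one elems) ⟩
    ones  ≡⟨ solve 2 (λ o s → o := (s :+ o) :+ :- s) refl _ _ ⟩
    (total ⊕ ones) ⊕ ⊖ total  ≡⟨ cong (_⊕ ⊖ total) (sym (Σᴷ.∑-⊕ elems _ _)) ⟩
    Σᴷ.∑ elems (λ x → x ⊕ 𝟙) ⊕ ⊖ total  ≡⟨ cong (_⊕ ⊖ total) (Σᴷ.∑-bijection enum (_⊕ 𝟙) (_⊕ ⊖ 𝟙)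
                        (λ x → solve 2 (λ x o → (x :+ :- o) :+ o := x) refl x 𝟙)
                        (λ x → solve 2 (λ x o → (x :+ o) :+ :- o := x) refl x 𝟙) id) ⟩
    total ⊕ ⊖ total  ≡⟨ -‿inverseʳ _ ⟩
    𝟘 ∎
    where
    total = Σᴷ.∑ elems id
    ones = Σᴷ.∑ elems (λ _ → 𝟙)

  -- Otherwise X^(k+2) - X, which has k + 3 ≤ q coefficients, would vanish at all q elements of K.
  nonroot-of-unity : ∀ k → 2 + k < q → ∃ λ b → b ≢ 𝟘 × pow b (suc k) ≢ 𝟙
  nonroot-of-unity k k< with Enum.search enum (λ b → ¬? (b ≟ 𝟘) ×-dec ¬? (pow b (suc k) ≟ 𝟙))
  ... | yes found = found
  ... | no none = ⊥-elim (𝟘≢𝟙 (sym (trans (sym (e-top k)) (roots⇒zero (3 + k) a elems-unique k< (λ x _ → root x) (2 + k) ℕₚ.≤-refl))))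
    where
    e : ℕ → ℕ → K
    e zero    zero    = 𝟙
    e zero    (suc _) = 𝟘
    e (suc k) zero    = 𝟘
    e (suc k) (suc i) = e k i
    e-top : ∀ k → e k k ≡ 𝟙
    e-top zero    = refl
    e-top (suc k) = e-top k
    eval-e : ∀ k x → eval (suc k) (e k) x ≡ pow x k
    eval-e zero    x = trans (+-identityʳ _) (*-identityʳ _)
    eval-e (suc k) x = trans (eval-suc (suc k) (e (suc k)) x) (trans (+-identityˡ _) (cong (x ⊗_) (eval-e k x)))
    a : ℕ → K
    a zero          = 𝟘
    a (suc zero)    = ⊖ 𝟙
    a (suc (suc i)) = e k i
    expand : ∀ x → eval (3 + k) a x ≡ x ⊗ (⊖ 𝟙 ⊕ pow x (suc k))
    expand x = begin
      eval (3 + k) a x  ≡⟨ trans (eval-suc (2 + k) a x) (+-identityˡ _) ⟩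
      x ⊗ eval (2 + k) (a ∘ suc) x  ≡⟨ cong (x ⊗_) (eval-suc (suc k) _ x) ⟩
      x ⊗ (⊖ 𝟙 ⊕ x ⊗ eval (suc k) (e k) x)  ≡⟨ cong (λ t → x ⊗ (⊖ 𝟙 ⊕ x ⊗ t)) (eval-e k x) ⟩
      x ⊗ (⊖ 𝟙 ⊕ pow x (suc k)) ∎
    root : ∀ x → eval (3 + k) a x ≡ 𝟘
    root x with x ≟ 𝟘
    ... | yes refl = trans (expand 𝟘) (zeroˡ _)
    ... | no x≢0 = trans (expand x) (trans (cong (λ t → x ⊗ (⊖ 𝟙 ⊕ t)) (decidable-stable (pow x (suc k) ≟ 𝟙) λ ne → none (x , x≢0 , ne)))
                     (trans (cong (x ⊗_) (-‿inverseˡ 𝟙)) (zeroʳ x)))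

  -- For a positive exponent, scaling by a suitable b permutes K and multiplies the sum by a power
  -- of b other than 1.
  power-sum : ∀ k → suc k < q → Σᴷ.∑ elems (λ x → pow x k) ≡ 𝟘
  power-sum zero    _  = trans (Σᴷ-one elems) ι-q
  power-sum (suc k) k< = let (b , b≢0 , bk≢1) = nonroot-of-unity k k<
                             (i , bi≡1) = invertible b b≢0
    in ⊗-cancel-difference bk≢1 (begin
      pow b (suc k) ⊗ total  ≡⟨ sym (Σᴷ-⊗ˡ elems _ _) ⟩
      Σᴷ.∑ elems (λ x → pow b (suc k) ⊗ pow x (suc k)) ≡⟨ Σᴷ.∑-cong elems (λ x → sym (pow-⊗ b x (suc k))) ⟩
      Σᴷ.∑ elems (λ x → pow (b ⊗ x) (suc k))  ≡⟨ Σᴷ.∑-bijection enum (b ⊗_) (i ⊗_)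
                        (λ x → trans (sym (*-assoc _ _ _)) (trans (cong (_⊗ x) bi≡1) (*-identityˡ x)))
                        (λ x → trans (sym (*-assoc _ _ _)) (trans (cong (_⊗ x) (trans (*-comm i b) bi≡1)) (*-identityˡ x)))
                        (λ x → pow x (suc k)) ⟩
      total  ≡⟨ sym (*-identityˡ _) ⟩
      𝟙 ⊗ total ∎)
    where total = Σᴷ.∑ elems (λ x → pow x (suc k))

-- The plane inequality by the polynomial method

length-filter : {A : Set} {P : A → Set} (P? : Decidable P) (xs : List A) → length (filter P? xs) ≡ ∑ xs (λ x → [ does (P? x) ])
length-filter P? []       = refl
length-filter P? (x ∷ xs) with P? x
... | yes _ = cong suc (length-filter P? xs)
... | no _  = length-filter P? xs

range-unique : ∀ n → Unique (range n)
range-unique zero    = []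
range-unique (suc n) = All.tabulate (λ i∈ → λ { refl → absurd (∈-map⁻ suc i∈) }) ∷ Uniqueₚ.map⁺ ℕₚ.suc-injective (range-unique n)
  where
  absurd : {xs : List ℕ} → (∃ λ j → j ∈ xs × 0 ≡ suc j) → ⊥
  absurd (_ , _ , ())

-- The index set of two families of s(s - 1)/2 linear conditions on V(X,Y), one on its total degree
-- and one on the degrees of the polynomials P_i.
triangle : ℕ → List (ℕ × ℕ)
triangle zero    = []
triangle (suc s) = map (s ,_) (range s) ++ triangle s

∈-triangle : ∀ {i e s} → e < i → i < s → (i , e) ∈ triangle s
∈-triangle {i} {s = suc s} e<i (s≤s i≤s) with ℕₚ.m≤n⇒m<n∨m≡n i≤s
... | inj₁ i<s  = ∈-++⁺ʳ (map (s ,_) (range s)) (∈-triangle e<i i<s)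
... | inj₂ refl = ∈-++⁺ˡ (∈-map⁺ (s ,_) (∈-range⁺ e<i))

length-triangle : ∀ s → length (triangle s) + length (triangle s) + s ≡ s * s
length-triangle zero    = refl
length-triangle (suc s) = begin
  length (triangle (suc s)) + length (triangle (suc s)) + suc s
    ≡⟨ cong (λ l → l + l + suc s) (trans (length-++ (map (s ,_) (range s))) (cong (_+ t) (trans (length-map _ (range s)) (length-range s)))) ⟩
  s + t + (s + t) + suc s  ≡⟨ solve 2 (λ s t → s :+ t :+ (s :+ t) :+ (con 1 :+ s) := con 1 :+ s :+ (s :+ (t :+ t :+ s))) refl s t ⟩
  suc s + (s + (t + t + s))  ≡⟨ cong (λ u → suc s + (s + u)) (length-triangle s) ⟩
  suc s + (s + s * s)  ≡⟨ cong (suc s +_) (sym (ℕₚ.*-suc s s)) ⟩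
  suc s * suc s ∎
  where
  open ≡-Reasoning
  open +-*-Solver
  t = length (triangle s)

module Stability (𝔽 : Field) where
  open Field 𝔽
  open Solver 𝔽
  open Interpolation 𝔽 public
  open ≡-Reasoning

  instance
    q-nonZero : NonZero q
    q-nonZero = nonempty (∈-elems 𝟘)
      where
      nonempty : ∀ {xs : List K} → 𝟘 ∈ xs → NonZero (length xs)
      nonempty (here _)  = _
      nonempty (there _) = _

  nz : K → ℕ
  nz x = [ does (¬? (x ≟ 𝟘)) ]

  ∑<-+ : ∀ m n f → ∑< (m + n) f ≡ ∑< m f ⊕ ∑< n (λ i → f (m + i))
  ∑<-+ zero    n f = sym (+-identityˡ _)
  ∑<-+ (suc m) n f = begin
    ∑< (suc (m + n)) f  ≡⟨ ∑<-suc (m + n) f ⟩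
    f 0 ⊕ ∑< (m + n) (f ∘ suc)  ≡⟨ cong (f 0 ⊕_) (∑<-+ m n (f ∘ suc)) ⟩
    f 0 ⊕ (∑< m (f ∘ suc) ⊕ ∑< n (λ i → f (suc m + i)))  ≡⟨ sym (+-assoc _ _ _) ⟩
    f 0 ⊕ ∑< m (f ∘ suc) ⊕ ∑< n (λ i → f (suc m + i))  ≡⟨ cong (_⊕ ∑< n (λ i → f (suc m + i))) (sym (∑<-suc m f)) ⟩
    ∑< (suc m) f ⊕ ∑< n (λ i → f (suc m + i)) ∎

  ∑<-* : ∀ m n f → ∑< (m * n) f ≡ ∑< m (λ j → ∑< n (λ r → f (r + j * n)))
  ∑<-* zero    n f = refl
  ∑<-* (suc m) n f = begin
    ∑< (n + m * n) f  ≡⟨ ∑<-+ n (m * n) f ⟩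
    ∑< n f ⊕ ∑< (m * n) (λ i → f (n + i))  ≡⟨ cong₂ _⊕_ (∑<-cong n λ i _ → cong f (sym (ℕₚ.+-identityʳ i))) (∑<-* m n _) ⟩
    ∑< n (λ r → f (r + 0)) ⊕ ∑< m (λ j → ∑< n (λ r → f (n + (r + j * n))))
      ≡⟨ cong (_ ⊕_) (∑<-cong m λ j _ → ∑<-cong n λ r _ → cong f (rearrange n r (j * n))) ⟩
    ∑< n (λ r → f (r + 0)) ⊕ ∑< m (λ j → ∑< n (λ r → f (r + suc j * n))) ≡⟨ sym (∑<-suc m _) ⟩
    ∑< (suc m) (λ j → ∑< n (λ r → f (r + j * n))) ∎
    where
    rearrange : ∀ a b c → a + (b + c) ≡ b + (a + c)
    rearrange a b c = trans (sym (ℕₚ.+-assoc a b c)) (trans (cong (_+ c) (ℕₚ.+-comm a b)) (ℕₚ.+-assoc b a c))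

  ∑<-single : ∀ {n f} k → k < n → (∀ i → i ≢ k → f i ≡ 𝟘) → ∑< n f ≡ f k
  ∑<-single {n} k k< z = Σᴷ.∑-single (∈-range⁺ k<) (range-unique n) λ i _ → z i

  -- The coefficients of a(Y) Y^r.
  shift : ℕ → (ℕ → K) → ℕ → K
  shift zero    a d       = a d
  shift (suc r) a zero    = 𝟘
  shift (suc r) a (suc d) = shift r a d

  shift-< : ∀ r a d → d < r → shift r a d ≡ 𝟘
  shift-< (suc r) a zero    _         = refl
  shift-< (suc r) a (suc d) (s≤s d<r) = shift-< r a d d<r

  shift-≡ : ∀ r a → shift r a r ≡ a 0
  shift-≡ zero    a = refl
  shift-≡ (suc r) a = shift-≡ r a

  shift-≥ : ∀ r a d n → (∀ i → n ≤ i → a i ≡ 𝟘) → r + n ≤ d → shift r a d ≡ 𝟘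
  shift-≥ zero    a d       n z le       = z d le
  shift-≥ (suc r) a (suc d) n z (s≤s le) = shift-≥ r a d n z le

  eval-shift : ∀ r n a m y → r + n ≤ m → eval m (shift r (truncate n a)) y ≡ pow y r ⊗ eval n a y
  eval-shift zero    n a m       y le       = trans (eval-truncate n m a y le) (sym (*-identityˡ _))
  eval-shift (suc r) n a (suc m) y (s≤s le) = begin
    eval (suc m) (shift (suc r) (truncate n a)) y  ≡⟨ trans (eval-suc m _ y) (+-identityˡ _) ⟩
    y ⊗ eval m (shift r (truncate n a)) y  ≡⟨ cong (y ⊗_) (eval-shift r n a m y le) ⟩
    y ⊗ (pow y r ⊗ eval n a y)  ≡⟨ sym (*-assoc _ _ _) ⟩
    pow y (suc r) ⊗ eval n a y ∎

  -- This is all that the plane inequality uses of a codeword restricted to an affine plane, swept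
  -- by the parallel lines y = const.
  Moments : (K → K → K) → Set
  Moments G = ∀ k → Poly (suc k) (λ y → Σᴷ.∑ elems (λ x → G x y ⊗ pow x k))

  module PlaneBound (G : K → K → K) (moments : Moments G) where

    support₀ : List K
    support₀ = filter (λ x → ¬? (G x 𝟘 ≟ 𝟘)) elems

    s : ℕ
    s = length support₀

    support : List (K × K)
    support = filter (λ (y , x) → ¬? (G x y ≟ 𝟘)) (cartesianProduct elems elems)

    -- The coefficients of the k-th moment polynomial, cut off so that those of index above k are
    -- really zero.
    A : ℕ → ℕ → K
    A k = truncate (suc k) (coefficient (moments k))

    -- The coefficient of X^j Y^r in V is the unknown number r + j q.
    flat : (ℕ → ℕ → K) → ℕ → K
    flat ψ k = ψ (k / q) (k % q)

    flat-≡ : ∀ ψ j r → r < q → flat ψ (r + j * q) ≡ ψ j r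
    flat-≡ ψ j r r<q = cong₂ ψ
      (trans (+-distrib-/-∣ʳ r (divides-refl j)) (cong₂ _+_ (m<n⇒m/n≡0 r<q) (m*n/n≡m j q)))
      (trans ([m+kn]%n≡m%n r j q) (m<n⇒m%n≡m r<q))

    unit : ℕ → ℕ → K
    unit k i with i ℕₚ.≟ k
    ... | yes _ = 𝟙
    ... | no _  = 𝟘

    unit-same : ∀ k → unit k k ≡ 𝟙
    unit-same k with k ℕₚ.≟ k
    ... | yes _ = refl
    ... | no ne = ⊥-elim (ne refl)

    unit-other : ∀ k i → i ≢ k → unit k i ≡ 𝟘
    unit-other k i ne with i ℕₚ.≟ k
    ... | yes e = ⊥-elim (ne e)
    ... | no _  = refl

    -- The unknowns with j + r ≥ q are those with r = q - 1 - e and e < j, and `total-degree` kills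
    -- them. Then P_i = Σ v j r Y^r A_(i+j)(Y) has degree at most q - 1 + i, so that `degree-drop`
    -- has to kill only its coefficients of Y^(q+e) with e < i.
    vanish-on-support degree-drop total-degree : List (ℕ → K)
    vanish-on-support = map (λ (y , x) → flat (λ j r → pow x j ⊗ pow y r)) support
    degree-drop       = map (λ (i , e) → flat (λ j r → shift r (A (i + j)) (q + e))) (triangle s)
    total-degree      = map (λ (j , e) → unit ((q ∸ suc e) + j * q)) (triangle s)

    -- A nonzero V(X,Y) = Σ v j r X^j Y^r with j < s and j + r < q that vanishes on the support of G and
    -- for which every P_i(Y) = Σ_x G(x,Y) x^i V(x,Y), i < s, has degree below q, cannot exist:
    -- P_i vanishes at all y, so P_i = 0, and the Hankel matrix of the moments of G(·,0) is invertible.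
    module Contradiction (x⃗ : ℕ → K)
      (onSupport : ∀ φ → φ ∈ vanish-on-support → ∑< (s * q) (λ k → φ k ⊗ x⃗ k) ≡ 𝟘)
      (onDrop    : ∀ φ → φ ∈ degree-drop → ∑< (s * q) (λ k → φ k ⊗ x⃗ k) ≡ 𝟘)
      (onTotal   : ∀ φ → φ ∈ total-degree → ∑< (s * q) (λ k → φ k ⊗ x⃗ k) ≡ 𝟘) where

      v : ℕ → ℕ → K
      v j r = x⃗ (r + j * q)

      pairing : ∀ ψ → ∑< (s * q) (λ k → flat ψ k ⊗ x⃗ k) ≡ ∑< s (λ j → ∑< q (λ r → ψ j r ⊗ v j r))
      pairing ψ = trans (∑<-* s q _) (∑<-cong s λ j _ → ∑<-cong q λ r r<q → cong (_⊗ v j r) (flat-≡ ψ j r r<q))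

      V : K → K → K
      V x y = ∑< s (λ j → ∑< q (λ r → pow x j ⊗ pow y r ⊗ v j r))

      GV≡𝟘 : ∀ x y → G x y ⊗ V x y ≡ 𝟘
      GV≡𝟘 x y with G x y ≟ 𝟘
      ... | yes e = trans (cong (_⊗ V x y) e) (zeroˡ _)
      ... | no ne = trans (cong (G x y ⊗_) (trans (sym (pairing _)) (onSupport _ (∈-map⁺ _
                      (∈-filter⁺ _ (∈-cartesianProduct⁺ (∈-elems y) (∈-elems x)) ne))))) (zeroʳ _)

      v-total-degree : ∀ j r → j < s → r < q → q ≤ r + j → v j r ≡ 𝟘
      v-total-degree j r j<s r<q q≤r+j = begin
        v j r  ≡⟨ sym (*-identityˡ _) ⟩
        𝟙 ⊗ v j r  ≡⟨ cong (_⊗ v j r) (sym (unit-same k)) ⟩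
        unit k k ⊗ x⃗ k  ≡⟨ sym (∑<-single k k< λ i ne → trans (cong (_⊗ x⃗ i) (unit-other k i ne)) (zeroˡ _)) ⟩
        ∑< (s * q) (λ i → unit k i ⊗ x⃗ i)  ≡⟨ onTotal _ (subst (λ t → unit (t + j * q) ∈ total-degree) r≡
                        (∈-map⁺ _ (∈-triangle e<j j<s))) ⟩
        𝟘 ∎
        where
        k = r + j * q
        k< : k < s * q
        k< = ℕₚ.<-≤-trans (ℕₚ.+-monoˡ-< (j * q) r<q) (ℕₚ.*-monoˡ-≤ q j<s)
        e = q ∸ suc r
        r≡ : q ∸ suc e ≡ r
        r≡ = begin
          q ∸ suc (q ∸ suc r) ≡⟨ cong (q ∸_) (sym (ℕₚ.+-∸-assoc 1 r<q)) ⟩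
          q ∸ (q ∸ r)  ≡⟨ ℕₚ.m∸[m∸n]≡n (ℕₚ.<⇒≤ r<q) ⟩
          r ∎
        e<j : e < j
        e<j = ℕₚ.+-cancelʳ-< (suc r) e j (subst (_< j + suc r) (sym (ℕₚ.m∸n+n≡m r<q))
                (subst (q <_) (trans (cong suc (ℕₚ.+-comm r j)) (sym (ℕₚ.+-suc j r))) (s≤s q≤r+j)))

      -- The coefficient of Y^d in P_i.
      C : ℕ → ℕ → K
      C i d = ∑< s (λ j → ∑< q (λ r → shift r (A (i + j)) d ⊗ v j r))

      -- For q ≤ d < q + i this is a row of `degree-drop`; from q + i on it follows from the bound
      -- on the total degree.
      C-high : ∀ i d → i < s → q ≤ d → C i d ≡ 𝟘
      C-high i d i<s q≤d with d ℕₚ.<? q + i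
      ... | yes d<q+i = subst (λ t → C i t ≡ 𝟘) (ℕₚ.m+[n∸m]≡n q≤d)
              (trans (sym (pairing _)) (onDrop _ (∈-map⁺ _ (∈-triangle
                (ℕₚ.+-cancelˡ-< q (d ∸ q) i (subst (_< q + i) (sym (ℕₚ.m+[n∸m]≡n q≤d)) d<q+i)) i<s))))
      ... | no d≮ = ∑<-zero s λ j j<s → ∑<-zero q λ r r<q → term j r j<s r<q
        where
        term : ∀ j r → j < s → r < q → shift r (A (i + j)) d ⊗ v j r ≡ 𝟘
        term j r j<s r<q with q ℕₚ.≤? r + j
        ... | yes le = trans (cong (_ ⊗_) (v-total-degree j r j<s r<q le)) (zeroʳ _)
        ... | no nle = trans (cong (_⊗ v j r) (shift-≥ r (A (i + j)) d (suc (i + j)) (truncate-≥ (suc (i + j)) _) bound)) (zeroˡ _)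
          where
          bound : r + suc (i + j) ≤ d
          bound = ℕₚ.≤-trans (ℕₚ.≤-trans (ℕₚ.≤-reflexive (+-*-Solver.solve 3 (λ r i j →
              r +-*-Solver.:+ (+-*-Solver.con 1 +-*-Solver.:+ (i +-*-Solver.:+ j)) +-*-Solver.:=
              +-*-Solver.con 1 +-*-Solver.:+ (r +-*-Solver.:+ j) +-*-Solver.:+ i) refl r i j))
            (ℕₚ.+-monoˡ-≤ i (ℕₚ.≰⇒> nle))) (ℕₚ.≮⇒≥ d≮)

      moment-form : ∀ i y → ∑< s (λ j → ∑< q (λ r → pow y r ⊗ Σᴷ.∑ elems (λ x → G x y ⊗ pow x (i + j)) ⊗ v j r))
                            ≡ Σᴷ.∑ elems (λ x → pow x i ⊗ (G x y ⊗ V x y))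
      moment-form i y = sym (begin
        Σᴷ.∑ elems (λ x → pow x i ⊗ (G x y ⊗ V x y))
          ≡⟨ Σᴷ.∑-cong elems (λ x → trans (sym (*-assoc _ _ _)) (trans (sym (Σᴷ-⊗ˡ (range s) _ _))
               (∑<-cong s λ j _ → sym (Σᴷ-⊗ˡ (range q) _ _)))) ⟩
        Σᴷ.∑ elems (λ x → ∑< s (λ j → ∑< q (λ r → pow x i ⊗ G x y ⊗ (pow x j ⊗ pow y r ⊗ v j r))))
          ≡⟨ Σᴷ.∑-swap elems (range s) _ ⟩
        ∑< s (λ j → Σᴷ.∑ elems (λ x → ∑< q (λ r → pow x i ⊗ G x y ⊗ (pow x j ⊗ pow y r ⊗ v j r))))
          ≡⟨ ∑<-cong s (λ j _ → Σᴷ.∑-swap elems (range q) _) ⟩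
        ∑< s (λ j → ∑< q (λ r → Σᴷ.∑ elems (λ x → pow x i ⊗ G x y ⊗ (pow x j ⊗ pow y r ⊗ v j r))))
          ≡⟨ ∑<-cong s (λ j _ → ∑<-cong q λ r _ → trans
               (Σᴷ.∑-cong elems λ x → trans
                 (solve 5 (λ a g b c v → a :* g :* (b :* c :* v) := c :* v :* (g :* (a :* b))) refl (pow x i) (G x y) (pow x j) (pow y r) (v j r))
                 (cong (λ t → pow y r ⊗ v j r ⊗ (G x y ⊗ t)) (sym (pow-+ x i j))))
               (trans (Σᴷ-⊗ˡ elems _ _) (solve 3 (λ c v m → c :* v :* m := c :* m :* v) refl _ _ _))) ⟩
        ∑< s (λ j → ∑< q (λ r → pow y r ⊗ Σᴷ.∑ elems (λ x → G x y ⊗ pow x (i + j)) ⊗ v j r)) ∎)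

      -- P_i(y) is the sum of G(x,y) x^i V(x,y) over x, and each term vanishes because V is zero
      -- wherever G is not. The length q + (i + s) exceeds all degrees r + i + j that occur.
      eval-C : ∀ i y → eval (q + (i + s)) (C i) y ≡ 𝟘
      eval-C i y = begin
        eval D (C i) y
          ≡⟨ ∑<-cong D (λ d _ → trans (sym (Σᴷ-⊗ʳ (range s) (pow y d) _)) (∑<-cong s λ j _ → sym (Σᴷ-⊗ʳ (range q) (pow y d) _))) ⟩
        ∑< D (λ d → ∑< s (λ j → ∑< q (λ r → shift r (A (i + j)) d ⊗ v j r ⊗ pow y d)))
          ≡⟨ trans (Σᴷ.∑-swap (range D) (range s) _) (∑<-cong s λ j _ → Σᴷ.∑-swap (range D) (range q) _) ⟩
        ∑< s (λ j → ∑< q (λ r → ∑< D (λ d → shift r (A (i + j)) d ⊗ v j r ⊗ pow y d)))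
          ≡⟨ ∑<-cong s (λ j j<s → ∑<-cong q λ r r<q → trans
               (∑<-cong D λ d _ → solve 3 (λ a v p → a :* v :* p := a :* p :* v) refl _ _ _)
               (trans (Σᴷ-⊗ʳ (range D) (v j r) _) (cong (_⊗ v j r)
                 (trans (eval-shift r (suc (i + j)) _ D y (bound j r j<s r<q)) (cong (pow y r ⊗_) (sym (evaluates (moments (i + j)) y))))))) ⟩
        ∑< s (λ j → ∑< q (λ r → pow y r ⊗ Σᴷ.∑ elems (λ x → G x y ⊗ pow x (i + j)) ⊗ v j r))
          ≡⟨ moment-form i y ⟩
        Σᴷ.∑ elems (λ x → pow x i ⊗ (G x y ⊗ V x y))
          ≡⟨ Σᴷ.∑-zero elems (λ x _ → trans (cong (pow x i ⊗_) (GV≡𝟘 x y)) (zeroʳ _)) ⟩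
        𝟘 ∎
        where
        D = q + (i + s)
        bound : ∀ j r → j < s → r < q → r + suc (i + j) ≤ D
        bound j r j<s r<q = ℕₚ.+-mono-≤ (ℕₚ.<⇒≤ r<q) (subst (_≤ i + s) (ℕₚ.+-suc i j) (ℕₚ.+-monoʳ-≤ i j<s))

      C≡𝟘 : ∀ i d → i < s → d < q → C i d ≡ 𝟘
      C≡𝟘 i d i<s d<q = roots⇒zero q (C i) elems-unique ℕₚ.≤-refl (λ y _ → root y) d d<q
        where
        root : ∀ y → eval q (C i) y ≡ 𝟘
        root y = begin
          eval q (C i) y  ≡⟨ sym (+-identityʳ _) ⟩
          eval q (C i) y ⊕ 𝟘  ≡⟨ cong (eval q (C i) y ⊕_) (sym (∑<-zero (i + s) λ e _ →
                        trans (cong (_⊗ pow y (q + e)) (C-high i (q + e) i<s (ℕₚ.m≤m+n q e))) (zeroˡ _))) ⟩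
          eval q (C i) y ⊕ ∑< (i + s) (λ e → C i (q + e) ⊗ pow y (q + e)) ≡⟨ sym (∑<-+ q (i + s) _) ⟩
          eval (q + (i + s)) (C i) y  ≡⟨ eval-C i y ⟩
          𝟘 ∎

      A-0 : ∀ k → A k 0 ≡ Σᴷ.∑ elems (λ x → G x 𝟘 ⊗ pow x k)
      A-0 k = sym (trans (evaluates (moments k) 𝟘) (trans (eval-suc k _ 𝟘) (trans (cong (_ ⊕_) (zeroˡ _)) (+-identityʳ _))))

      -- By induction on r, the coefficient of Y^r in P_i is Σ_j A (i + j) 0 · v j r: lower rows of
      -- v are zero, and higher powers of Y do not reach it. Hence κ = Σ_j v j r X^j, weighted by
      -- G(·,0), has zero moments of order below s. By the Vandermonde argument κ vanishes at the s
      -- support points, which exceed its degree.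
      v≡𝟘 : ∀ r → r < q → ∀ j → j < s → v j r ≡ 𝟘
      v≡𝟘 = <-rec _ step
        where
        step : ∀ r → (∀ {r′} → r′ < r → r′ < q → ∀ j → j < s → v j r′ ≡ 𝟘) → r < q → ∀ j → j < s → v j r ≡ 𝟘
        step r lower r<q = roots⇒zero s (λ j → v j r) support₀-unique ℕₚ.≤-refl
            λ x x∈ → ⊗-cancel (proj₂ (∈-filter⁻ (λ x → ¬? (G x 𝟘 ≟ 𝟘)) {xs = elems} x∈))
                       (moments⇒zero (λ x → G x 𝟘 ⊗ κ x) support₀-unique ℕₚ.≤-refl
                         (λ i i<s → trans (restrict (λ x → G x 𝟘) (λ x → κ x) (λ x → pow x i) elems) (hankel i i<s)) x x∈)
          where
          support₀-unique = Uniqueₚ.filter⁺ (λ x → ¬? (G x 𝟘 ≟ 𝟘)) elems-unique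
          κ = eval s (λ j → v j r)
          restrict : ∀ (g k p : K → K) xs → Σᴷ.∑ (filter (λ x → ¬? (g x ≟ 𝟘)) xs) (λ x → g x ⊗ k x ⊗ p x) ≡ Σᴷ.∑ xs (λ x → g x ⊗ k x ⊗ p x)
          restrict g k p []       = refl
          restrict g k p (x ∷ xs) with g x ≟ 𝟘
          ... | no _  = cong (_ ⊕_) (restrict g k p xs)
          ... | yes e = trans (restrict g k p xs) (sym (trans (cong (_⊕ Σᴷ.∑ xs (λ x → g x ⊗ k x ⊗ p x)) (trans (*-assoc _ _ _) (trans (cong (_⊗ (k x ⊗ p x)) e) (zeroˡ _)))) (+-identityˡ _)))
          row : ∀ i j → j < s → ∑< q (λ r′ → shift r′ (A (i + j)) r ⊗ v j r′) ≡ A (i + j) 0 ⊗ v j r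
          row i j j<s = trans (Σᴷ.∑-single (∈-range⁺ r<q) (range-unique q) off) (cong (_⊗ v j r) (shift-≡ r (A (i + j))))
            where
            off : ∀ r′ → r′ ∈ range q → r′ ≢ r → shift r′ (A (i + j)) r ⊗ v j r′ ≡ 𝟘
            off r′ r′∈ ne with ℕₚ.<-cmp r′ r
            ... | tri< lt _ _ = trans (cong (_ ⊗_) (lower lt (∈-range⁻ r′∈) j j<s)) (zeroʳ _)
            ... | tri≈ _ e _  = ⊥-elim (ne e)
            ... | tri> _ _ gt = trans (cong (_⊗ v j r′) (shift-< r′ (A (i + j)) r gt)) (zeroˡ _)
          hankel : ∀ i → i < s → Σᴷ.∑ elems (λ x → G x 𝟘 ⊗ κ x ⊗ pow x i) ≡ 𝟘
          hankel i i<s = begin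
            Σᴷ.∑ elems (λ x → G x 𝟘 ⊗ κ x ⊗ pow x i)
              ≡⟨ Σᴷ.∑-cong elems (λ x → trans (solve 3 (λ g k p → g :* k :* p := g :* p :* k) refl _ _ _) (sym (Σᴷ-⊗ˡ (range s) _ _))) ⟩
            Σᴷ.∑ elems (λ x → ∑< s (λ j → G x 𝟘 ⊗ pow x i ⊗ (v j r ⊗ pow x j)))
              ≡⟨ Σᴷ.∑-swap elems (range s) _ ⟩
            ∑< s (λ j → Σᴷ.∑ elems (λ x → G x 𝟘 ⊗ pow x i ⊗ (v j r ⊗ pow x j)))
              ≡⟨ ∑<-cong s (λ j _ → trans (Σᴷ.∑-cong elems λ x → trans
                   (solve 4 (λ g a v b → g :* a :* (v :* b) := g :* (a :* b) :* v) refl _ _ _ _)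
                   (cong (λ t → G x 𝟘 ⊗ t ⊗ v j r) (sym (pow-+ x i j))))
                   (trans (Σᴷ-⊗ʳ elems (v j r) _) (cong (_⊗ v j r) (sym (A-0 (i + j)))))) ⟩
            ∑< s (λ j → A (i + j) 0 ⊗ v j r)
              ≡⟨ ∑<-cong s (λ j j<s → sym (row i j j<s)) ⟩
            C i r
              ≡⟨ C≡𝟘 i r i<s r<q ⟩
            𝟘 ∎

    -- If it failed, the |supp| + s(s - 1) conditions would be fewer than the s q unknowns, and a
    -- nonzero V would exist.
    line-bound : q * s + s ≤ ∑ elems (λ y → ∑ elems (λ x → nz (G x y))) + s * s
    line-bound with q * s + s ℕₚ.≤? ∑ elems (λ y → ∑ elems (λ x → nz (G x y))) + s * s
    ... | yes le = le
    ... | no nle = ⊥-elim (nonzero zero-solution)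
      where
      rows = vanish-on-support ++ (degree-drop ++ total-degree)
      t = length (triangle s)
      S = ∑ elems (λ y → ∑ elems (λ x → nz (G x y)))
      length-rows : length rows + s ≡ S + s * s
      length-rows = begin
        length rows + s
          ≡⟨ cong (_+ s) (trans (length-++ vanish-on-support) (cong₂ _+_
               (trans (length-map _ support) (trans (length-filter _ (cartesianProduct elems elems)) (∑-product _,_ elems elems _)))
               (trans (length-++ degree-drop) (cong₂ _+_ (length-map _ (triangle s)) (length-map _ (triangle s)))))) ⟩
        S + (t + t) + s  ≡⟨ ℕₚ.+-assoc S (t + t) s ⟩
        S + (t + t + s)  ≡⟨ cong (S +_) (length-triangle s) ⟩
        S + s * s ∎
      few-rows : length rows < s * q
      few-rows = ℕₚ.+-cancelʳ-< s (length rows) (s * q)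
        (subst (_< s * q + s) (sym length-rows) (subst (λ m → S + s * s < m + s) (ℕₚ.*-comm q s) (ℕₚ.≰⇒> nle)))
      solution = underdetermined (s * q) rows few-rows
      x⃗ = proj₁ solution
      k = proj₁ (proj₁ (proj₂ solution))
      k< = proj₁ (proj₂ (proj₁ (proj₂ solution)))
      nonzero = proj₂ (proj₂ (proj₁ (proj₂ solution)))
      sol = λ φ (φ∈ : φ ∈ rows) → All.lookup (proj₂ (proj₂ solution)) φ∈
      open Contradiction x⃗ (λ φ φ∈ → sol φ (∈-++⁺ˡ φ∈)) (λ φ φ∈ → sol φ (∈-++⁺ʳ vanish-on-support (∈-++⁺ˡ φ∈)))
        (λ φ φ∈ → sol φ (∈-++⁺ʳ vanish-on-support (∈-++⁺ʳ degree-drop φ∈)))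
      zero-solution : x⃗ k ≡ 𝟘
      zero-solution = trans (cong x⃗ (m≡m%n+[m/n]*n k q)) (v≡𝟘 (k % q) (m%n<n k q) (k / q) (m<n*o⇒m/o<n k<))

-- Functions on vector spaces whose restrictions to planes have low-degree moments

module Vectors (𝔽 : Field) where
  open Field 𝔽
  open Solver 𝔽
  open Stability 𝔽 public
  open ≡-Reasoning

  r : ℕ
  r = pred q

  q≡1+r : q ≡ suc r
  q≡1+r = sym (ℕₚ.suc-pred q)

  infixl 6 _+ᵛ_
  infixr 7 _·ᵛ_

  _+ᵛ_ : ∀ {k} → Vec K k → Vec K k → Vec K k
  _+ᵛ_ = zipWith _⊕_

  _·ᵛ_ : ∀ {k} → K → Vec K k → Vec K k
  c ·ᵛ v = Vec.map (c ⊗_) v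

  𝟘ᵛ : ∀ {k} → Vec K k
  𝟘ᵛ = Vec.replicate _ 𝟘

  infix 8 -ᵛ_
  -ᵛ_ : ∀ {k} → Vec K k → Vec K k
  -ᵛ v = Vec.map ⊖_ v

  dot : ∀ {k} → Vec K k → Vec K k → K
  dot []       []       = 𝟘
  dot (x ∷ xs) (y ∷ ys) = x ⊗ y ⊕ dot xs ys

  dot-+ : ∀ {k} (u v w : Vec K k) → dot u (v +ᵛ w) ≡ dot u v ⊕ dot u w
  dot-+ []      []      []      = sym (+-identityˡ 𝟘)
  dot-+ (x ∷ u) (y ∷ v) (z ∷ w) = trans (cong (x ⊗ (y ⊕ z) ⊕_) (dot-+ u v w))
    (solve 5 (λ x y z a b → x :* (y :+ z) :+ (a :+ b) := x :* y :+ a :+ (x :* z :+ b)) refl x y z _ _)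

  dot-· : ∀ {k} (u v : Vec K k) c → dot u (c ·ᵛ v) ≡ c ⊗ dot u v
  dot-· []      []      c = sym (zeroʳ c)
  dot-· (x ∷ u) (y ∷ v) c = trans (cong (x ⊗ (c ⊗ y) ⊕_) (dot-· u v c))
    (solve 4 (λ x y c a → x :* (c :* y) :+ c :* a := c :* (x :* y :+ a)) refl x y c _)

  +ᵛ-assoc : ∀ {k} (u v w : Vec K k) → (u +ᵛ v) +ᵛ w ≡ u +ᵛ (v +ᵛ w)
  +ᵛ-assoc []      []      []      = refl
  +ᵛ-assoc (x ∷ u) (y ∷ v) (z ∷ w) = cong₂ _∷_ (+-assoc x y z) (+ᵛ-assoc u v w)

  +ᵛ-comm : ∀ {k} (u v : Vec K k) → u +ᵛ v ≡ v +ᵛ u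
  +ᵛ-comm []      []      = refl
  +ᵛ-comm (x ∷ u) (y ∷ v) = cong₂ _∷_ (+-comm x y) (+ᵛ-comm u v)

  +ᵛ-identityʳ : ∀ {k} (u : Vec K k) → u +ᵛ 𝟘ᵛ ≡ u
  +ᵛ-identityʳ []      = refl
  +ᵛ-identityʳ (x ∷ u) = cong₂ _∷_ (+-identityʳ x) (+ᵛ-identityʳ u)

  +ᵛ-identityˡ : ∀ {k} (u : Vec K k) → 𝟘ᵛ +ᵛ u ≡ u
  +ᵛ-identityˡ u = trans (+ᵛ-comm 𝟘ᵛ u) (+ᵛ-identityʳ u)

  +ᵛ-inverseʳ : ∀ {k} (u : Vec K k) → u +ᵛ -ᵛ u ≡ 𝟘ᵛ
  +ᵛ-inverseʳ []      = refl
  +ᵛ-inverseʳ (x ∷ u) = cong₂ _∷_ (-‿inverseʳ x) (+ᵛ-inverseʳ u)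

  ·ᵛ-identity : ∀ {k} (u : Vec K k) → 𝟙 ·ᵛ u ≡ u
  ·ᵛ-identity []      = refl
  ·ᵛ-identity (x ∷ u) = cong₂ _∷_ (*-identityˡ x) (·ᵛ-identity u)

  ·ᵛ-zero : ∀ {k} (u : Vec K k) → 𝟘 ·ᵛ u ≡ 𝟘ᵛ
  ·ᵛ-zero []      = refl
  ·ᵛ-zero (x ∷ u) = cong₂ _∷_ (zeroˡ x) (·ᵛ-zero u)

  ·ᵛ-zeroʳ : ∀ {k} c → c ·ᵛ 𝟘ᵛ {k} ≡ 𝟘ᵛ
  ·ᵛ-zeroʳ {zero}  c = refl
  ·ᵛ-zeroʳ {suc k} c = cong₂ _∷_ (zeroʳ c) (·ᵛ-zeroʳ c)

  ·ᵛ-assoc : ∀ {k} a b (u : Vec K k) → (a ⊗ b) ·ᵛ u ≡ a ·ᵛ (b ·ᵛ u)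
  ·ᵛ-assoc a b []      = refl
  ·ᵛ-assoc a b (x ∷ u) = cong₂ _∷_ (*-assoc a b x) (·ᵛ-assoc a b u)

  ·ᵛ-distribˡ : ∀ {k} a (u v : Vec K k) → a ·ᵛ (u +ᵛ v) ≡ a ·ᵛ u +ᵛ a ·ᵛ v
  ·ᵛ-distribˡ a []      []      = refl
  ·ᵛ-distribˡ a (x ∷ u) (y ∷ v) = cong₂ _∷_ (distribˡ a x y) (·ᵛ-distribˡ a u v)

  ·ᵛ-distribʳ : ∀ {k} a b (u : Vec K k) → (a ⊕ b) ·ᵛ u ≡ a ·ᵛ u +ᵛ b ·ᵛ u
  ·ᵛ-distribʳ a b []      = refl
  ·ᵛ-distribʳ a b (x ∷ u) = cong₂ _∷_ (distribʳ x a b) (·ᵛ-distribʳ a b u)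

  +ᵛ-interchange : ∀ {k} (a b c d : Vec K k) → (a +ᵛ b) +ᵛ (c +ᵛ d) ≡ (a +ᵛ c) +ᵛ (b +ᵛ d)
  +ᵛ-interchange []      []      []      []      = refl
  +ᵛ-interchange (x ∷ a) (y ∷ b) (z ∷ c) (w ∷ d) =
    cong₂ _∷_ (Σᴷ.interchange x y z w) (+ᵛ-interchange a b c d)

  ∑ᵛ : ∀ k → (Vec K k → ℕ) → ℕ
  ∑ᵛ k = ∑ (vecs elems k)

  ∣vecs∣ : ∀ k → length (vecs elems k) ≡ q ^ k
  ∣vecs∣ = length-vecs elems

  ∑ᵛ-const : ∀ k c → ∑ᵛ k (λ _ → c) ≡ q ^ k * c
  ∑ᵛ-const k c = trans (∑-const (vecs elems k) c) (cong (_* c) (∣vecs∣ k))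

  ∑ᵛ-translate : ∀ {k} (u : Vec K k) (φ : Vec K k → ℕ) → ∑ᵛ k (λ v → φ (u +ᵛ v)) ≡ ∑ᵛ k φ
  ∑ᵛ-translate {k} u φ = ∑-bijection (Vec-enum enum k) (u +ᵛ_) (-ᵛ u +ᵛ_)
    (λ v → trans (sym (+ᵛ-assoc u (-ᵛ u) v)) (trans (cong (_+ᵛ v) (+ᵛ-inverseʳ u)) (+ᵛ-identityˡ v)))
    (λ v → trans (sym (+ᵛ-assoc (-ᵛ u) u v)) (trans (cong (_+ᵛ v) (trans (+ᵛ-comm (-ᵛ u) u) (+ᵛ-inverseʳ u))) (+ᵛ-identityˡ v))) φ

  ∑ᵛ-scale : ∀ {k} {c} → c ≢ 𝟘 → (φ : Vec K k → ℕ) → ∑ᵛ k (λ v → φ (c ·ᵛ v)) ≡ ∑ᵛ k φ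
  ∑ᵛ-scale {k} {c} c≢0 φ = let (i , ci≡1) = invertible c c≢0 in
    ∑-bijection (Vec-enum enum k) (c ·ᵛ_) (i ·ᵛ_)
      (λ v → trans (sym (·ᵛ-assoc c i v)) (trans (cong (_·ᵛ v) ci≡1) (·ᵛ-identity v)))
      (λ v → trans (sym (·ᵛ-assoc i c v)) (trans (cong (_·ᵛ v) (trans (*-comm i c) ci≡1)) (·ᵛ-identity v))) φ

  ∑ᵛ-affine : ∀ {k} (u : Vec K k) {c} → c ≢ 𝟘 → (φ : Vec K k → ℕ) → ∑ᵛ k (λ v → φ (u +ᵛ c ·ᵛ v)) ≡ ∑ᵛ k φ
  ∑ᵛ-affine u c≢0 φ = trans (∑ᵛ-scale c≢0 (λ v → φ (u +ᵛ v))) (∑ᵛ-translate u φ)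

  -- Written with sums on both sides because natural numbers cannot be subtracted freely.
  ∑-split-𝟘 : (φ ψ : K → ℕ) → (∀ y → y ≢ 𝟘 → φ y ≡ ψ y) → ∑ elems φ + ψ 𝟘 ≡ φ 𝟘 + ∑ elems ψ
  ∑-split-𝟘 φ ψ e = begin
    ∑ elems φ + ψ 𝟘  ≡⟨ cong (∑ elems φ +_) (sym (∑-pick enum 𝟘 ψ)) ⟩
    ∑ elems φ + ∑ elems (pick enum 𝟘 ψ)  ≡⟨ sym (∑-⊕ elems _ _) ⟩
    ∑ elems (λ y → φ y + pick enum 𝟘 ψ y)  ≡⟨ ∑-cong elems pointwise ⟩
    ∑ elems (λ y → pick enum 𝟘 φ y + ψ y)  ≡⟨ ∑-⊕ elems _ _ ⟩
    ∑ elems (pick enum 𝟘 φ) + ∑ elems ψ  ≡⟨ cong (_+ ∑ elems ψ) (∑-pick enum 𝟘 φ) ⟩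
    φ 𝟘 + ∑ elems ψ ∎
    where
    pointwise : ∀ y → φ y + pick enum 𝟘 ψ y ≡ pick enum 𝟘 φ y + ψ y
    pointwise y with y ≟ 𝟘
    ... | yes _  = refl
    ... | no ne = trans (ℕₚ.+-identityʳ _) (e y ne)

  ∑-const-off-𝟘 : (φ : K → ℕ) (c : ℕ) → (∀ y → y ≢ 𝟘 → φ y ≡ c) → ∑ elems φ ≡ φ 𝟘 + r * c
  ∑-const-off-𝟘 φ c e = ℕₚ.+-cancelʳ-≡ c _ _ (begin
    ∑ elems φ + c  ≡⟨ ∑-split-𝟘 φ (λ _ → c) e ⟩
    φ 𝟘 + ∑ elems (λ _ → c)  ≡⟨ cong (φ 𝟘 +_) (trans (∑-const elems c) (cong (_* c) q≡1+r)) ⟩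
    φ 𝟘 + (c + r * c)  ≡⟨ cong (φ 𝟘 +_) (ℕₚ.+-comm c _) ⟩
    φ 𝟘 + (r * c + c)  ≡⟨ sym (ℕₚ.+-assoc (φ 𝟘) _ c) ⟩
    φ 𝟘 + r * c + c ∎)

  ind : K → K
  ind z = if does (z ≟ 𝟘) then 𝟙 else 𝟘

  ind-𝟘 : ∀ {z} → z ≡ 𝟘 → ind z ≡ 𝟙
  ind-𝟘 {z} e with z ≟ 𝟘
  ... | yes _ = refl
  ... | no ne = ⊥-elim (ne e)

  ind-≢ : ∀ {z} → z ≢ 𝟘 → ind z ≡ 𝟘
  ind-≢ {z} ne with z ≟ 𝟘
  ... | yes e = ⊥-elim (ne e)
  ... | no _  = refl

  -- Moments of order at least q − 1 carry no information.
  low-moments : ∀ G → (∀ k → suc k < q → Poly (suc k) (λ y → Σᴷ.∑ elems (λ x → G x y ⊗ pow x k))) → Moments G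
  low-moments G low k with suc k ℕₚ.<? q
  ... | yes k< = low k k<
  ... | no k≮ = poly-mono (ℕₚ.≮⇒≥ k≮) (interpolation _)

  moments-cong : ∀ {G H} → (∀ x y → G x y ≡ H x y) → Moments H → Moments G
  moments-cong e m k = poly-cong (λ y → Σᴷ.∑-cong elems λ x → cong (_⊗ pow x k) (e x y)) (m k)

  moments-⊕ : ∀ {G H} → Moments G → Moments H → Moments (λ x y → G x y ⊕ H x y)
  moments-⊕ m m′ k = poly-cong (λ y → trans (Σᴷ.∑-cong elems λ x → distribʳ _ _ _) (Σᴷ.∑-⊕ elems _ _)) (poly-⊕ (m k) (m′ k))

  moments-scale : ∀ {G} c → Moments G → Moments (λ x y → c ⊗ G x y)
  moments-scale c m k = poly-cong (λ y → trans (Σᴷ.∑-cong elems λ x → *-assoc _ _ _) (Σᴷ-⊗ˡ elems c _)) (poly-scale c (m k))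

  moments-constant-on-lines : ∀ (h : K → K) → Moments (λ _ y → h y)
  moments-constant-on-lines h = low-moments _ λ k k< →
    poly-cong (λ y → trans (Σᴷ-⊗ˡ elems (h y) _) (trans (cong (h y ⊗_) (power-sum k k<)) (zeroʳ _))) (poly-zero _)

  -- If β ≠ 0, the line meets y = const in the single point with abscissa x₀ y, which is linear in
  -- y, so the k-th moment is the k-th power of x₀ y. If β = 0, there is no dependence on x.
  moments-line : ∀ α β γ → Moments (λ x y → ind (α ⊕ x ⊗ β ⊕ y ⊗ γ))
  moments-line α β γ with β ≟ 𝟘
  ... | yes refl = moments-cong (λ x y → cong (λ t → ind (α ⊕ t ⊕ y ⊗ γ)) (zeroʳ x)) (moments-constant-on-lines (λ y → ind (α ⊕ 𝟘 ⊕ y ⊗ γ)))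
  ... | no β≢0 = low-moments _ λ k _ → poly-cong (collapse k) (poly-linear-pow (⊖ (i ⊗ α)) (⊖ (i ⊗ γ)) k)
    where
    i = proj₁ (invertible β β≢0)
    βi≡1 = proj₂ (invertible β β≢0)
    x₀ : K → K
    x₀ y = ⊖ (i ⊗ α) ⊕ ⊖ (i ⊗ γ) ⊗ y
    on : ∀ y → α ⊕ x₀ y ⊗ β ⊕ y ⊗ γ ≡ 𝟘
    on y = begin
      α ⊕ x₀ y ⊗ β ⊕ y ⊗ γ
        ≡⟨ solve 5 (λ α β γ i y → α :+ (:- (i :* α) :+ :- (i :* γ) :* y) :* β :+ y :* γ := (α :+ y :* γ) :+ :- (β :* i :* (α :+ y :* γ))) refl α β γ i y ⟩
      (α ⊕ y ⊗ γ) ⊕ ⊖ (β ⊗ i ⊗ (α ⊕ y ⊗ γ))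
        ≡⟨ cong (λ t → (α ⊕ y ⊗ γ) ⊕ ⊖ t) (trans (cong (_⊗ (α ⊕ y ⊗ γ)) βi≡1) (*-identityˡ _)) ⟩
      (α ⊕ y ⊗ γ) ⊕ ⊖ (α ⊕ y ⊗ γ)
        ≡⟨ -‿inverseʳ _ ⟩
      𝟘 ∎
    off : ∀ y x → x ≢ x₀ y → α ⊕ x ⊗ β ⊕ y ⊗ γ ≢ 𝟘
    off y x ne e = ne (⊖-≡𝟘 (⊗-cancel β≢0 (begin
      β ⊗ (x ⊕ ⊖ x₀ y)
        ≡⟨ solve 5 (λ α β g x z → β :* (x :+ :- z) := (α :+ x :* β :+ g) :+ :- (α :+ z :* β :+ g)) refl α β (y ⊗ γ) x (x₀ y) ⟩
      (α ⊕ x ⊗ β ⊕ y ⊗ γ) ⊕ ⊖ (α ⊕ x₀ y ⊗ β ⊕ y ⊗ γ)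
        ≡⟨ cong₂ (λ s t → s ⊕ ⊖ t) e (on y) ⟩
      𝟘 ⊕ ⊖ 𝟘
        ≡⟨ -‿inverseʳ 𝟘 ⟩
      𝟘 ∎)))
    collapse : ∀ k y → Σᴷ.∑ elems (λ x → ind (α ⊕ x ⊗ β ⊕ y ⊗ γ) ⊗ pow x k) ≡ pow (x₀ y) k
    collapse k y = trans (Σᴷ.∑-single (∈-elems (x₀ y)) elems-unique λ x _ ne → trans (cong (_⊗ pow x k) (ind-≢ (off y x ne))) (zeroˡ _))
      (trans (cong (_⊗ pow (x₀ y) k) (ind-𝟘 (on y))) (*-identityˡ _))

  -- The directions w and v′ may be dependent or zero, so that an average over all v′ needs no
  -- exceptions.
  PlaneMoments : ∀ {k} → (Vec K k → K) → Set
  PlaneMoments {k} g = ∀ v w v′ → Moments (λ x y → g (v +ᵛ x ·ᵛ w +ᵛ y ·ᵛ v′))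

  planeMoments-hyperplane : ∀ {k} (u : Vec K k) → PlaneMoments (λ v → ind (dot u v))
  planeMoments-hyperplane u v w v′ = moments-cong (λ x y → cong ind
    (trans (dot-+ u _ _) (cong₂ _⊕_ (trans (dot-+ u _ _) (cong (dot u v ⊕_) (dot-· u w x))) (dot-· u v′ y))))
    (moments-line (dot u v) (dot u w) (dot u v′))

  nz≤1 : ∀ x → nz x ≤ 1
  nz≤1 x = []≤1 _

-- Averaging the plane inequality over the planes through a line

module Lines (𝔽 : Field) where
  open Field 𝔽 using (K; 𝟘; 𝟙; _⊕_; _⊗_; ⊖_; enum; elems; q; _≟_; +-identityʳ; ∈-elems; 𝟘≢𝟙; invertible)
  open Vectors 𝔽 public
  open ℕₚ.≤-Reasoning
  open +-*-Solver

  line : ∀ {k} → (Vec K k → K) → Vec K k → Vec K k → K → ℕ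
  line g v w a = ∑ elems (λ x → nz (g (v +ᵛ x ·ᵛ w) ⊕ ⊖ a))

  -- The inequality for planes, averaged over all planes through the line v + K w.
  -- On that line g may be shifted by any constant without affecting the moments.
  line-average : ∀ {k} (g : Vec K k → K) → PlaneMoments g → ∀ v w a →
    q ^ k * (q * line g v w a) ≤ q ^ k * (line g v w a * line g v w a) + r * (q * ∑ᵛ k (nz ∘ g))
  line-average {k} g m v w a = ℕₚ.+-cancelʳ-≤ (q ^ k * s₀) _ _ (begin
    q ^ k * (q * t) + q ^ k * s₀  ≡⟨ ℕₚ.*-distribˡ-+ (q ^ k) (q * t) s₀ ⟨
    q ^ k * (q * t + s₀)  ≡⟨ ∑ᵛ-const k _ ⟨
    ∑ᵛ k (λ _ → q * t + s₀)  ≤⟨ ∑-mono (vecs elems k) plane ⟩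
    ∑ᵛ k (λ v′ → t * t + ∑ elems (λ y → ∑ elems (λ x → at v′ x y)))
                        ≡⟨ trans (∑-⊕ (vecs elems k) _ _) (cong₂ _+_ (∑ᵛ-const k _) total) ⟩
    q ^ k * (t * t) + (q ^ k * s₀ + r * (q * S)) ≡⟨ solve 3 (λ a b c → a :+ (b :+ c) := a :+ c :+ b) refl (q ^ k * (t * t)) _ _ ⟩
    q ^ k * (t * t) + r * (q * S) + q ^ k * s₀ ∎)
    where
    t = line g v w a
    S = ∑ᵛ k (nz ∘ g)
    s₀ = ∑ elems (λ x → nz (g (v +ᵛ x ·ᵛ w)))
    at : Vec K k → K → K → ℕ
    at v′ x y = nz (g (v +ᵛ x ·ᵛ w +ᵛ y ·ᵛ v′))
    at-𝟘 : ∀ u (v′ : Vec K k) → u +ᵛ 𝟘 ·ᵛ v′ ≡ u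
    at-𝟘 u v′ = trans (cong (u +ᵛ_) (·ᵛ-zero v′)) (+ᵛ-identityʳ u)
    -- The shift by -a on the line y = 0 alone: the line then has t support points, and the rest of
    -- the plane is unchanged.
    h : K → K
    h y = if does (y ≟ 𝟘) then ⊖ a else 𝟘
    h-𝟘 : h 𝟘 ≡ ⊖ a
    h-𝟘 with 𝟘 ≟ 𝟘
    ... | yes _ = refl
    ... | no ne = ⊥-elim (ne refl)
    h-≢ : ∀ y → y ≢ 𝟘 → h y ≡ 𝟘
    h-≢ y ne with y ≟ 𝟘
    ... | yes e = ⊥-elim (ne e)
    ... | no _  = refl
    plane : ∀ v′ → q * t + s₀ ≤ t * t + ∑ elems (λ y → ∑ elems (λ x → at v′ x y))
    plane v′ = ℕₚ.+-cancelʳ-≤ t _ _ (begin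
      q * t + s₀ + t  ≡⟨ solve 3 (λ a b c → a :+ b :+ c := a :+ c :+ b) refl (q * t) s₀ t ⟩
      q * t + t + s₀  ≤⟨ ℕₚ.+-monoˡ-≤ s₀ (subst (λ s → q * s + s ≤ Φ + s * s) s≡t (PlaneBound.line-bound G moments)) ⟩
      Φ + t * t + s₀  ≡⟨ solve 3 (λ a b c → a :+ b :+ c := b :+ (a :+ c)) refl Φ (t * t) s₀ ⟩
      t * t + (Φ + s₀)  ≡⟨ cong (t * t +_) split ⟩
      t * t + (t + Ψ)  ≡⟨ solve 3 (λ a b c → a :+ (b :+ c) := a :+ c :+ b) refl (t * t) t Ψ ⟩
      t * t + Ψ + t ∎)
      where
      G : K → K → K
      G x y = g (v +ᵛ x ·ᵛ w +ᵛ y ·ᵛ v′) ⊕ h y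
      moments : Moments G
      moments = moments-⊕ (m v w v′) (moments-constant-on-lines h)
      Φ = ∑ elems (λ y → ∑ elems (λ x → nz (G x y)))
      Ψ = ∑ elems (λ y → ∑ elems (λ x → at v′ x y))
      G-𝟘 : ∑ elems (λ x → nz (G x 𝟘)) ≡ t
      G-𝟘 = ∑-cong elems λ x → cong nz (cong₂ _⊕_ (cong g (at-𝟘 (v +ᵛ x ·ᵛ w) v′)) h-𝟘)
      s≡t : PlaneBound.s G moments ≡ t
      s≡t = trans (length-filter _ elems) G-𝟘
      split : Φ + s₀ ≡ t + Ψ
      split = begin-equality
        Φ + s₀  ≡⟨ cong (Φ +_) (∑-cong elems λ x → cong (nz ∘ g) (at-𝟘 (v +ᵛ x ·ᵛ w) v′)) ⟨
        Φ + ∑ elems (λ x → at v′ x 𝟘)  ≡⟨ ∑-split-𝟘 _ _ (λ y ne → ∑-cong elems λ x → cong nz (trans (cong (_ ⊕_) (h-≢ y ne)) (+-identityʳ _))) ⟩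
        ∑ elems (λ x → nz (G x 𝟘)) + Ψ  ≡⟨ cong (_+ Ψ) G-𝟘 ⟩
        t + Ψ ∎
    total : ∑ᵛ k (λ v′ → ∑ elems (λ y → ∑ elems (λ x → at v′ x y))) ≡ q ^ k * s₀ + r * (q * S)
    total = begin-equality
      ∑ᵛ k (λ v′ → ∑ elems (λ y → ∑ elems (λ x → at v′ x y)))  ≡⟨ ∑-swap (vecs elems k) elems _ ⟩
      ∑ elems (λ y → ∑ᵛ k (λ v′ → ∑ elems (λ x → at v′ x y)))  ≡⟨ ∑-const-off-𝟘 _ (q * S) generic ⟩
      ∑ᵛ k (λ v′ → ∑ elems (λ x → at v′ x 𝟘)) + r * (q * S)  ≡⟨ cong (_+ r * (q * S)) (trans
                        (∑-cong (vecs elems k) λ v′ → ∑-cong elems λ x → cong (nz ∘ g) (at-𝟘 (v +ᵛ x ·ᵛ w) v′))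
                        (∑ᵛ-const k s₀)) ⟩
      q ^ k * s₀ + r * (q * S) ∎
      where
      -- For fixed x and y ≠ 0 the point v + x w + y v′ runs once through the whole space as v′
      -- does.
      generic : ∀ y → y ≢ 𝟘 → ∑ᵛ k (λ v′ → ∑ elems (λ x → at v′ x y)) ≡ q * S
      generic y y≢0 = trans (∑-swap (vecs elems k) elems _)
        (trans (∑-cong elems λ x → ∑ᵛ-affine (v +ᵛ x ·ᵛ w) y≢0 (nz ∘ g)) (∑-const elems S))

∑->-const : {A : Set} (xs : List A) {f : A → ℕ} {c : ℕ} → 0 < length xs → (∀ x → c < f x) → length xs * c < ∑ xs f
∑->-const (x ∷ [])     {f} {c} _ gt = ℕₚ.+-mono-<-≤ (gt x) ℕₚ.≤-refl
∑->-const (x ∷ y ∷ xs) {f} {c} _ gt = ℕₚ.+-mono-< (gt x) (∑->-const (y ∷ xs) (s≤s z≤n) gt)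

-- With t = B + 1 + i and q - t = B + 1 + j, the difference t(q - t) - (q - 1)B equals i + j + i j +
-- B + 1 - B². It is positive since i + j = q - 2B - 2 is at least B².
quadratic-gap : ∀ B q r t → q ≡ suc r → 4 * (suc B * suc B) ≤ q → q * t ≤ t * t + r * B → t ≤ B ⊎ q ≤ t + B
quadratic-gap B q r t q≡ big le with t ℕₚ.≤? B | q ℕₚ.≤? t + B
... | yes t≤B | _ = inj₁ t≤B
... | no _ | yes q≤ = inj₂ q≤
... | no t≰B | no q≰ = ⊥-elim (ℕₚ.<⇒≱ lt le)
  where
  open ℕₚ.≤-Reasoning
  open +-*-Solver
  i = t ∸ suc B
  j = q ∸ suc (t + B)
  t≡ : t ≡ suc B + i
  t≡ = sym (ℕₚ.m+[n∸m]≡n (ℕₚ.≰⇒> t≰B))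
  q≡′ : q ≡ suc (t + B) + j
  q≡′ = sym (ℕₚ.m+[n∸m]≡n (ℕₚ.≰⇒> q≰))
  q≡″ : q ≡ suc (suc B + i + B) + j
  q≡″ = trans q≡′ (cong (λ t → suc (t + B) + j) t≡)
  r≡ : r ≡ suc B + i + B + j
  r≡ = ℕₚ.suc-injective (trans (sym q≡) q≡″)
  B²≤ : B * B ≤ i + j
  B²≤ = ℕₚ.+-cancelˡ-≤ (B + B + 2) _ _ (begin
    B + B + 2 + B * B  ≤⟨ ℕₚ.m≤m+n _ (3 * (B * B) + 6 * B + 2) ⟩
    B + B + 2 + B * B + (3 * (B * B) + 6 * B + 2)
      ≡⟨ solve 1 (λ B → B :+ B :+ con 2 :+ B :* B :+ (con 3 :* (B :* B) :+ con 6 :* B :+ con 2) := con 4 :* ((con 1 :+ B) :* (con 1 :+ B))) refl B ⟩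
    4 * (suc B * suc B)  ≤⟨ big ⟩
    q  ≡⟨ q≡″ ⟩
    suc (suc B + i + B) + j  ≡⟨ solve 3 (λ B i j → con 1 :+ (con 1 :+ B :+ i :+ B) :+ j := B :+ B :+ con 2 :+ (i :+ j)) refl B i j ⟩
    B + B + 2 + (i + j) ∎)
  lt : t * t + r * B < q * t
  lt = begin-strict
    t * t + r * B ≡⟨ cong (t * t +_) (cong (_* B) r≡) ⟩
    t * t + (suc B + i + B + j) * B
      ≡⟨ cong (t * t +_) (solve 3 (λ B i j → (con 1 :+ B :+ i :+ B :+ j) :* B := B :* B :+ (B :* B :+ B :+ B :* (i :+ j))) refl B i j) ⟩
    t * t + (B * B + (B * B + B + B * (i + j)))
      ≤⟨ ℕₚ.+-monoʳ-≤ (t * t) (ℕₚ.+-monoˡ-≤ _ B²≤) ⟩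
    t * t + (i + j + (B * B + B + B * (i + j)))
      <⟨ ℕₚ.+-monoʳ-< (t * t) (ℕₚ.m≤m+n _ (B + i * j)) ⟩
    t * t + (suc (i + j + (B * B + B + B * (i + j))) + (B + i * j))
      ≡⟨ cong (t * t +_) (solve 3 (λ B i j → con 1 :+ (i :+ j :+ (B :* B :+ B :+ B :* (i :+ j))) :+ (B :+ i :* j) :=
            (con 1 :+ B :+ i) :* (con 1 :+ B :+ j)) refl B i j) ⟩
    t * t + (suc B + i) * (suc B + j)
      ≡⟨ cong (λ s → t * t + s * (suc B + j)) (sym t≡) ⟩
    t * t + t * (suc B + j)
      ≡⟨ solve 3 (λ t B j → t :* t :+ t :* (con 1 :+ B :+ j) := (con 1 :+ (t :+ B) :+ j) :* t) refl t B j ⟩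
    (suc (t + B) + j) * t ≡⟨ cong (_* t) (sym q≡′) ⟩
    q * t ∎

-- Linear parametrizations and deviations from a value

module LinearMaps (𝔽 : Field) where
  open Field 𝔽
  open Lines 𝔽 public
  open ≡-Reasoning

  lin : ∀ {N d} → Vec (Vec K N) d → Vec K d → Vec K N
  lin []       []       = 𝟘ᵛ
  lin (b ∷ bs) (z ∷ zs) = z ·ᵛ b +ᵛ lin bs zs

  lin-+ : ∀ {N d} (bs : Vec (Vec K N) d) z z′ → lin bs (z +ᵛ z′) ≡ lin bs z +ᵛ lin bs z′
  lin-+ []       []      []        = sym (+ᵛ-identityʳ 𝟘ᵛ)
  lin-+ (b ∷ bs) (x ∷ z) (x′ ∷ z′) = trans (cong₂ _+ᵛ_ (·ᵛ-distribʳ x x′ b) (lin-+ bs z z′)) (+ᵛ-interchange _ _ _ _)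

  lin-· : ∀ {N d} (bs : Vec (Vec K N) d) c z → lin bs (c ·ᵛ z) ≡ c ·ᵛ lin bs z
  lin-· []       c []      = sym (·ᵛ-zeroʳ c)
  lin-· (b ∷ bs) c (x ∷ z) = trans (cong₂ _+ᵛ_ (·ᵛ-assoc c x b) (lin-· bs c z)) (sym (·ᵛ-distribˡ c _ _))

  lin-line : ∀ {N d} (bs : Vec (Vec K N) d) v x w → lin bs (v +ᵛ x ·ᵛ w) ≡ lin bs v +ᵛ x ·ᵛ lin bs w
  lin-line bs v x w = trans (lin-+ bs v _) (cong (lin bs v +ᵛ_) (lin-· bs x w))

  planeMoments-affine : ∀ {N d} {f : Vec K N → K} → PlaneMoments f → ∀ u (bs : Vec (Vec K N) d) → PlaneMoments (λ z → f (u +ᵛ lin bs z))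
  planeMoments-affine {f = f} m u bs v w v′ = moments-cong (λ x y → cong f (begin
    u +ᵛ lin bs (v +ᵛ x ·ᵛ w +ᵛ y ·ᵛ v′)  ≡⟨ cong (u +ᵛ_) (lin-line bs _ y v′) ⟩
    u +ᵛ (lin bs (v +ᵛ x ·ᵛ w) +ᵛ y ·ᵛ lin bs v′)  ≡⟨ +ᵛ-assoc _ _ _ ⟨
    u +ᵛ lin bs (v +ᵛ x ·ᵛ w) +ᵛ y ·ᵛ lin bs v′  ≡⟨ cong (λ t → u +ᵛ t +ᵛ y ·ᵛ lin bs v′) (lin-line bs v x w) ⟩
    u +ᵛ (lin bs v +ᵛ x ·ᵛ lin bs w) +ᵛ y ·ᵛ lin bs v′  ≡⟨ cong (_+ᵛ y ·ᵛ lin bs v′) (sym (+ᵛ-assoc _ _ _)) ⟩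
    u +ᵛ lin bs v +ᵛ x ·ᵛ lin bs w +ᵛ y ·ᵛ lin bs v′ ∎)) (m (u +ᵛ lin bs v) (lin bs w) (lin bs v′))

  ne : K → K → ℕ
  ne x a = [ does (¬? (x ≟ a)) ]

  ne-refl : ∀ x → ne x x ≡ 0
  ne-refl x = [no] (¬? (x ≟ x)) λ k → k refl

  ne-≢ : ∀ {x y} → x ≢ y → ne x y ≡ 1
  ne-≢ {x} {y} e = [yes] (¬? (x ≟ y)) e

  ne-triangle : ∀ x y c → ne x y ≤ ne x c + ne y c
  ne-triangle x y c with x ≟ c
  ... | no _ = ℕₚ.≤-trans ([]≤1 _) (ℕₚ.m≤m+n 1 _)
  ... | yes refl = [ ¬? (x ≟ y) ]-mono (¬? (y ≟ x)) (λ k e → k (sym e))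

  ne≡nz : ∀ x a → nz (x ⊕ ⊖ a) ≡ ne x a
  ne≡nz x a = [ ¬? (x ⊕ ⊖ a ≟ 𝟘) ]-cong (¬? (x ≟ a)) (λ k e → k (trans (cong (_⊕ ⊖ a) e) (-‿inverseʳ a))) (λ k e → k (⊖-≡𝟘 e))

  -- The same count as `line`, with the test g ≠ a in place of g - a ≠ 0; the moments require the
  -- latter, the combinatorics prefers the former.
  off : ∀ {k} → (Vec K k → K) → Vec K k → Vec K k → K → ℕ
  off g v w a = ∑ elems (λ x → ne (g (v +ᵛ x ·ᵛ w)) a)

  line≡off : ∀ {k} (g : Vec K k → K) v w a → line g v w a ≡ off g v w a
  line≡off g v w a = ∑-cong elems λ x → ne≡nz _ a

  off-lin : ∀ {N d} (f : Vec K N → K) (bs : Vec (Vec K N) d) v w a → off (f ∘ lin bs) v w a ≡ off f (lin bs v) (lin bs w) a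
  off-lin f bs v w a = ∑-cong elems λ x → cong (λ u → ne (f u) a) (lin-line bs v x w)

  q^≥1 : ∀ k → 1 ≤ q ^ k
  q^≥1 k = ℕₚ.m^n>0 q k

-- Lines: every line has a dominant value

module Dominance (𝔽 : Field) (B p : ℕ) (4[B+1]²≤q : 4 * (suc B * suc B) ≤ Field.q 𝔽) (p²≤q : p * p ≤ Field.q 𝔽) where
  open Field 𝔽 using (K; 𝟘; 𝟙; _⊕_; _⊗_; ⊖_; ι; enum; elems; q; _≟_; ∈-elems; 𝟘≢𝟙; invertible)
  open LinearMaps 𝔽 public
  open ℕₚ.≤-Reasoning
  open +-*-Solver

  B²+1<q : suc (B * B) < q
  B²+1<q = ℕₚ.<-≤-trans (begin-strict
    suc (B * B)  <⟨ ℕₚ.m≤m+n _ (3 * (B * B) + 8 * B + 2) ⟩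
    suc (suc (B * B)) + (3 * (B * B) + 8 * B + 2) ≡⟨ solve 1 (λ B → con 2 :+ B :* B :+ (con 3 :* (B :* B) :+ con 8 :* B :+ con 2) := con 4 :* ((con 1 :+ B) :* (con 1 :+ B))) refl B ⟩
    4 * (suc B * suc B) ∎) 4[B+1]²≤q

  pB<q : p * B < q
  pB<q with p ℕₚ.≤? B
  ... | yes p≤B = ℕₚ.≤-<-trans (ℕₚ.≤-trans (ℕₚ.*-monoˡ-≤ B p≤B) (ℕₚ.n≤1+n _)) B²+1<q
  ... | no p≰B = ℕₚ.<-≤-trans (ℕₚ.*-monoʳ-< p {{>-nonZero (ℕₚ.≤-<-trans z≤n (ℕₚ.≰⇒> p≰B))}} (ℕₚ.≰⇒> p≰B)) p²≤q

  Dichotomous : ∀ {k} → (Vec K k → K) → Set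
  Dichotomous g = ∀ v w a → off g v w a ≤ B ⊎ q ≤ off g v w a + B

  Valued : ∀ {k} → (Vec K k → K) → Set
  Valued g = ∀ v → ∃ λ m → m < p × g v ≡ ι m

  dichotomy : ∀ {k} (g : Vec K k → K) → PlaneMoments g → q * ∑ᵛ k (nz ∘ g) ≤ B * q ^ k → Dichotomous g
  dichotomy {k} g m sparse v w a = subst (λ t → t ≤ B ⊎ q ≤ t + B) (line≡off g v w a)
    (quadratic-gap B q r t q≡1+r 4[B+1]²≤q (ℕₚ.*-cancelˡ-≤ (q ^ k) {{>-nonZero (q^≥1 k)}} (begin
      q ^ k * (q * t)  ≤⟨ line-average g m v w a ⟩
      q ^ k * (t * t) + r * (q * ∑ᵛ k (nz ∘ g))  ≤⟨ ℕₚ.+-monoʳ-≤ (q ^ k * (t * t)) (ℕₚ.*-monoʳ-≤ r sparse) ⟩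
      q ^ k * (t * t) + r * (B * q ^ k)  ≡⟨ solve 4 (λ Q t r B → Q :* (t :* t) :+ r :* (B :* Q) := Q :* (t :* t :+ r :* B)) refl (q ^ k) t r B ⟩
      q ^ k * (t * t + r * B) ∎)))
    where t = line g v w a

  -- Otherwise, by the dichotomy, each of the p possible values would occur at most B times among
  -- the q parameters of the line, but p B < q.
  dominant-value : ∀ {k} (g : Vec K k → K) → Dichotomous g → Valued g → ∀ v w → ∃ λ a → off g v w a ≤ B
  dominant-value g di val v w with Any.any? (λ m → off g v w (ι m) ℕₚ.≤? B) (range p)
  ... | yes found = let (m , _ , le) = find found in ι m , le
  ... | no none = ⊥-elim (ℕₚ.<⇒≱ pB<q (begin
      q  ≡⟨ ℕₚ.*-identityʳ q ⟨
      q * 1  ≡⟨ ∑-const elems 1 ⟨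
      ∑ elems (λ _ → 1)  ≤⟨ ∑-mono elems (λ x → let (m , m<p , e) = val (v +ᵛ x ·ᵛ w) in
                        ℕₚ.≤-trans (ℕₚ.≤-reflexive (sym ([yes] (_ ≟ ι m) e))) (term≤∑ (∈-range⁺ m<p))) ⟩
      ∑ elems (λ x → ∑ (range p) (λ m → eq x m))  ≡⟨ ∑-swap elems (range p) _ ⟩
      ∑ (range p) (λ m → ∑ elems (λ x → eq x m))  ≤⟨ few (range p) (λ m m∈ → m∈) ⟩
      length (range p) * B  ≡⟨ cong (_* B) (length-range p) ⟩
      p * B ∎))
    where
    eq : K → ℕ → ℕ
    eq x m = [ does (g (v +ᵛ x ·ᵛ w) ≟ ι m) ]
    off+eq : ∀ m → off g v w (ι m) + ∑ elems (λ x → eq x m) ≡ q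
    off+eq m = begin-equality
      off g v w (ι m) + ∑ elems (λ x → eq x m)  ≡⟨ ∑-⊕ elems _ _ ⟨
      ∑ elems (λ x → ne (g (v +ᵛ x ·ᵛ w)) (ι m) + eq x m) ≡⟨ ∑-cong elems (λ x → [¬]+[] (_ ≟ _)) ⟩
      ∑ elems (λ _ → 1)  ≡⟨ trans (∑-const elems 1) (ℕₚ.*-identityʳ q) ⟩
      q ∎
    rare : ∀ m → m ∈ range p → ∑ elems (λ x → eq x m) ≤ B
    rare m m∈ with di v w (ι m)
    ... | inj₁ le = ⊥-elim (none (lose m∈ le))
    ... | inj₂ ge = ℕₚ.+-cancelˡ-≤ (off g v w (ι m)) _ _ (subst (_≤ off g v w (ι m) + B) (sym (off+eq m)) ge)
    few : ∀ ms → (∀ m → m ∈ ms → m ∈ range p) → ∑ ms (λ m → ∑ elems (λ x → eq x m)) ≤ length ms * B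
    few []       _  = z≤n
    few (m ∷ ms) ms⊆ = ℕₚ.+-mono-≤ (rare m (ms⊆ m (here refl))) (few ms λ m′ m′∈ → ms⊆ m′ (there m′∈))

  -- If t were the maximal number of support points on the lines through Q in the plane and t ≤ B, then counting
  -- the support along these lines and bounding it from below by line-average would give q ≤ t² + 1.
  heavy-line : ∀ {N} (f : Vec K N → K) → PlaneMoments f → ∀ Q (bs : Vec (Vec K N) 2) → f Q ≢ 𝟘 →
    ∃ λ z → z ≢ 𝟘ᵛ × B < off f Q (lin bs z) 𝟘
  heavy-line f m Q bs fQ≢0 with Enum.search (Vec-enum enum 2) (λ z → ¬? (Enum._≟_ (Vec-enum enum 2) z 𝟘ᵛ) ×-dec (B ℕₚ.<? off f Q (lin bs z) 𝟘))
  ... | yes found = found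
  ... | no none = ⊥-elim (descend B ℕₚ.≤-refl λ z z≢0 → ℕₚ.≮⇒≥ λ lt → none (z , z≢0 , subst (B <_) (count≡off z) lt))
    where
    g : Vec K 2 → K
    g z = f (Q +ᵛ lin bs z)
    count : Vec K 2 → ℕ
    count z = ∑ elems (λ x → nz (g (x ·ᵛ z)))
    count≡off : ∀ z → count z ≡ off f Q (lin bs z) 𝟘
    count≡off z = ∑-cong elems λ x → cong (λ t → nz (f (Q +ᵛ t))) (lin-· bs x z)
    count≡line : ∀ z → count z ≡ line g 𝟘ᵛ z 𝟘
    count≡line z = trans (∑-cong elems λ x → cong (nz ∘ g) (sym (+ᵛ-identityˡ _))) (sym (line≡off g 𝟘ᵛ z 𝟘))
    S = ∑ᵛ 2 (nz ∘ g)
    g𝟘 : nz (g 𝟘ᵛ) ≡ 1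
    g𝟘 = [yes] (¬? (g 𝟘ᵛ ≟ 𝟘)) λ e → fQ≢0 (trans (cong f (sym (trans (cong (Q +ᵛ_) lin-𝟘) (+ᵛ-identityʳ Q)))) e)
      where
      lin-𝟘 : lin bs 𝟘ᵛ ≡ 𝟘ᵛ
      lin-𝟘 = trans (cong (lin bs) (sym (·ᵛ-zero 𝟘ᵛ))) (trans (lin-· bs 𝟘 𝟘ᵛ) (·ᵛ-zero _))
    total : ∑ᵛ 2 count ≡ q ^ 2 + r * S
    total = begin-equality
      ∑ᵛ 2 count  ≡⟨ ∑-swap (vecs elems 2) elems _ ⟩
      ∑ elems (λ x → ∑ᵛ 2 (λ z → nz (g (x ·ᵛ z))))  ≡⟨ ∑-const-off-𝟘 _ S (λ x x≢0 → ∑ᵛ-scale x≢0 (nz ∘ g)) ⟩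
      ∑ᵛ 2 (λ z → nz (g (𝟘 ·ᵛ z))) + r * S  ≡⟨ cong (_+ r * S) (trans (∑-cong (vecs elems 2) λ z → trans (cong (nz ∘ g) (·ᵛ-zero z)) g𝟘)
                        (trans (∑ᵛ-const 2 1) (ℕₚ.*-identityʳ _))) ⟩
      q ^ 2 + r * S ∎
    descend : ∀ t → t ≤ B → (∀ z → z ≢ 𝟘ᵛ → count z ≤ t) → ⊥
    -- No line through Q has t = 0, because Q itself, at parameter 0, is a support point.
    descend zero t≤B bound = ℕₚ.<⇒≱ (s≤s z≤n) (ℕₚ.≤-trans
        (ℕₚ.≤-trans (ℕₚ.≤-reflexive (sym (trans (cong (nz ∘ g) (·ᵛ-zero e₁)) g𝟘))) (term≤∑ (∈-elems 𝟘))) (bound e₁ λ e → 𝟘≢𝟙 (sym (cong Vec.head e))))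
      where
      e₁ : Vec K 2
      e₁ = 𝟙 ∷ 𝟘 ∷ []
    descend (suc t) t≤B bound with Enum.search (Vec-enum enum 2) (λ z → ¬? (Enum._≟_ (Vec-enum enum 2) z 𝟘ᵛ) ×-dec (t ℕₚ.<? count z))
    ... | no none′ = descend t (ℕₚ.<⇒≤ t≤B) λ z z≢0 → ℕₚ.≮⇒≥ λ lt → none′ (z , z≢0 , lt)
    ... | yes (z , z≢0 , t<) = ℕₚ.<⇒≱ B²+1<q (ℕₚ.≤-trans q≤ (s≤s (ℕₚ.*-mono-≤ t≤B t≤B)))
      where
      τ = suc t
      τ≡ : line g 𝟘ᵛ z 𝟘 ≡ τ
      τ≡ = trans (sym (count≡line z)) (ℕₚ.≤-antisym (bound z z≢0) t<)
      average : q ^ 2 * (q * τ) ≤ q ^ 2 * (τ * τ) + r * (q * S)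
      average = subst (λ t → q ^ 2 * (q * t) ≤ q ^ 2 * (t * t) + r * (q * S)) τ≡
                  (line-average g (planeMoments-affine {f = f} m Q bs) 𝟘ᵛ z 𝟘)
      -- Every direction other than 0 contributes at most τ; the direction 0 repeats Q and
      -- contributes at most q.
      through-Q : q ^ 2 + r * S ≤ q ^ 2 * τ + q
      through-Q = begin
        q ^ 2 + r * S  ≡⟨ total ⟨
        ∑ᵛ 2 count  ≤⟨ ∑-mono (vecs elems 2) pointwise ⟩
        ∑ᵛ 2 (λ z → τ + pick (Vec-enum enum 2) 𝟘ᵛ (λ _ → q) z)  ≡⟨ ∑-⊕ (vecs elems 2) _ _ ⟩
        ∑ᵛ 2 (λ z → τ) + ∑ᵛ 2 (pick (Vec-enum enum 2) 𝟘ᵛ (λ _ → q)) ≡⟨ cong₂ _+_ (∑ᵛ-const 2 τ) (∑-pick (Vec-enum enum 2) 𝟘ᵛ (λ _ → q)) ⟩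
        q ^ 2 * τ + q ∎
        where
        pointwise : ∀ z → count z ≤ τ + pick (Vec-enum enum 2) 𝟘ᵛ (λ _ → q) z
        pointwise z with Enum._≟_ (Vec-enum enum 2) z 𝟘ᵛ
        ... | no z≢0 = ℕₚ.≤-trans (bound z z≢0) (ℕₚ.m≤m+n _ _)
        ... | yes _ = ℕₚ.≤-trans (ℕₚ.≤-trans (∑-≤-const elems λ x → nz≤1 _) (ℕₚ.≤-reflexive (ℕₚ.*-identityʳ q))) (ℕₚ.m≤n+m q τ)
      q≤ : q ≤ suc (τ * τ)
      q≤ = ℕₚ.*-cancelˡ-≤ (q ^ 2) {{>-nonZero (q^≥1 2)}} (ℕₚ.+-cancelˡ-≤ (q ^ 2 * (q * τ)) _ _ (begin
        q ^ 2 * (q * τ) + q ^ 2 * q  ≤⟨ ℕₚ.+-monoˡ-≤ _ average ⟩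
        q ^ 2 * (τ * τ) + r * (q * S) + q ^ 2 * q  ≡⟨ solve 5 (λ Q τ r q S → Q :* (τ :* τ) :+ r :* (q :* S) :+ Q :* q := Q :* (τ :* τ) :+ q :* (Q :+ r :* S)) refl (q ^ 2) τ r q S ⟩
        q ^ 2 * (τ * τ) + q * (q ^ 2 + r * S)  ≤⟨ ℕₚ.+-monoʳ-≤ (q ^ 2 * (τ * τ)) (ℕₚ.*-monoʳ-≤ q through-Q) ⟩
        q ^ 2 * (τ * τ) + q * (q ^ 2 * τ + q)  ≡⟨ solve 2 (λ τ q → q :^ 2 :* (τ :* τ) :+ q :* (q :^ 2 :* τ :+ q) := q :^ 2 :* (q :* τ) :+ q :^ 2 :* (con 1 :+ τ :* τ)) refl τ q ⟩
        q ^ 2 * (q * τ) + q ^ 2 * suc (τ * τ) ∎))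

  -- The value a is missed by a fraction of at most 2B/(q - 1). Two random points of a line differ
  -- in value with probability at most 2B/q; discarding the parameter difference 0, where they
  -- coincide, replaces q by q - 1.
  Dominated : ∀ {d} → (Vec K d → K) → K → Set
  Dominated {d} g a = r * ∑ᵛ d (λ z → ne (g z) a) ≤ 2 * B * q ^ d

  -- Two random points lie on a random line, where values rarely differ.
  dominated : ∀ {d} (g : Vec K d → K) → Dichotomous g → Valued g → ∃ λ z → Dominated g (g z)
  dominated {d} g di val with Enum.search (Vec-enum enum d) (λ z → r * ∑ᵛ d (λ z′ → ne (g z′) (g z)) ℕₚ.≤? 2 * B * q ^ d)
  ... | yes found = found
  ... | no none = ⊥-elim (ℕₚ.<⇒≱ many few)
    where
    differ : ∀ v w → ℕ
    differ v w = ne (g w) (g v)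
    D = ∑ᵛ d (λ v → ∑ᵛ d (differ v))
    many : q ^ d * (2 * B * q ^ d) < r * D
    many = begin-strict
      q ^ d * (2 * B * q ^ d)  ≡⟨ cong (_* (2 * B * q ^ d)) (∣vecs∣ d) ⟨
      length (vecs elems d) * (2 * B * q ^ d) <⟨ ∑->-const (vecs elems d) (subst (0 <_) (sym (∣vecs∣ d)) (q^≥1 d)) (λ v → ℕₚ.≰⇒> λ le → none (v , le)) ⟩
      ∑ᵛ d (λ v → r * ∑ᵛ d (differ v))  ≡⟨ ∑-*ˡ (vecs elems d) r _ ⟩
      r * D ∎
    -- Sliding v along w by every x at once turns the pairs (v, v + y w) into all pairs of
    -- parameters on each line; this costs the factor q.
    pairs-on-line : ∀ w → ∑ᵛ d (λ v → ∑ elems (λ y → differ v (v +ᵛ y ·ᵛ w))) * q ≤ q ^ d * (2 * B * q)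
    pairs-on-line w = begin
      ∑ᵛ d (λ v → ∑ elems (λ y → differ v (v +ᵛ y ·ᵛ w))) * q
        ≡⟨ trans (ℕₚ.*-comm _ q) (sym (∑-const elems _)) ⟩
      ∑ elems (λ x → ∑ᵛ d (λ v → ∑ elems (λ y → differ v (v +ᵛ y ·ᵛ w))))
        ≡⟨ ∑-cong elems (λ x → sym (∑ᵛ-translate (x ·ᵛ w) _)) ⟩
      ∑ elems (λ x → ∑ᵛ d (λ v → ∑ elems (λ y → differ (x ·ᵛ w +ᵛ v) (x ·ᵛ w +ᵛ v +ᵛ y ·ᵛ w))))
        ≡⟨ ∑-cong elems (λ x → ∑-cong (vecs elems d) λ v → trans
             (∑-cong elems λ y → cong₂ (λ s t → ne (g s) (g t)) (slide x y v) (+ᵛ-comm (x ·ᵛ w) v))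
             (∑-bijection enum (x ⊕_) (⊖ x ⊕_) (λ y → cancel₁ x y) (λ y → cancel₂ x y) (λ y → differ (v +ᵛ x ·ᵛ w) (v +ᵛ y ·ᵛ w)))) ⟩
      ∑ elems (λ x → ∑ᵛ d (λ v → ∑ elems (λ y → differ (v +ᵛ x ·ᵛ w) (v +ᵛ y ·ᵛ w))))
        ≡⟨ ∑-swap elems (vecs elems d) _ ⟩
      ∑ᵛ d (λ v → ∑ elems (λ x → ∑ elems (λ y → differ (v +ᵛ x ·ᵛ w) (v +ᵛ y ·ᵛ w))))
        ≤⟨ ∑-≤-const (vecs elems d) on-line ⟩
      length (vecs elems d) * (2 * B * q)
        ≡⟨ cong (_* (2 * B * q)) (∣vecs∣ d) ⟩
      q ^ d * (2 * B * q) ∎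
      where
      module FS = Solver 𝔽
      cancel₁ : ∀ x y → x ⊕ (⊖ x ⊕ y) ≡ y
      cancel₁ = FS.solve 2 (λ x y → x FS.:+ (FS.:- x FS.:+ y) FS.:= y) refl
      cancel₂ : ∀ x y → ⊖ x ⊕ (x ⊕ y) ≡ y
      cancel₂ = FS.solve 2 (λ x y → FS.:- x FS.:+ (x FS.:+ y) FS.:= y) refl
      slide : ∀ x y v → x ·ᵛ w +ᵛ v +ᵛ y ·ᵛ w ≡ v +ᵛ (x ⊕ y) ·ᵛ w
      slide x y v = trans (cong (_+ᵛ y ·ᵛ w) (+ᵛ-comm _ v)) (trans (+ᵛ-assoc v _ _) (cong (v +ᵛ_) (sym (·ᵛ-distribʳ x y w))))
      on-line : ∀ v → ∑ elems (λ x → ∑ elems (λ y → differ (v +ᵛ x ·ᵛ w) (v +ᵛ y ·ᵛ w))) ≤ 2 * B * q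
      on-line v = let (a , le) = dominant-value g di val v w in begin
        ∑ elems (λ x → ∑ elems (λ y → differ (v +ᵛ x ·ᵛ w) (v +ᵛ y ·ᵛ w)))
          ≤⟨ ∑-mono elems (λ x → ∑-mono elems λ y → ne-triangle _ _ a) ⟩
        ∑ elems (λ x → ∑ elems (λ y → ne (g (v +ᵛ y ·ᵛ w)) a + ne (g (v +ᵛ x ·ᵛ w)) a))
          ≡⟨ ∑-cong elems (λ x → trans (∑-⊕ elems _ _) (cong (off g v w a +_) (∑-const elems _))) ⟩
        ∑ elems (λ x → off g v w a + q * ne (g (v +ᵛ x ·ᵛ w)) a)
          ≡⟨ trans (∑-⊕ elems _ _) (cong₂ _+_ (∑-const elems _) (∑-*ˡ elems q _)) ⟩
        q * off g v w a + q * off g v w a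
          ≤⟨ ℕₚ.+-mono-≤ (ℕₚ.*-monoʳ-≤ q le) (ℕₚ.*-monoʳ-≤ q le) ⟩
        q * B + q * B ≡⟨ solve 2 (λ q B → q :* B :+ q :* B := con 2 :* B :* q) refl q B ⟩
        2 * B * q ∎
    few : r * D ≤ q ^ d * (2 * B * q ^ d)
    few = ℕₚ.*-cancelʳ-≤ _ _ q (begin
      r * D * q
        ≡⟨ cong (_* q) rD≡ ⟩
      ∑ᵛ d (λ w → ∑ᵛ d (λ v → ∑ elems (λ y → differ v (v +ᵛ y ·ᵛ w)))) * q
        ≡⟨ sym (∑-*ʳ (vecs elems d) q _) ⟩
      ∑ᵛ d (λ w → ∑ᵛ d (λ v → ∑ elems (λ y → differ v (v +ᵛ y ·ᵛ w))) * q)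
        ≤⟨ ∑-≤-const (vecs elems d) pairs-on-line ⟩
      length (vecs elems d) * (q ^ d * (2 * B * q))
        ≡⟨ cong (_* (q ^ d * (2 * B * q))) (∣vecs∣ d) ⟩
      q ^ d * (q ^ d * (2 * B * q))
        ≡⟨ solve 3 (λ D B q → D :* (D :* (con 2 :* B :* q)) := D :* (con 2 :* B :* D) :* q) refl (q ^ d) B q ⟩
      q ^ d * (2 * B * q ^ d) * q ∎)
      where
      -- The parameter y = 0 contributes nothing, and for each of the q - 1 others v + y w runs
      -- through the whole space as w does.
      rD≡ : r * D ≡ ∑ᵛ d (λ w → ∑ᵛ d (λ v → ∑ elems (λ y → differ v (v +ᵛ y ·ᵛ w))))
      rD≡ = sym (begin-equality
        ∑ᵛ d (λ w → ∑ᵛ d (λ v → ∑ elems (λ y → differ v (v +ᵛ y ·ᵛ w))))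
          ≡⟨ ∑-swap (vecs elems d) (vecs elems d) _ ⟩
        ∑ᵛ d (λ v → ∑ᵛ d (λ w → ∑ elems (λ y → differ v (v +ᵛ y ·ᵛ w))))
          ≡⟨ ∑-cong (vecs elems d) (λ v → trans (∑-swap (vecs elems d) elems _) (trans
               (∑-const-off-𝟘 _ (∑ᵛ d (differ v)) λ y y≢0 → ∑ᵛ-affine v y≢0 (differ v))
               (cong (_+ r * ∑ᵛ d (differ v)) (∑-zero (vecs elems d) λ w _ → trans
                 (cong (λ u → ne (g u) (g v)) (trans (cong (v +ᵛ_) (·ᵛ-zero w)) (+ᵛ-identityʳ v))) (ne-refl (g v)))))) ⟩
        ∑ᵛ d (λ v → r * ∑ᵛ d (differ v))
          ≡⟨ ∑-*ˡ (vecs elems d) r _ ⟩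
        r * D ∎)

-- The numerical clash in which `Obstruction` ends: c ≥ 3(B + 1) gives q² ≤ 2c², and e exceeds 4B².
cubic-gap : ∀ B q c e → c + suc B ≡ q → e + 2 * B + 1 ≡ q → 4 * (suc B * suc B) ≤ q → 2 * (B * B) * (q * q) < c * c * e
cubic-gap B q c e c≡ e≡ big = ℕₚ.*-cancelˡ-< 2 _ _ (begin-strict
  2 * (2 * (B * B) * (q * q))  ≡⟨ solve 2 (λ B q → con 2 :* (con 2 :* (B :* B) :* (q :* q)) := (q :* q) :* (con 4 :* (B :* B))) refl B q ⟩
  q * q * (4 * (B * B))  <⟨ ℕₚ.*-monoʳ-< (q * q) {{>-nonZero (ℕₚ.*-mono-≤ q≥1 q≥1)}} e> ⟩
  q * q * e  ≤⟨ ℕₚ.*-monoˡ-≤ e q²≤ ⟩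
  2 * (c * c) * e  ≡⟨ ℕₚ.*-assoc 2 (c * c) e ⟩
  2 * (c * c * e) ∎)
  where
  open ℕₚ.≤-Reasoning
  open +-*-Solver
  k = suc B
  q≥1 : 1 ≤ q
  q≥1 = ℕₚ.≤-trans (s≤s z≤n) big
  e> : 4 * (B * B) < e
  e> = ℕₚ.+-cancelʳ-< (2 * B + 1) _ _ (begin-strict
    4 * (B * B) + (2 * B + 1)  <⟨ ℕₚ.m≤m+n _ (6 * B + 2) ⟩
    suc (4 * (B * B) + (2 * B + 1)) + (6 * B + 2)
      ≡⟨ solve 1 (λ B → con 1 :+ (con 4 :* (B :* B) :+ (con 2 :* B :+ con 1)) :+ (con 6 :* B :+ con 2) := con 4 :* ((con 1 :+ B) :* (con 1 :+ B))) refl B ⟩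
    4 * (suc B * suc B)  ≤⟨ big ⟩
    q  ≡⟨ trans (sym e≡) (ℕₚ.+-assoc e (2 * B) 1) ⟩
    e + (2 * B + 1) ∎)
  3k≤c : 3 * k ≤ c
  3k≤c = ℕₚ.+-cancelʳ-≤ k _ _ (begin
    3 * k + k  ≡⟨ solve 1 (λ k → con 3 :* k :+ k := con 4 :* k) refl k ⟩
    4 * k  ≤⟨ ℕₚ.*-monoʳ-≤ 4 (ℕₚ.m≤m*n k k) ⟩
    4 * (k * k)  ≤⟨ big ⟩
    q  ≡⟨ c≡ ⟨
    c + k ∎)
  q²≤ : q * q ≤ 2 * (c * c)
  q²≤ = begin
    q * q  ≡⟨ cong (λ q → q * q) c≡ ⟨
    (c + k) * (c + k)  ≡⟨ solve 2 (λ c k → (c :+ k) :* (c :+ k) := c :* c :+ (con 2 :* (k :* c) :+ k :* k)) refl c k ⟩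
    c * c + (2 * (k * c) + k * k)  ≤⟨ ℕₚ.+-monoʳ-≤ (c * c) (ℕₚ.+-monoʳ-≤ (2 * (k * c)) (ℕₚ.*-monoʳ-≤ k (ℕₚ.≤-trans (ℕₚ.m≤m+n k (k + (k + 0))) 3k≤c))) ⟩
    c * c + (2 * (k * c) + k * c)  ≡⟨ cong (c * c +_) (solve 2 (λ c k → con 2 :* (k :* c) :+ k :* c := con 3 :* k :* c) refl c k) ⟩
    c * c + 3 * k * c  ≤⟨ ℕₚ.+-monoʳ-≤ (c * c) (ℕₚ.*-monoˡ-≤ c 3k≤c) ⟩
    c * c + c * c  ≡⟨ cong (c * c +_) (sym (ℕₚ.+-identityʳ (c * c))) ⟩
    2 * (c * c) ∎

-- Subspaces with a nonzero dominant value can be enlarged up to hyperplanes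

module Growth (𝔽 : Field) (B p : ℕ) (4[B+1]²≤q : 4 * (suc B * suc B) ≤ Field.q 𝔽) (p²≤q : p * p ≤ Field.q 𝔽) where
  open Field 𝔽 using (K; 𝟘; 𝟙; _⊕_; _⊗_; ⊖_; ι; enum; elems; q; _≟_; ∈-elems; 𝟘≢𝟙; invertible; *-comm; *-assoc; *-identityˡ; *-identityʳ; zeroˡ; zeroʳ; +-identityˡ; -‿inverseʳ; +-comm; distribʳ)
  open Dominance 𝔽 B p 4[B+1]²≤q p²≤q public
  open ℕₚ.≤-Reasoning
  open +-*-Solver
  module FS = Solver 𝔽

  2k≤4kk : 2 * suc B ≤ q
  2k≤4kk = ℕₚ.≤-trans (ℕₚ.*-mono-≤ {2} {4} (s≤s (s≤s z≤n)) (ℕₚ.m≤m*n (suc B) (suc B))) 4[B+1]²≤q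

  -- A heavy line has at least q - B = c + 1 support points, hence c besides any given one. A
  -- subspace with a nonzero dominant value has at least the fraction e/(q - 1) of its vectors in
  -- the support.
  c e : ℕ
  c = q ∸ suc B
  e = q ∸ (2 * B + 1)

  c+B+1≡q : c + suc B ≡ q
  c+B+1≡q = ℕₚ.m∸n+n≡m (ℕₚ.≤-trans (ℕₚ.m≤m+n (suc B) _) 2k≤4kk)

  e+2B+1≡q : e + 2 * B + 1 ≡ q
  e+2B+1≡q = trans (ℕₚ.+-assoc e (2 * B) 1) (ℕₚ.m∸n+n≡m (ℕₚ.≤-trans (ℕₚ.≤-trans (ℕₚ.m≤m+n (2 * B + 1) 1)
    (ℕₚ.≤-reflexive (solve 1 (λ B → con 2 :* B :+ con 1 :+ con 1 := con 2 :* (con 1 :+ B)) refl B))) 2k≤4kk))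

  record Sparse {N : ℕ} (f : Vec K N → K) : Set where
    field
      planeMoments : PlaneMoments f
      valued       : Valued f
      homogeneous  : ∀ {c} → c ≢ 𝟘 → ∀ v → f (c ·ᵛ v) ≡ f v
      sparse       : q * ∑ᵛ N (nz ∘ f) ≤ B * q ^ N

  InSpan : ∀ {N d} → Vec (Vec K N) d → Vec K N → Set
  InSpan bs w = ∃ λ z → lin bs z ≡ w

  inSpan? : ∀ {N d} (bs : Vec (Vec K N) d) w → Dec (InSpan bs w)
  inSpan? {N} {d} bs w = Enum.search (Vec-enum enum d) λ z → Enum._≟_ (Vec-enum enum N) (lin bs z) w

  -- Only an upper bound, because the vectors may be dependent.
  count-span : ∀ {N d} (bs : Vec (Vec K N) d) → ∑ᵛ N (λ w → [ does (inSpan? bs w) ]) ≤ q ^ d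
  count-span {N} {d} bs = begin
    ∑ᵛ N (λ w → [ does (inSpan? bs w) ])  ≤⟨ ∑-mono (vecs elems N) pointwise ⟩
    ∑ᵛ N (λ w → ∑ᵛ d (λ z → hit z w))  ≡⟨ ∑-swap (vecs elems N) (vecs elems d) _ ⟩
    ∑ᵛ d (λ z → ∑ᵛ N (hit z))  ≡⟨ ∑-cong (vecs elems d) (λ z → trans
                        (∑-single (Enum.complete (Vec-enum enum N) (lin bs z)) (Enum.unique (Vec-enum enum N))
                        λ w _ ne → [no] (Enum._≟_ (Vec-enum enum N) (lin bs z) w) (ne ∘ sym))
                        ([yes] (Enum._≟_ (Vec-enum enum N) (lin bs z) (lin bs z)) refl)) ⟩
    ∑ᵛ d (λ _ → 1)  ≡⟨ trans (∑ᵛ-const d 1) (ℕₚ.*-identityʳ _) ⟩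
    q ^ d ∎
    where
    hit : Vec K d → Vec K N → ℕ
    hit z w = [ does (Enum._≟_ (Vec-enum enum N) (lin bs z) w) ]
    pointwise : ∀ w → [ does (inSpan? bs w) ] ≤ ∑ᵛ d (λ z → hit z w)
    pointwise w = helper (inSpan? bs w)
      where
      helper : (P? : Dec (InSpan bs w)) → [ does P? ] ≤ ∑ᵛ d (λ z → hit z w)
      helper (no _) = z≤n
      helper (yes (z , eq)) = ℕₚ.≤-trans (ℕₚ.≤-reflexive (sym ([yes] (Enum._≟_ (Vec-enum enum N) (lin bs z) w) eq)))
                                (term≤∑ {f = λ z → hit z w} (Enum.complete (Vec-enum enum d) z))

  ∑ᵛ-suc : ∀ d φ → ∑ᵛ (suc d) φ ≡ ∑ elems (λ x → ∑ᵛ d (λ z → φ (x ∷ z)))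
  ∑ᵛ-suc d φ = ∑-product _∷_ elems (vecs elems d) φ

  module _ {N : ℕ} (f : Vec K N → K) (F : Sparse f) where
    open Sparse F

    dichotomous : Dichotomous f
    dichotomous = dichotomy f planeMoments sparse

    dichotomous-lin : ∀ {d} (bs : Vec (Vec K N) d) → Dichotomous (f ∘ lin bs)
    dichotomous-lin bs v w a = subst (λ t → t ≤ B ⊎ q ≤ t + B) (sym (off-lin f bs v w a)) (dichotomous (lin bs v) (lin bs w) a)

    S : ℕ
    S = ∑ᵛ N (nz ∘ f)

    points : Vec K N → Vec K N → ℕ
    points v w = off f v w 𝟘

    heavy : Vec K N → Vec K N → ℕ
    heavy v w = [ does (B ℕₚ.<? points v w) ]

    heavy-cong : ∀ {v w v′ w′} → points v w ≡ points v′ w′ → heavy v w ≡ heavy v′ w′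
    heavy-cong eq = cong (λ t → [ does (B ℕₚ.<? t) ]) eq

    points-direction : ∀ v w {b} → b ≢ 𝟘 → points v (b ·ᵛ w) ≡ points v w
    points-direction v w {b} b≢0 = let (i , bi≡1) = invertible b b≢0 in trans
      (∑-cong elems λ x → cong (λ u → nz (f (v +ᵛ u))) (sym (·ᵛ-assoc x b w)))
      (∑-bijection enum (_⊗ b) (_⊗ i)
        (λ x → trans (*-assoc x i b) (trans (cong (x ⊗_) (trans (*-comm i b) bi≡1)) (*-identityʳ x)))
        (λ x → trans (*-assoc x b i) (trans (cong (x ⊗_) bi≡1) (*-identityʳ x)))
        (λ x → nz (f (v +ᵛ x ·ᵛ w))))

    points-scale : ∀ v w {b} → b ≢ 𝟘 → points (b ·ᵛ v) w ≡ points v w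
    points-scale v w {b} b≢0 = trans (sym (points-direction (b ·ᵛ v) w b≢0))
      (∑-cong elems λ x → cong nz (trans (cong (λ u → f (b ·ᵛ v +ᵛ u)) (trans (sym (·ᵛ-assoc x b w)) (trans (cong (_·ᵛ w) (*-comm x b)) (·ᵛ-assoc b x w))))
        (trans (cong f (sym (·ᵛ-distribˡ b v (x ·ᵛ w)))) (homogeneous b≢0 (v +ᵛ x ·ᵛ w)))))

    reflect : ∀ {k} (v w : Vec K k) x → v +ᵛ w +ᵛ (𝟙 ⊕ ⊖ x) ·ᵛ (-ᵛ w) ≡ v +ᵛ x ·ᵛ w
    reflect []      []      x = refl
    reflect (a ∷ v) (b ∷ w) x = cong₂ _∷_ (trans
      (FS.solve 4 (λ a b x o → a FS.:+ b FS.:+ (o FS.:+ FS.:- x) FS.:* FS.:- b FS.:= a FS.:+ x FS.:* b FS.:+ (b FS.:+ FS.:- (o FS.:* b))) refl a b x 𝟙)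
      (trans (cong (λ t → a ⊕ x ⊗ b ⊕ (b ⊕ ⊖ t)) (*-identityˡ b)) (FS.solve 2 (λ a b → a FS.:+ (b FS.:+ FS.:- b) FS.:= a) refl _ b)))
      (reflect v w x)

    points-reflect : ∀ v w → points v w ≡ points (v +ᵛ w) (-ᵛ w)
    points-reflect v w = trans (∑-cong elems λ x → cong (nz ∘ f) (sym (reflect v w x)))
      (∑-bijection enum (λ x → 𝟙 ⊕ ⊖ x) (λ x → 𝟙 ⊕ ⊖ x) involutive involutive (λ x → nz (f (v +ᵛ w +ᵛ x ·ᵛ (-ᵛ w)))))
      where
      involutive : ∀ x → 𝟙 ⊕ ⊖ (𝟙 ⊕ ⊖ x) ≡ x
      involutive x = FS.solve 2 (λ o x → o FS.:+ FS.:- (o FS.:+ FS.:- x) FS.:= x) refl 𝟙 x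

    -- By the dichotomy, more than B support points means at least c + 1, so that c are left when
    -- the one at parameter 0 is set aside. With the indicator as a factor, the inequality covers
    -- the other lines too and can be summed.
    heavy-count : ∀ v w → c * heavy v w + nz (f (v +ᵛ 𝟘 ·ᵛ w)) ≤ points v w
    heavy-count v w = helper (B ℕₚ.<? points v w)
      where
      helper : (P? : Dec (B < points v w)) → c * [ does P? ] + nz (f (v +ᵛ 𝟘 ·ᵛ w)) ≤ points v w
      helper (no _) = ℕₚ.≤-trans (ℕₚ.≤-reflexive (cong (_+ nz (f (v +ᵛ 𝟘 ·ᵛ w))) (ℕₚ.*-zeroʳ c))) (term≤∑ {f = λ x → nz (f (v +ᵛ x ·ᵛ w))} (∈-elems 𝟘))
      helper (yes B<) with dichotomous v w 𝟘
      ... | inj₁ ≤B = ⊥-elim (ℕₚ.<⇒≱ B< ≤B)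
      ... | inj₂ ge = ℕₚ.≤-trans (ℕₚ.+-mono-≤ (ℕₚ.≤-reflexive (ℕₚ.*-identityʳ c)) (nz≤1 _))
              (ℕₚ.+-cancelʳ-≤ B _ _ (ℕₚ.≤-trans (ℕₚ.≤-reflexive (trans (ℕₚ.+-assoc c 1 B) c+B+1≡q)) ge))

    -- Suppose that all subspaces ⟨U, w⟩ with w ∉ U = im L have dominant value 0. By heavy-line, each of the many Q ∈ U in the
    -- support lies on heavy lines in a fraction 1/q of all directions w ∉ U. On the other hand, in the sparse space ⟨U, w⟩
    -- a support point X ∉ U is joined to few Q ∈ U by heavy lines, as these have disjoint supports outside X. Counting the
    -- pairs (X, Q) in the cosets w + U and in U contradicts sparsity of f.
    module Obstruction {d : ℕ} (bs : Vec (Vec K N) d) (a : K) (a≢0 : a ≢ 𝟘) (dom : Dominated (f ∘ lin bs) a) (d+2≤N : 2 + d ≤ N)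
      (light : ∀ w → ¬ InSpan bs w → Dominated (f ∘ lin (w ∷ bs)) 𝟘) where

      L : Vec K d → Vec K N
      L = lin bs
      D A : ℕ
      D = q ^ d
      A = ∑ᵛ d (λ z → nz (f (L z)))
      σ : Vec K N → ℕ
      σ w = ∑ᵛ d (λ z → nz (f (w +ᵛ L z)))
      out : Vec K N → ℕ
      out w = [ does (¬? (inSpan? bs w)) ]

      A-large : e * D ≤ r * A
      A-large = ℕₚ.+-cancelʳ-≤ (2 * B * D) _ _ (begin
        e * D + 2 * B * D  ≡⟨ ℕₚ.*-distribʳ-+ D e (2 * B) ⟨
        (e + 2 * B) * D  ≡⟨ cong (_* D) (ℕₚ.suc-injective (trans (trans (ℕₚ.+-comm 1 (e + 2 * B)) e+2B+1≡q) q≡1+r)) ⟩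
        r * D  ≡⟨ cong (r *_) (trans (sym (ℕₚ.*-identityʳ D)) (sym (∑ᵛ-const d 1))) ⟩
        r * ∑ᵛ d (λ _ → 1)  ≤⟨ ℕₚ.*-monoʳ-≤ r (∑-mono (vecs elems d) pointwise) ⟩
        r * ∑ᵛ d (λ z → nz (f (L z)) + ne (f (L z)) a) ≡⟨ cong (r *_) (∑-⊕ (vecs elems d) _ _) ⟩
        r * (A + ∑ᵛ d (λ z → ne (f (L z)) a))  ≡⟨ ℕₚ.*-distribˡ-+ r A _ ⟩
        r * A + r * ∑ᵛ d (λ z → ne (f (L z)) a)  ≤⟨ ℕₚ.+-monoʳ-≤ (r * A) dom ⟩
        r * A + 2 * B * D ∎)
        where
        pointwise : ∀ z → 1 ≤ nz (f (L z)) + ne (f (L z)) a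
        pointwise z = ℕₚ.≤-trans (ℕₚ.≤-reflexive (sym (ne-≢ (a≢0 ∘ sym))))
          (ℕₚ.≤-trans (ne-triangle 𝟘 a (f (L z))) (ℕₚ.≤-reflexive (cong₂ _+_ (ne-sym 𝟘 _) (ne-sym a _))))
          where
          ne-sym : ∀ x y → ne x y ≡ ne y x
          ne-sym x y = [ ¬? (x ≟ y) ]-cong (¬? (y ≟ x)) (λ k e → k (sym e)) (λ k e → k (sym e))

      coset : ∀ w x → x ≢ 𝟘 → ∑ᵛ d (λ z → nz (f (x ·ᵛ w +ᵛ L z))) ≡ σ w
      coset w x x≢0 = trans (sym (∑ᵛ-scale x≢0 (λ z → nz (f (x ·ᵛ w +ᵛ L z))))) (∑-cong (vecs elems d) λ z → cong nz (trans
        (cong (λ u → f (x ·ᵛ w +ᵛ u)) (lin-· bs x z)) (trans (cong f (sym (·ᵛ-distribˡ x w (L z)))) (homogeneous x≢0 _))))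

      -- By homogeneity all q - 1 cosets x w + U with x ≠ 0 have σ w support points, so that A + r σ
      -- w is the support count of ⟨w, U⟩.
      coset-light : ∀ w → ¬ InSpan bs w → r * (A + r * σ w) ≤ 2 * B * (q * D)
      coset-light w w∉ = subst (λ t → r * t ≤ 2 * B * (q * D)) (begin-equality
        ∑ᵛ (suc d) (λ z → ne (f (lin (w ∷ bs) z)) 𝟘)  ≡⟨ ∑ᵛ-suc d _ ⟩
        ∑ elems (λ x → ∑ᵛ d (λ z → nz (f (x ·ᵛ w +ᵛ L z))))  ≡⟨ ∑-const-off-𝟘 _ (σ w) (coset w) ⟩
        ∑ᵛ d (λ z → nz (f (𝟘 ·ᵛ w +ᵛ L z))) + r * σ w  ≡⟨ cong (_+ r * σ w) (∑-cong (vecs elems d) λ z →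
                        cong (nz ∘ f) (trans (cong (_+ᵛ L z) (·ᵛ-zero w)) (+ᵛ-identityˡ (L z)))) ⟩
        A + r * σ w ∎) (light w w∉)

      ∑σ : ∑ᵛ N σ ≡ D * S
      ∑σ = begin-equality
        ∑ᵛ N σ  ≡⟨ ∑-swap (vecs elems N) (vecs elems d) _ ⟩
        ∑ᵛ d (λ z → ∑ᵛ N (λ w → nz (f (w +ᵛ L z))))  ≡⟨ ∑-cong (vecs elems d) (λ z → trans
                        (∑-cong (vecs elems N) λ w → cong (nz ∘ f) (+ᵛ-comm w (L z))) (∑ᵛ-translate (L z) (nz ∘ f))) ⟩
        ∑ᵛ d (λ _ → S)  ≡⟨ ∑ᵛ-const d S ⟩
        D * S ∎

      E : Vec K d → ℕ
      E z = ∑ᵛ N (λ w → out w * heavy (L z) w)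

      span-absorb : ∀ w e′ γ → InSpan bs (w +ᵛ γ ·ᵛ e′) → InSpan (e′ ∷ bs) w
      span-absorb w e′ γ (z , eq) = (⊖ γ ∷ z) , trans (cong ((⊖ γ) ·ᵛ e′ +ᵛ_) eq) (cancel w e′)
        where
        cancel : ∀ {k} (w e′ : Vec K k) → (⊖ γ) ·ᵛ e′ +ᵛ (w +ᵛ γ ·ᵛ e′) ≡ w
        cancel []      []       = refl
        cancel (x ∷ w) (y ∷ e′) = cong₂ _∷_ (FS.solve 3 (λ g x y → FS.:- g FS.:* y FS.:+ (x FS.:+ g FS.:* y) FS.:= x) refl γ x y) (cancel w e′)

      -- Suppose that some direction e′ outside U is not heavy. For w outside ⟨e′, U⟩, `heavy-line`
      -- finds a heavy direction in ⟨w, e′⟩; it is not a multiple of e′, so it can be scaled to w +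
      -- γ e′, which is outside U. Each heavy direction arises from at most q such w, and at most q
      -- D vectors w are excluded. If there is no such e′, all directions outside U are heavy.
      E-large : ∀ z → f (L z) ≢ 𝟘 → q ^ N ≤ q * E z + q * D
      E-large z fLz≢0 with Enum.search (Vec-enum enum N) (λ e′ → ¬? (inSpan? bs e′) ×-dec ¬? (B ℕₚ.<? points (L z) e′))
      ... | no none = begin
          q ^ N  ≡⟨ trans (sym (ℕₚ.*-identityʳ (q ^ N))) (sym (∑ᵛ-const N 1)) ⟩
          ∑ᵛ N (λ _ → 1)  ≤⟨ ∑-mono (vecs elems N) pointwise ⟩
          ∑ᵛ N (λ w → out w * heavy (L z) w + [ does (inSpan? bs w) ])  ≡⟨ ∑-⊕ (vecs elems N) _ _ ⟩
          E z + ∑ᵛ N (λ w → [ does (inSpan? bs w) ])  ≤⟨ ℕₚ.+-monoʳ-≤ (E z) (count-span bs) ⟩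
          E z + D  ≤⟨ ℕₚ.+-mono-≤ (ℕₚ.m≤n*m (E z) q) (ℕₚ.m≤n*m D q) ⟩
          q * E z + q * D ∎
        where
        pointwise : ∀ w → 1 ≤ out w * heavy (L z) w + [ does (inSpan? bs w) ]
        pointwise w with inSpan? bs w
        ... | yes _ = s≤s z≤n
        ... | no w∉ = ℕₚ.≤-trans (ℕₚ.≤-reflexive (sym ([yes] (B ℕₚ.<? points (L z) w) (decidable-stable (B ℕₚ.<? points (L z) w) λ k → none (w , w∉ , k)))))
                        (ℕₚ.≤-trans (ℕₚ.m≤m+n _ 0) (ℕₚ.m≤m+n _ 0))
      ... | yes (e′ , e′∉ , e′-light) = begin
          q ^ N  ≡⟨ trans (sym (ℕₚ.*-identityʳ (q ^ N))) (sym (∑ᵛ-const N 1)) ⟩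
          ∑ᵛ N (λ _ → 1)  ≤⟨ ∑-mono (vecs elems N) pointwise ⟩
          ∑ᵛ N (λ w → ∑ elems (λ γ → h (γ ·ᵛ e′ +ᵛ w)) + [ does (inSpan? (e′ ∷ bs) w) ]) ≡⟨ ∑-⊕ (vecs elems N) _ _ ⟩
          ∑ᵛ N (λ w → ∑ elems (λ γ → h (γ ·ᵛ e′ +ᵛ w))) + ∑ᵛ N (λ w → [ does (inSpan? (e′ ∷ bs) w) ])
            ≤⟨ ℕₚ.+-mono-≤ (ℕₚ.≤-reflexive (trans (∑-swap (vecs elems N) elems _) (trans (∑-cong elems λ γ → ∑ᵛ-translate (γ ·ᵛ e′) h) (∑-const elems (E z)))))
                           (count-span (e′ ∷ bs)) ⟩
          q * E z + q * D ∎
        where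
        h : Vec K N → ℕ
        h w = out w * heavy (L z) w
        pointwise : ∀ w → 1 ≤ ∑ elems (λ γ → h (γ ·ᵛ e′ +ᵛ w)) + [ does (inSpan? (e′ ∷ bs) w) ]
        pointwise w = helper (inSpan? (e′ ∷ bs) w)
          where
          helper : (P? : Dec (InSpan (e′ ∷ bs) w)) → 1 ≤ ∑ elems (λ γ → h (γ ·ᵛ e′ +ᵛ w)) + [ does P? ]
          helper (yes _) = ℕₚ.m≤n+m 1 _
          helper (no w∉) with heavy-line f planeMoments (L z) (w ∷ e′ ∷ []) fLz≢0
          ... | (α ∷ β ∷ []) , αβ≢0 , big with α ≟ 𝟘
          ... | yes refl = ⊥-elim (e′-light (subst (B <_) (trans (cong (points (L z)) (trans (cong₂ _+ᵛ_ (·ᵛ-zero w) (+ᵛ-identityʳ (β ·ᵛ e′))) (+ᵛ-identityˡ _)))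
                              (points-direction (L z) e′ (λ { refl → αβ≢0 refl }))) big))
          ... | no α≢0 = let (i , αi≡1) = invertible α α≢0
                             γ = i ⊗ β
                             factor : α ·ᵛ w +ᵛ (β ·ᵛ e′ +ᵛ 𝟘ᵛ) ≡ α ·ᵛ (γ ·ᵛ e′ +ᵛ w)
                             factor = trans (cong (α ·ᵛ w +ᵛ_) (+ᵛ-identityʳ _)) (trans (+ᵛ-comm _ _) (trans
                               (cong (_+ᵛ α ·ᵛ w) (trans (cong (_·ᵛ e′) (trans (sym (*-identityˡ β)) (trans (cong (_⊗ β) (sym αi≡1)) (*-assoc α i β)))) (·ᵛ-assoc α γ e′)))
                               (sym (·ᵛ-distribˡ α _ _))))
                             is-heavy : heavy (L z) (γ ·ᵛ e′ +ᵛ w) ≡ 1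
                             is-heavy = [yes] (B ℕₚ.<? _) (subst (B <_) (trans (cong (points (L z)) factor) (points-direction (L z) _ α≢0)) big)
                             is-out : out (γ ·ᵛ e′ +ᵛ w) ≡ 1
                             is-out = [yes] (¬? (inSpan? bs _)) λ in-span → w∉ (span-absorb w e′ γ (subst (InSpan bs) (+ᵛ-comm _ w) in-span))
            in ℕₚ.≤-trans (ℕₚ.≤-reflexive (sym (cong₂ _*_ is-out is-heavy)))
                 (ℕₚ.≤-trans (term≤∑ {f = λ γ → h (γ ·ᵛ e′ +ᵛ w)} (∈-elems γ)) (ℕₚ.m≤m+n _ 0))

      -- `Z` counts heavy lines from U into the coset w + U by starting point and direction; `Z′`
      -- requires in addition that the point at parameter 1 be in the support.
      Z Z′ : Vec K N → ℕ
      Z w = ∑ᵛ d (λ z → ∑ᵛ d (λ z′ → heavy (L z) (w +ᵛ L z′)))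
      Z′ w = ∑ᵛ d (λ z → ∑ᵛ d (λ z′ → heavy (L z) (w +ᵛ L z′) * nz (f (L z +ᵛ (w +ᵛ L z′)))))

      ∑Z : ∑ᵛ N (λ w → out w * Z w) ≡ D * ∑ᵛ d E
      ∑Z = begin-equality
        ∑ᵛ N (λ w → out w * Z w)
          ≡⟨ ∑-cong (vecs elems N) (λ w → trans (sym (∑-*ˡ (vecs elems d) (out w) _)) (∑-cong (vecs elems d) λ z → sym (∑-*ˡ (vecs elems d) (out w) _))) ⟩
        ∑ᵛ N (λ w → ∑ᵛ d (λ z → ∑ᵛ d (λ z′ → out w * heavy (L z) (w +ᵛ L z′))))
          ≡⟨ trans (∑-swap (vecs elems N) (vecs elems d) _) (∑-cong (vecs elems d) λ z → ∑-swap (vecs elems N) (vecs elems d) _) ⟩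
        ∑ᵛ d (λ z → ∑ᵛ d (λ z′ → ∑ᵛ N (λ w → out w * heavy (L z) (w +ᵛ L z′))))
          ≡⟨ ∑-cong (vecs elems d) (λ z → ∑-cong (vecs elems d) λ z′ → trans
               (∑-cong (vecs elems N) λ w → cong₂ _*_ (out-translate z′ w) (cong (heavy (L z)) (+ᵛ-comm w (L z′))))
               (∑ᵛ-translate (L z′) (λ w → out w * heavy (L z) w))) ⟩
        ∑ᵛ d (λ z → ∑ᵛ d (λ _ → E z))
          ≡⟨ trans (∑-cong (vecs elems d) λ z → ∑ᵛ-const d (E z)) (∑-*ˡ (vecs elems d) D E) ⟩
        D * ∑ᵛ d E ∎
        where
        out-translate : ∀ z′ w → out w ≡ out (L z′ +ᵛ w)
        out-translate z′ w = [ ¬? (inSpan? bs w) ]-cong (¬? (inSpan? bs (L z′ +ᵛ w)))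
          (λ k (z , eq) → k (z +ᵛ -ᵛ z′ , trans (lin-+ bs z (-ᵛ z′)) (trans (cong (_+ᵛ L (-ᵛ z′)) eq) (trans (cong (_+ᵛ L (-ᵛ z′)) (+ᵛ-comm _ w))
             (trans (+ᵛ-assoc w _ _) (trans (cong (w +ᵛ_) (trans (sym (lin-+ bs z′ (-ᵛ z′))) (trans (cong L (+ᵛ-inverseʳ z′)) L-𝟘))) (+ᵛ-identityʳ w)))))))
          (λ k (z , eq) → k (z′ +ᵛ z , trans (lin-+ bs z′ z) (cong (L z′ +ᵛ_) eq)))
          where
          L-𝟘 : L 𝟘ᵛ ≡ 𝟘ᵛ
          L-𝟘 = trans (cong L (sym (·ᵛ-zero 𝟘ᵛ))) (trans (lin-· bs 𝟘 𝟘ᵛ) (·ᵛ-zero _))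

      -- Each heavy line has at least c support points at parameters x ≠ 0. By homogeneity,
      -- rescaling the starting point by x turns the count at parameter x into the one at parameter
      -- 1, so each of the q - 1 nonzero parameters gives `Z′ w`.
      Z-bound : ∀ w → c * Z w ≤ r * Z′ w
      Z-bound w = ℕₚ.+-cancelʳ-≤ (φ 𝟘) _ _ (begin
        c * Z w + φ 𝟘
          ≡⟨ cong (_+ φ 𝟘) (trans (sym (∑-*ˡ (vecs elems d) c _)) (∑-cong (vecs elems d) λ z → sym (∑-*ˡ (vecs elems d) c _))) ⟩
        ∑ᵛ d (λ z → ∑ᵛ d (λ z′ → c * H z z′)) + ∑ᵛ d (λ z → ∑ᵛ d (λ z′ → H z z′ * pt z z′ 𝟘))
          ≡⟨ trans (∑-cong (vecs elems d) λ z → ∑-⊕ (vecs elems d) _ _) (∑-⊕ (vecs elems d) _ _) ⟨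
        ∑ᵛ d (λ z → ∑ᵛ d (λ z′ → c * H z z′ + H z z′ * pt z z′ 𝟘))
          ≤⟨ ∑-mono (vecs elems d) (λ z → ∑-mono (vecs elems d) λ z′ → pointwise z z′) ⟩
        ∑ᵛ d (λ z → ∑ᵛ d (λ z′ → ∑ elems (λ x → H z z′ * pt z z′ x)))
          ≡⟨ trans (∑-cong (vecs elems d) λ z → ∑-swap (vecs elems d) elems _) (∑-swap (vecs elems d) elems _) ⟩
        ∑ elems φ
          ≡⟨ ∑-const-off-𝟘 φ (Z′ w) rescale ⟩
        φ 𝟘 + r * Z′ w
          ≡⟨ ℕₚ.+-comm (φ 𝟘) _ ⟩
        r * Z′ w + φ 𝟘 ∎)
        where
        H : Vec K d → Vec K d → ℕ
        H z z′ = heavy (L z) (w +ᵛ L z′)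
        pt : Vec K d → Vec K d → K → ℕ
        pt z z′ x = nz (f (L z +ᵛ x ·ᵛ (w +ᵛ L z′)))
        φ : K → ℕ
        φ x = ∑ᵛ d (λ z → ∑ᵛ d (λ z′ → H z z′ * pt z z′ x))
        H≡H² : ∀ z z′ → H z z′ * H z z′ ≡ H z z′
        H≡H² z z′ with does (B ℕₚ.<? points (L z) (w +ᵛ L z′))
        ... | true = refl
        ... | false = refl
        pointwise : ∀ z z′ → c * H z z′ + H z z′ * pt z z′ 𝟘 ≤ ∑ elems (λ x → H z z′ * pt z z′ x)
        pointwise z z′ = begin
          c * H z z′ + H z z′ * pt z z′ 𝟘  ≡⟨ cong (λ t → c * t + H z z′ * pt z z′ 𝟘) (sym (H≡H² z z′)) ⟩
          c * (H z z′ * H z z′) + H z z′ * pt z z′ 𝟘  ≡⟨ solve 3 (λ c h p → c :* (h :* h) :+ h :* p := h :* (c :* h :+ p)) refl c (H z z′) (pt z z′ 𝟘) ⟩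
          H z z′ * (c * H z z′ + pt z z′ 𝟘)  ≤⟨ ℕₚ.*-monoʳ-≤ (H z z′) (heavy-count (L z) (w +ᵛ L z′)) ⟩
          H z z′ * points (L z) (w +ᵛ L z′)  ≡⟨ sym (∑-*ˡ elems (H z z′) _) ⟩
          ∑ elems (λ x → H z z′ * pt z z′ x) ∎
        rescale : ∀ x → x ≢ 𝟘 → φ x ≡ Z′ w
        rescale x x≢0 = trans (sym (∑ᵛ-scale x≢0 (λ z → ∑ᵛ d (λ z′ → H z z′ * pt z z′ x)))) (∑-cong (vecs elems d) λ z → ∑-cong (vecs elems d) λ z′ → cong₂ _*_
          (heavy-cong (trans (cong (λ u → points u (w +ᵛ L z′)) (lin-· bs x z)) (points-scale (L z) (w +ᵛ L z′) x≢0)))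
          (cong nz (trans (cong (λ u → f (u +ᵛ x ·ᵛ (w +ᵛ L z′))) (lin-· bs x z)) (trans (cong f (sym (·ᵛ-distribˡ x (L z) (w +ᵛ L z′)))) (homogeneous x≢0 _)))))

      -- Seen from X = w + L z′, each heavy line to a point of U has c support points other than X.
      -- The points X + y (L z - X) with z varying give A at y = 1; for other y ≠ 0 they run through
      -- the coset (1 - y) w + U and give σ w by homogeneity.
      through-point : ∀ w z′ → c * ∑ᵛ d (λ z → heavy (L z) (w +ᵛ L (-ᵛ z +ᵛ z′))) ≤ A + r * σ w
      through-point w z′ = ℕₚ.+-cancelˡ-≤ (Ψ 𝟘) _ _ (begin
        Ψ 𝟘 + c * ∑ᵛ d (λ z → heavy (L z) (w +ᵛ L (-ᵛ z +ᵛ z′)))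
          ≡⟨ trans (ℕₚ.+-comm (Ψ 𝟘) _) (cong (_+ Ψ 𝟘) (trans (cong (c *_) (∑-cong (vecs elems d) λ z → reverse z)) (sym (∑-*ˡ (vecs elems d) c _)))) ⟩
        ∑ᵛ d (λ z → c * heavy X (L z +ᵛ -ᵛ X)) + ∑ᵛ d (λ z → nz (f (X +ᵛ 𝟘 ·ᵛ (L z +ᵛ -ᵛ X))))
          ≡⟨ ∑-⊕ (vecs elems d) _ _ ⟨
        ∑ᵛ d (λ z → c * heavy X (L z +ᵛ -ᵛ X) + nz (f (X +ᵛ 𝟘 ·ᵛ (L z +ᵛ -ᵛ X))))
          ≤⟨ ∑-mono (vecs elems d) (λ z → heavy-count X (L z +ᵛ -ᵛ X)) ⟩
        ∑ᵛ d (λ z → points X (L z +ᵛ -ᵛ X))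
          ≡⟨ ∑-swap (vecs elems d) elems _ ⟩
        ∑ elems Ψ
          ≤⟨ ∑-mono elems pointwise ⟩
        ∑ elems (λ y → pick enum 𝟘 Ψ y + (pick enum 𝟙 (λ _ → A) y + ψ y))
          ≡⟨ trans (∑-⊕ elems _ _) (cong₂ _+_ (∑-pick enum 𝟘 Ψ) (trans (∑-⊕ elems _ _) (cong₂ _+_ (∑-pick enum 𝟙 (λ _ → A)) ∑ψ))) ⟩
        Ψ 𝟘 + (A + r * σ w) ∎)
        where
        X : Vec K N
        X = w +ᵛ L z′
        Ψ : K → ℕ
        Ψ y = ∑ᵛ d (λ z → nz (f (X +ᵛ y ·ᵛ (L z +ᵛ -ᵛ X))))
        -- The parameter y = 1 is included for simplicity; the total A + r σ w is then exactly what
        -- `coset-light` bounds.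
        ψ : K → ℕ
        ψ y = if does (y ≟ 𝟘) then 0 else σ w
        ψ-𝟘 : ψ 𝟘 ≡ 0
        ψ-𝟘 with 𝟘 ≟ 𝟘
        ... | yes _ = refl
        ... | no k = ⊥-elim (k refl)
        ψ-≢ : ∀ y → y ≢ 𝟘 → ψ y ≡ σ w
        ψ-≢ y y≢0 with y ≟ 𝟘
        ... | yes k = ⊥-elim (y≢0 k)
        ... | no _ = refl
        ∑ψ : ∑ elems ψ ≡ r * σ w
        ∑ψ = trans (∑-const-off-𝟘 ψ (σ w) ψ-≢) (cong (_+ r * σ w) ψ-𝟘)
        L-neg : ∀ z → L (-ᵛ z) ≡ -ᵛ L z
        L-neg z = trans (cong L (neg≡ z)) (trans (lin-· bs (⊖ 𝟙) z) (sym (neg≡ (L z))))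
          where
          neg≡ : ∀ {k} (v : Vec K k) → -ᵛ v ≡ (⊖ 𝟙) ·ᵛ v
          neg≡ []      = refl
          neg≡ (x ∷ v) = cong₂ _∷_ (trans (cong ⊖_ (sym (*-identityˡ x))) (FS.solve 2 (λ o x → FS.:- (o FS.:* x) FS.:= FS.:- o FS.:* x) refl 𝟙 x)) (neg≡ v)
        reverse : ∀ z → heavy (L z) (w +ᵛ L (-ᵛ z +ᵛ z′)) ≡ heavy X (L z +ᵛ -ᵛ X)
        reverse z = heavy-cong (trans (cong (points (L z)) (trans (cong (w +ᵛ_) (trans (lin-+ bs (-ᵛ z) z′) (cong (_+ᵛ L z′) (L-neg z)))) (shuffle w (L z) (L z′))))
          (trans (points-reflect (L z) (X +ᵛ -ᵛ L z)) (cong₂ points (shuffle₂ (L z) X) (shuffle₃ (L z) X))))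
          where
          shuffle : ∀ {k} (w l l′ : Vec K k) → w +ᵛ (-ᵛ l +ᵛ l′) ≡ w +ᵛ l′ +ᵛ -ᵛ l
          shuffle []      []      []        = refl
          shuffle (x ∷ w) (y ∷ l) (y′ ∷ l′) = cong₂ _∷_ (FS.solve 3 (λ x y z → x FS.:+ (FS.:- y FS.:+ z) FS.:= x FS.:+ z FS.:+ FS.:- y) refl x y y′) (shuffle w l l′)
          shuffle₂ : ∀ {k} (l X : Vec K k) → l +ᵛ (X +ᵛ -ᵛ l) ≡ X
          shuffle₂ []      []      = refl
          shuffle₂ (y ∷ l) (x ∷ X) = cong₂ _∷_ (FS.solve 2 (λ y x → y FS.:+ (x FS.:+ FS.:- y) FS.:= x) refl y x) (shuffle₂ l X)
          shuffle₃ : ∀ {k} (l X : Vec K k) → -ᵛ (X +ᵛ -ᵛ l) ≡ l +ᵛ -ᵛ X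
          shuffle₃ []      []      = refl
          shuffle₃ (y ∷ l) (x ∷ X) = cong₂ _∷_ (FS.solve 2 (λ y x → FS.:- (x FS.:+ FS.:- y) FS.:= y FS.:+ FS.:- x) refl y x) (shuffle₃ l X)
        Ψ-𝟙 : Ψ 𝟙 ≡ A
        Ψ-𝟙 = ∑-cong (vecs elems d) λ z → cong (nz ∘ f) (trans (cong (X +ᵛ_) (·ᵛ-identity _)) (undo X (L z)))
          where
          undo : ∀ {k} (X l : Vec K k) → X +ᵛ (l +ᵛ -ᵛ X) ≡ l
          undo []      []      = refl
          undo (x ∷ X) (y ∷ l) = cong₂ _∷_ (FS.solve 2 (λ x y → x FS.:+ (y FS.:+ FS.:- x) FS.:= y) refl x y) (undo X l)
        Ψ-generic : ∀ y → y ≢ 𝟘 → y ≢ 𝟙 → Ψ y ≡ σ w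
        Ψ-generic y y≢0 y≢1 = trans (∑-cong (vecs elems d) λ z → cong nz (trans (cong f (at z)) (homogeneous δ≢0 _)))
            (∑ᵛ-affine z′ γ≢0 (λ z → nz (f (w +ᵛ L z))))
          where
          δ = 𝟙 ⊕ ⊖ y
          δ≢0 : δ ≢ 𝟘
          δ≢0 k = y≢1 (sym (⊖-≡𝟘 k))
          i = proj₁ (invertible δ δ≢0)
          δi≡1 = proj₂ (invertible δ δ≢0)
          γ = i ⊗ y
          i≢0 : i ≢ 𝟘
          i≢0 k = 𝟘≢𝟙 (trans (sym (trans (cong (δ ⊗_) k) (zeroʳ δ))) δi≡1)
          γ≢0 : γ ≢ 𝟘
          γ≢0 = ⊗-≢𝟘 i≢0 y≢0
          convex : ∀ {k} (X l : Vec K k) → X +ᵛ y ·ᵛ (l +ᵛ -ᵛ X) ≡ δ ·ᵛ X +ᵛ y ·ᵛ l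
          convex []      []      = refl
          convex (x ∷ X) (a ∷ l) = cong₂ _∷_ (trans (cong (_⊕ y ⊗ (a ⊕ ⊖ x)) (sym (*-identityˡ x)))
            (FS.solve 4 (λ o x y a → o FS.:* x FS.:+ y FS.:* (a FS.:+ FS.:- x) FS.:= (o FS.:+ FS.:- y) FS.:* x FS.:+ y FS.:* a) refl 𝟙 x y a)) (convex X l)
          at : ∀ z → X +ᵛ y ·ᵛ (L z +ᵛ -ᵛ X) ≡ δ ·ᵛ (w +ᵛ L (z′ +ᵛ γ ·ᵛ z))
          at z = trans (convex X (L z)) (trans
            (cong (λ t → δ ·ᵛ X +ᵛ t ·ᵛ L z) (trans (sym (*-identityˡ y)) (trans (cong (_⊗ y) (sym δi≡1)) (*-assoc δ i y)))) (trans
            (cong (δ ·ᵛ X +ᵛ_) (·ᵛ-assoc δ γ (L z))) (trans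
            (sym (·ᵛ-distribˡ δ _ _))
            (cong (δ ·ᵛ_) (trans (+ᵛ-assoc w _ _) (cong (w +ᵛ_) (sym (lin-line bs z′ γ z))))))))
        pointwise : ∀ y → Ψ y ≤ pick enum 𝟘 Ψ y + (pick enum 𝟙 (λ _ → A) y + ψ y)
        pointwise y = by-cases (y ≟ 𝟘) (y ≟ 𝟙)
          where
          by-cases : Dec (y ≡ 𝟘) → Dec (y ≡ 𝟙) → Ψ y ≤ pick enum 𝟘 Ψ y + (pick enum 𝟙 (λ _ → A) y + ψ y)
          by-cases (yes refl) _ = ℕₚ.≤-trans (ℕₚ.≤-reflexive (sym (pick-same enum 𝟘 Ψ))) (ℕₚ.m≤m+n _ _)
          by-cases (no _) (yes refl) = ℕₚ.≤-trans (ℕₚ.≤-reflexive (trans Ψ-𝟙 (sym (pick-same enum 𝟙 (λ _ → A)))))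
            (ℕₚ.≤-trans (ℕₚ.m≤m+n _ (ψ y)) (ℕₚ.m≤n+m _ (pick enum 𝟘 Ψ y)))
          by-cases (no y≢0) (no y≢1) = ℕₚ.≤-trans (ℕₚ.≤-reflexive (trans (Ψ-generic y y≢0 y≢1) (sym (ψ-≢ y y≢0))))
            (ℕₚ.≤-trans (ℕₚ.m≤n+m _ (pick enum 𝟙 (λ _ → A) y)) (ℕₚ.m≤n+m _ (pick enum 𝟘 Ψ y)))

      -- Replacing z′ by z′ - z fixes the endpoint w + L z′, so that `through-point` applies to each
      -- of the σ w support points of the coset.
      Z′-bound : ∀ w → c * Z′ w ≤ σ w * (A + r * σ w)
      Z′-bound w = begin
        c * Z′ w
          ≡⟨ cong (c *_) (∑-cong (vecs elems d) λ z → sym (∑ᵛ-translate (-ᵛ z) _)) ⟩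
        c * ∑ᵛ d (λ z → ∑ᵛ d (λ z′ → G z z′ * nz (f (L z +ᵛ (w +ᵛ L (-ᵛ z +ᵛ z′))))))
          ≡⟨ cong (c *_) (trans (∑-cong (vecs elems d) λ z → ∑-cong (vecs elems d) λ z′ → cong (λ u → G z z′ * nz (f u)) (endpoint z z′)) (∑-swap (vecs elems d) (vecs elems d) _)) ⟩
        c * ∑ᵛ d (λ z′ → ∑ᵛ d (λ z → G z z′ * nz (f (w +ᵛ L z′))))
          ≡⟨ trans (sym (∑-*ˡ (vecs elems d) c _)) (∑-cong (vecs elems d) λ z′ → trans (cong (c *_) (∑-*ʳ (vecs elems d) _ _)) (sym (ℕₚ.*-assoc c _ _))) ⟩
        ∑ᵛ d (λ z′ → c * ∑ᵛ d (λ z → G z z′) * nz (f (w +ᵛ L z′)))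
          ≤⟨ ∑-mono (vecs elems d) (λ z′ → ℕₚ.*-monoˡ-≤ (nz (f (w +ᵛ L z′))) (through-point w z′)) ⟩
        ∑ᵛ d (λ z′ → (A + r * σ w) * nz (f (w +ᵛ L z′)))
          ≡⟨ trans (∑-*ˡ (vecs elems d) (A + r * σ w) _) (ℕₚ.*-comm _ (σ w)) ⟩
        σ w * (A + r * σ w) ∎
        where
        G : Vec K d → Vec K d → ℕ
        G z z′ = heavy (L z) (w +ᵛ L (-ᵛ z +ᵛ z′))
        endpoint : ∀ z z′ → L z +ᵛ (w +ᵛ L (-ᵛ z +ᵛ z′)) ≡ w +ᵛ L z′
        endpoint z z′ = trans (sym (+ᵛ-assoc _ _ _)) (trans
          (cong (_+ᵛ L (-ᵛ z +ᵛ z′)) (+ᵛ-comm (L z) w)) (trans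
          (+ᵛ-assoc _ _ _) (cong (w +ᵛ_) (trans
          (sym (lin-+ bs z (-ᵛ z +ᵛ z′)))
          (cong L (trans (sym (+ᵛ-assoc z (-ᵛ z) z′)) (trans (cong (_+ᵛ z′) (+ᵛ-inverseʳ z)) (+ᵛ-identityˡ z′))))))))

      -- The factor A + r σ w from the bound on `Z′` is the support count of ⟨w, U⟩, which lightness
      -- makes small.
      Z-small : ∀ w → c * c * (out w * Z w) ≤ 2 * B * (q * D) * σ w
      Z-small w = helper (inSpan? bs w)
        where
        helper : (P? : Dec (InSpan bs w)) → c * c * ([ does (¬? P?) ] * Z w) ≤ 2 * B * (q * D) * σ w
        helper (yes _) = ℕₚ.≤-trans (ℕₚ.≤-reflexive (ℕₚ.*-zeroʳ (c * c))) z≤n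
        helper (no w∉) = begin
          c * c * (1 * Z w)  ≡⟨ solve 2 (λ c Z → c :* c :* (con 1 :* Z) := c :* (c :* Z)) refl c (Z w) ⟩
          c * (c * Z w)  ≤⟨ ℕₚ.*-monoʳ-≤ c (Z-bound w) ⟩
          c * (r * Z′ w)  ≡⟨ solve 3 (λ c r Z → c :* (r :* Z) := r :* (c :* Z)) refl c r (Z′ w) ⟩
          r * (c * Z′ w)  ≤⟨ ℕₚ.*-monoʳ-≤ r (Z′-bound w) ⟩
          r * (σ w * (A + r * σ w))  ≡⟨ solve 3 (λ r s t → r :* (s :* t) := r :* t :* s) refl r (σ w) (A + r * σ w) ⟩
          r * (A + r * σ w) * σ w  ≤⟨ ℕₚ.*-monoˡ-≤ (σ w) (coset-light w w∉) ⟩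
          2 * B * (q * D) * σ w ∎

      upper : c * c * (D * ∑ᵛ d E) ≤ 2 * (B * B) * (D * D * q ^ N)
      upper = begin
        c * c * (D * ∑ᵛ d E)  ≡⟨ cong (c * c *_) ∑Z ⟨
        c * c * ∑ᵛ N (λ w → out w * Z w)  ≡⟨ ∑-*ˡ (vecs elems N) (c * c) _ ⟨
        ∑ᵛ N (λ w → c * c * (out w * Z w))  ≤⟨ ∑-mono (vecs elems N) Z-small ⟩
        ∑ᵛ N (λ w → 2 * B * (q * D) * σ w)  ≡⟨ ∑-*ˡ (vecs elems N) (2 * B * (q * D)) σ ⟩
        2 * B * (q * D) * ∑ᵛ N σ  ≡⟨ cong (2 * B * (q * D) *_) ∑σ ⟩
        2 * B * (q * D) * (D * S)  ≡⟨ solve 4 (λ B q D S → con 2 :* B :* (q :* D) :* (D :* S) := con 2 :* B :* (D :* D) :* (q :* S)) refl B q D S ⟩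
        2 * B * (D * D) * (q * S)  ≤⟨ ℕₚ.*-monoʳ-≤ (2 * B * (D * D)) sparse ⟩
        2 * B * (D * D) * (B * q ^ N)  ≡⟨ solve 3 (λ B D Q → con 2 :* B :* (D :* D) :* (B :* Q) := con 2 :* (B :* B) :* (D :* D :* Q)) refl B D (q ^ N) ⟩
        2 * (B * B) * (D * D * q ^ N) ∎

      lower : A * (r * q ^ N) ≤ q * q * ∑ᵛ d E
      lower = begin
        A * (r * q ^ N)  ≡⟨ ∑-*ʳ (vecs elems d) (r * q ^ N) _ ⟨
        ∑ᵛ d (λ z → nz (f (L z)) * (r * q ^ N))  ≤⟨ ∑-mono (vecs elems d) (λ z → pointwise z (f (L z) ≟ 𝟘)) ⟩
        ∑ᵛ d (λ z → q * q * E z)  ≡⟨ ∑-*ˡ (vecs elems d) (q * q) E ⟩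
        q * q * ∑ᵛ d E ∎
        where
        -- Codimension at least two enters here: the loss q D in `E-large`, multiplied by q, is at
        -- most q^N.
        q²D≤ : q * (q * D) ≤ q ^ N
        q²D≤ = ℕₚ.^-monoʳ-≤ q d+2≤N
        pointwise : ∀ z → (P? : Dec (f (L z) ≡ 𝟘)) → [ does (¬? P?) ] * (r * q ^ N) ≤ q * q * E z
        pointwise z (yes _) = z≤n
        pointwise z (no fLz≢0) = ℕₚ.+-cancelʳ-≤ (q ^ N) _ _ (begin
          1 * (r * q ^ N) + q ^ N  ≡⟨ solve 2 (λ r Q → con 1 :* (r :* Q) :+ Q := (con 1 :+ r) :* Q) refl r (q ^ N) ⟩
          suc r * q ^ N  ≡⟨ cong (_* q ^ N) q≡1+r ⟨
          q * q ^ N  ≤⟨ ℕₚ.*-monoʳ-≤ q (E-large z fLz≢0) ⟩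
          q * (q * E z + q * D)  ≡⟨ solve 3 (λ q E D → q :* (q :* E :+ q :* D) := q :* q :* E :+ q :* (q :* D)) refl q (E z) D ⟩
          q * q * E z + q * (q * D)  ≤⟨ ℕₚ.+-monoʳ-≤ (q * q * E z) q²D≤ ⟩
          q * q * E z + q ^ N ∎)

      impossible : ⊥
      impossible = ℕₚ.<⇒≱ (cubic-gap B q c e c+B+1≡q e+2B+1≡q 4[B+1]²≤q)
        (ℕₚ.*-cancelʳ-≤ _ _ (D * D * q ^ N) {{>-nonZero (ℕₚ.*-mono-≤ (ℕₚ.*-mono-≤ (q^≥1 d) (q^≥1 d)) (q^≥1 N))}} (begin
          c * c * e * (D * D * q ^ N)  ≡⟨ solve 4 (λ c e D Q → c :* c :* e :* (D :* D :* Q) := c :* c :* D :* Q :* (e :* D)) refl c e D (q ^ N) ⟩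
          c * c * D * q ^ N * (e * D)  ≤⟨ ℕₚ.*-monoʳ-≤ (c * c * D * q ^ N) A-large ⟩
          c * c * D * q ^ N * (r * A)  ≡⟨ solve 5 (λ c D Q r A → c :* c :* D :* Q :* (r :* A) := c :* c :* D :* (A :* (r :* Q))) refl c D (q ^ N) r A ⟩
          c * c * D * (A * (r * q ^ N))  ≤⟨ ℕₚ.*-monoʳ-≤ (c * c * D) lower ⟩
          c * c * D * (q * q * ∑ᵛ d E)  ≡⟨ solve 4 (λ c D q E → c :* c :* D :* (q :* q :* E) := q :* q :* (c :* c :* (D :* E))) refl c D q (∑ᵛ d E) ⟩
          q * q * (c * c * (D * ∑ᵛ d E))  ≤⟨ ℕₚ.*-monoʳ-≤ (q * q) upper ⟩
          q * q * (2 * (B * B) * (D * D * q ^ N))  ≡⟨ solve 4 (λ q B D Q → q :* q :* (con 2 :* (B :* B) :* (D :* D :* Q)) := con 2 :* (B :* B) :* (q :* q) :* (D :* D :* Q)) refl q B D (q ^ N) ⟩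
          2 * (B * B) * (q * q) * (D * D * q ^ N) ∎))

    -- By the obstruction, 0 does not dominate some ⟨w, U⟩. Some value dominates it nevertheless,
    -- and that value must be nonzero.
    enlarge : ∀ {d} (bs : Vec (Vec K N) d) a → a ≢ 𝟘 → Dominated (f ∘ lin bs) a → 2 + d ≤ N →
      ∃ λ w → ¬ InSpan bs w × ∃ λ a′ → a′ ≢ 𝟘 × Dominated (f ∘ lin (w ∷ bs)) a′
    enlarge {d} bs a a≢0 dom d+2≤N with Enum.search (Vec-enum enum N) (λ w → ¬? (inSpan? bs w) ×-dec
        ¬? (r * ∑ᵛ (suc d) (λ z → ne (f (lin (w ∷ bs) z)) 𝟘) ℕₚ.≤? 2 * B * q ^ suc d))
    ... | yes (w , w∉ , ¬dom) = let (z , dom′) = dominated (f ∘ lin (w ∷ bs)) (dichotomous-lin (w ∷ bs)) (λ v → valued _)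
                                in w , w∉ , f (lin (w ∷ bs) z) , (λ eq → ¬dom (subst (Dominated (f ∘ lin (w ∷ bs))) eq dom′)) , dom′
    ... | no none = ⊥-elim (Obstruction.impossible bs a a≢0 dom d+2≤N
          λ w w∉ → decidable-stable (_ ℕₚ.≤? _) λ k → none (w , w∉ , k))

-- Hyperplanes and codewords

module Hyperplanes (𝔽 : Field) where
  open Field 𝔽
  open LinearMaps 𝔽 public
  module FS = Solver 𝔽

  dot-comm : ∀ {k} (u v : Vec K k) → dot u v ≡ dot v u
  dot-comm []      []      = refl
  dot-comm (x ∷ u) (y ∷ v) = cong₂ _⊕_ (*-comm x y) (dot-comm u v)

  dot-𝟘 : ∀ {k} (u : Vec K k) → dot u 𝟘ᵛ ≡ 𝟘
  dot-𝟘 u = trans (cong (dot u) (sym (·ᵛ-zero 𝟘ᵛ))) (trans (dot-· u 𝟘ᵛ 𝟘) (zeroˡ _))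

  isNorm : ∀ {k} → Vec K k → Bool
  isNorm []       = false
  isNorm (x ∷ xs) = does (x ≟ 𝟙) ∨ (does (x ≟ 𝟘) ∧ isNorm xs)

  normalize : ∀ {k} (u : Vec K k) → u ≢ 𝟘ᵛ → ∃ λ c → c ≢ 𝟘 × T (isNorm (c ·ᵛ u))
  normalize []      u≢0 = ⊥-elim (u≢0 refl)
  normalize (x ∷ u) xu≢0 with x ≟ 𝟘
  ... | no x≢0 = let (i , xi≡1) = invertible x x≢0 in i , (λ i≡0 → 𝟘≢𝟙 (trans (sym (trans (cong (x ⊗_) i≡0) (zeroʳ x))) xi≡1)) , leading (i ·ᵛ u) (trans (*-comm i x) xi≡1)
    where
    leading : ∀ {k y} (w : Vec K k) → y ≡ 𝟙 → T (isNorm (y ∷ w))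
    leading {y = y} _ y≡1 with y ≟ 𝟙
    ... | yes _ = tt
    ... | no y≢1 = ⊥-elim (y≢1 y≡1)
  ... | yes x≡0 = let (c , c≢0 , norm) = normalize u (λ u≡0 → xu≢0 (cong₂ _∷_ x≡0 u≡0)) in c , c≢0 , skip (c ·ᵛ u) (trans (cong (c ⊗_) x≡0) (zeroʳ c)) norm
    where
    skip : ∀ {k y} (w : Vec K k) → y ≡ 𝟘 → T (isNorm w) → T (isNorm (y ∷ w))
    skip {y = y} _ y≡0 norm with y ≟ 𝟙 | y ≟ 𝟘
    ... | yes _ | _     = tt
    ... | no _  | yes _ = norm
    ... | no _  | no k  = ⊥-elim (k y≡0)

  norm-pivot : ∀ {k} (u : Vec K k) → T (isNorm u) → ∃ λ e → dot u e ≡ 𝟙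
  norm-pivot (x ∷ u) norm with x ≟ 𝟙 | x ≟ 𝟘
  ... | yes refl | _ = (𝟙 ∷ 𝟘ᵛ) , trans (cong₂ _⊕_ (*-identityˡ 𝟙) (dot-𝟘 u)) (+-identityʳ 𝟙)
  ... | no _ | yes refl = let (e , eq) = norm-pivot u norm in (𝟘 ∷ e) , trans (cong₂ _⊕_ (zeroˡ 𝟘) eq) (+-identityˡ 𝟙)

  norm-≢𝟘 : ∀ {k} (u : Vec K k) → T (isNorm u) → u ≢ 𝟘ᵛ
  norm-≢𝟘 u norm u≡0 = let (e , eq) = norm-pivot u norm in
    𝟘≢𝟙 (trans (sym (trans (cong (λ t → dot t e) u≡0) (trans (dot-comm 𝟘ᵛ e) (dot-𝟘 e)))) eq)

  -- Distinct normalized vectors are not proportional.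
  separate : ∀ {k} (u w : Vec K k) → T (isNorm u) → T (isNorm w) → u ≢ w → ∃ λ e → dot u e ≡ 𝟘 × dot w e ≢ 𝟘
  separate {k} u w u-norm w-norm u≢w with Enum.search (Vec-enum enum k) (λ e → (dot u e ≟ 𝟘) ×-dec ¬? (dot w e ≟ 𝟘))
  ... | yes found = found
  ... | no none = ⊥-elim (u≢w (proportional u w u-norm w-norm (λ v → trans (w-on v) (*-comm _ _))))
    where
    e₀ = proj₁ (norm-pivot u u-norm)
    ue₀≡1 = proj₂ (norm-pivot u u-norm)
    b = dot w e₀
    -- The vector v - (u·v) e₀ is in the kernel of u, hence in that of w.
    w-on : ∀ v → dot w v ≡ dot u v ⊗ b
    w-on v = ⊖-≡𝟘 (trans (trans (cong (dot w v ⊕_) (trans (cong ⊖_ (sym (dot-· w e₀ (dot u v)))) (sym (dot-neg w _)))) (sym (dot-+ w v _)))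
      (decidable-stable (dot w _ ≟ 𝟘) λ ne → none (_ , (trans (dot-+ u v _) (trans (cong (dot u v ⊕_) (trans (dot-neg u _) (cong ⊖_ (trans (dot-· u e₀ (dot u v)) (trans (cong (dot u v ⊗_) ue₀≡1) (*-identityʳ _)))))) (-‿inverseʳ _))) , ne)))
      where
      dot-neg : ∀ {k} (u v : Vec K k) → dot u (-ᵛ v) ≡ ⊖ dot u v
      dot-neg []      []      = sym (trans (sym (+-identityˡ _)) (-‿inverseʳ 𝟘))
      dot-neg (x ∷ u) (y ∷ v) = trans (cong (x ⊗ ⊖ y ⊕_) (dot-neg u v))
        (FS.solve 3 (λ x y a → x FS.:* FS.:- y FS.:+ FS.:- a FS.:= FS.:- (x FS.:* y FS.:+ a)) refl x y _)
    head-on : ∀ {k} x (u : Vec K k) → dot (x ∷ u) (𝟙 ∷ 𝟘ᵛ) ≡ x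
    head-on x u = trans (cong₂ _⊕_ (*-identityʳ x) (dot-𝟘 u)) (+-identityʳ x)
    tail-on : ∀ {k} x (u v : Vec K k) → dot (x ∷ u) (𝟘 ∷ v) ≡ dot u v
    tail-on x u v = trans (cong (_⊕ dot u v) (zeroʳ x)) (+-identityˡ _)
    scalar-one : ∀ {k} {b} (u w : Vec K k) → b ≡ 𝟙 → (∀ v → dot w v ≡ b ⊗ dot u v) → u ≡ w
    scalar-one []      []      _   _  = refl
    scalar-one {b = b} (x ∷ u) (y ∷ w) b≡1 on = cong₂ _∷_
      (trans (sym (*-identityˡ x)) (trans (cong (_⊗ x) (sym b≡1)) (trans (cong (b ⊗_) (sym (head-on x u))) (trans (sym (on (𝟙 ∷ 𝟘ᵛ))) (head-on y w)))))
      (scalar-one u w b≡1 λ v → trans (sym (tail-on y w v)) (trans (on (𝟘 ∷ v)) (cong (b ⊗_) (tail-on x u v))))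
    proportional : ∀ {k} {b} (u w : Vec K k) → T (isNorm u) → T (isNorm w) → (∀ v → dot w v ≡ b ⊗ dot u v) → u ≡ w
    proportional {b = b} (x ∷ u) (y ∷ w) un wn on = by-cases (x ≟ 𝟙) (x ≟ 𝟘) (y ≟ 𝟙) (y ≟ 𝟘) un wn
      where
      y≡bx : y ≡ b ⊗ x
      y≡bx = trans (sym (head-on y w)) (trans (on (𝟙 ∷ 𝟘ᵛ)) (cong (b ⊗_) (head-on x u)))
      tails : ∀ v → dot w v ≡ b ⊗ dot u v
      tails v = trans (sym (tail-on y w v)) (trans (on (𝟘 ∷ v)) (cong (b ⊗_) (tail-on x u v)))
      by-cases : (d₁ : Dec (x ≡ 𝟙)) (d₂ : Dec (x ≡ 𝟘)) (d₃ : Dec (y ≡ 𝟙)) (d₄ : Dec (y ≡ 𝟘)) →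
        T (does d₁ ∨ (does d₂ ∧ isNorm u)) → T (does d₃ ∨ (does d₄ ∧ isNorm w)) → x ∷ u ≡ y ∷ w
      by-cases (yes x≡1) _ (yes y≡1) _ _ _ = scalar-one (x ∷ u) (y ∷ w)
        (trans (sym (*-identityʳ b)) (trans (cong (b ⊗_) (sym x≡1)) (trans (sym y≡bx) y≡1))) on
      by-cases (yes x≡1) _ (no _) (yes y≡0) _ wn = ⊥-elim (norm-≢𝟘 w wn (zero-vector w λ v → trans (tails v) (trans (cong (_⊗ dot u v)
        (trans (sym (*-identityʳ b)) (trans (cong (b ⊗_) (sym x≡1)) (trans (sym y≡bx) y≡0)))) (zeroˡ _))))
        where
        zero-vector : ∀ {k} (w : Vec K k) → (∀ v → dot w v ≡ 𝟘) → w ≡ 𝟘ᵛ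
        zero-vector []      _ = refl
        zero-vector (z ∷ w) h = cong₂ _∷_ (trans (sym (head-on z w)) (h (𝟙 ∷ 𝟘ᵛ))) (zero-vector w λ v → trans (sym (tail-on z w v)) (h (𝟘 ∷ v)))
      by-cases (no _) (yes x≡0) (yes y≡1) _ _ _ = ⊥-elim (𝟘≢𝟙 (trans (sym (trans (cong (b ⊗_) x≡0) (zeroʳ b))) (trans (sym y≡bx) y≡1)))
      by-cases (no _) (yes x≡0) (no _) (yes y≡0) un wn = cong₂ _∷_ (trans x≡0 (sym y≡0)) (proportional u w un wn tails)

  on : ∀ {k} → Vec K k → Vec K k → ℕ
  on u v = [ does (dot u v ≟ 𝟘) ]

  on-cong : ∀ {k} (u : Vec K k) {v v′} → dot u v ≡ dot u v′ → on u v ≡ on u v′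
  on-cong u eq = cong (λ t → [ does (t ≟ 𝟘) ]) eq

  -- Every line parallel to e meets the hyperplane of u exactly once, and P is constant on these
  -- lines.
  section : ∀ {k} (P : Vec K k → ℕ) (u e : Vec K k) → dot u e ≢ 𝟘 → (∀ x v → P (x ·ᵛ e +ᵛ v) ≡ P v) →
    q * ∑ᵛ k (λ v → P v * on u v) ≡ ∑ᵛ k P
  section {k} P u e ue≢0 invariant = sym (begin
    ∑ᵛ k P
      ≡⟨ ∑-cong (vecs elems k) (λ v → trans (sym (ℕₚ.*-identityʳ _)) (trans (cong (P v *_) (sym (one v))) (sym (∑-*ˡ elems (P v) _)))) ⟩
    ∑ᵛ k (λ v → ∑ elems (λ x → P v * on u (x ·ᵛ e +ᵛ v)))
      ≡⟨ ∑-swap (vecs elems k) elems _ ⟩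
    ∑ elems (λ x → ∑ᵛ k (λ v → P v * on u (x ·ᵛ e +ᵛ v)))
      ≡⟨ ∑-cong elems (λ x → trans (∑-cong (vecs elems k) λ v → cong (_* on u (x ·ᵛ e +ᵛ v)) (sym (invariant x v)))
           (∑ᵛ-translate (x ·ᵛ e) (λ v → P v * on u v))) ⟩
    ∑ elems (λ _ → ∑ᵛ k (λ v → P v * on u v))
      ≡⟨ ∑-const elems _ ⟩
    q * ∑ᵛ k (λ v → P v * on u v) ∎)
    where
    open ≡-Reasoning
    b = dot u e
    i = proj₁ (invertible b ue≢0)
    bi≡1 = proj₂ (invertible b ue≢0)
    value : ∀ x v → dot u (x ·ᵛ e +ᵛ v) ≡ x ⊗ b ⊕ dot u v
    value x v = trans (dot-+ u _ v) (cong (_⊕ dot u v) (dot-· u e x))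
    one : ∀ v → ∑ elems (λ x → on u (x ·ᵛ e +ᵛ v)) ≡ 1
    one v = trans (∑-single (∈-elems x₀) elems-unique λ x _ ne → [no] (dot u (x ·ᵛ e +ᵛ v) ≟ 𝟘) λ z → ne (unique x z))
      ([yes] (dot u (x₀ ·ᵛ e +ᵛ v) ≟ 𝟘) (trans (value x₀ v) solves))
      where
      x₀ = ⊖ (i ⊗ dot u v)
      solves : x₀ ⊗ b ⊕ dot u v ≡ 𝟘
      solves = trans (FS.solve 3 (λ i d b → FS.:- (i FS.:* d) FS.:* b FS.:+ d FS.:= FS.:- (b FS.:* i FS.:* d) FS.:+ d) refl i (dot u v) b)
        (trans (cong (λ t → ⊖ (t ⊗ dot u v) ⊕ dot u v) bi≡1) (trans (cong (λ t → ⊖ t ⊕ dot u v) (*-identityˡ _)) (-‿inverseˡ _)))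
      unique : ∀ x → dot u (x ·ᵛ e +ᵛ v) ≡ 𝟘 → x ≡ x₀
      unique x z = ⊖-≡𝟘 (⊗-cancel ue≢0 (trans
        (FS.solve 4 (λ b x y d → b FS.:* (x FS.:+ FS.:- y) FS.:= (x FS.:* b FS.:+ d) FS.:+ FS.:- (y FS.:* b FS.:+ d)) refl b x x₀ (dot u v))
        (trans (cong₂ (λ s t → s ⊕ ⊖ t) (trans (sym (value x v)) z) solves) (-‿inverseʳ 𝟘))))

  count-hyperplane : ∀ {n} (u : Vec K (suc n)) → T (isNorm u) → ∑ᵛ (suc n) (on u) ≡ q ^ n
  count-hyperplane {n} u norm = ℕₚ.*-cancelˡ-≡ _ _ q (trans (cong (q *_) (∑-cong (vecs elems (suc n)) λ v → sym (ℕₚ.*-identityˡ (on u v))))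
    (trans (section (λ _ → 1) u (proj₁ (norm-pivot u norm)) (λ z → 𝟘≢𝟙 (trans (sym z) (proj₂ (norm-pivot u norm)))) (λ _ _ → refl))
      (trans (∑ᵛ-const (suc n) 1) (ℕₚ.*-identityʳ _))))

  -- The factor q avoids the exponent n - 1. A vector in the kernel of u but not of w leaves the
  -- first hyperplane invariant, so the second one cuts out one q-th of it.
  count-intersection : ∀ {n} (u w : Vec K (suc n)) → T (isNorm u) → T (isNorm w) → u ≢ w → q * ∑ᵛ (suc n) (λ v → on u v * on w v) ≡ q ^ n
  count-intersection u w un wn u≢w = let (e , ue≡0 , we≢0) = separate u w un wn u≢w in
    trans (section (on u) w e we≢0 (λ x v → on-cong u (trans (dot-+ u _ v) (trans (cong (_⊕ dot u v) (trans (dot-· u e x) (trans (cong (x ⊗_) ue≡0) (zeroʳ x)))) (+-identityˡ _)))))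
      (count-hyperplane u un)

  fromFun : ∀ k → (ℕ → K) → Vec K k
  fromFun zero    f = []
  fromFun (suc k) f = f 0 ∷ fromFun k (f ∘ suc)

  toFun : ∀ {k} → Vec K k → ℕ → K
  toFun []      _       = 𝟘
  toFun (x ∷ v) zero    = x
  toFun (x ∷ v) (suc i) = toFun v i

  dot-fun : ∀ {k} (b : Vec K k) f → dot b (fromFun k f) ≡ ∑< k (λ i → toFun b i ⊗ f i)
  dot-fun []      f = refl
  dot-fun {suc k} (x ∷ b) f = trans (cong (x ⊗ f 0 ⊕_) (dot-fun b (f ∘ suc))) (sym (∑<-suc k _))

  fromFun-𝟘 : ∀ k f → fromFun k f ≡ 𝟘ᵛ → ∀ i → i < k → f i ≡ 𝟘
  fromFun-𝟘 (suc k) f eq zero    _        = cong Vec.head eq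
  fromFun-𝟘 (suc k) f eq (suc i) (s≤s i<) = fromFun-𝟘 k (f ∘ suc) (cong Vec.tail eq) i i<

  normal-vector : ∀ {n} (bs : Vec (Vec K (suc n)) n) → ∃ λ u → T (isNorm u) × ∀ z → dot u (lin bs z) ≡ 𝟘
  normal-vector {n} bs =
    let (x , (k , k< , xk≢0) , sols) = underdetermined (suc n) (Vec.toList (Vec.map toFun bs)) (s≤s (ℕₚ.≤-reflexive (Vecₚ.length-toList (Vec.map toFun bs))))
        u₀ = fromFun (suc n) x
        (c , c≢0 , norm) = normalize u₀ (λ eq → xk≢0 (fromFun-𝟘 (suc n) x eq k k<))
    in c ·ᵛ u₀ , norm , λ z → trans (trans (dot-comm (c ·ᵛ u₀) (lin bs z)) (dot-· (lin bs z) u₀ c)) (trans (cong (c ⊗_) (trans (dot-comm (lin bs z) u₀) (orthogonal x bs sols z))) (zeroʳ c))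
    where
    orthogonal : ∀ {d} x (bs : Vec (Vec K (suc n)) d) → All (λ φ → ∑< (suc n) (λ k → φ k ⊗ x k) ≡ 𝟘) (Vec.toList (Vec.map toFun bs)) →
      ∀ z → dot (fromFun (suc n) x) (lin bs z) ≡ 𝟘
    orthogonal x []       []       []      = dot-𝟘 (fromFun (suc n) x)
    orthogonal x (b ∷ bs) (s ∷ ss) (y ∷ z) = trans (dot-+ (fromFun (suc n) x) (y ·ᵛ b) (lin bs z)) (trans (cong₂ _⊕_
      (trans (dot-· (fromFun (suc n) x) b y) (trans (cong (y ⊗_) (trans (dot-comm (fromFun (suc n) x) b) (trans (dot-fun b x) s))) (zeroʳ y))) (orthogonal x bs ss z)) (+-identityˡ 𝟘))

  -- The values of the codeword are placed in the prime field inside K, where they can be multiplied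
  -- by powers of coordinates.
  code : ∀ {k} → List (ℕ × Vec K k) → Vec K k → K
  code []             v = 𝟘
  code ((a , u) ∷ hs) v = ι a ⊗ ind (dot u v) ⊕ code hs v

  code-planeMoments : ∀ {k} (hs : List (ℕ × Vec K k)) → PlaneMoments (code hs)
  code-planeMoments []             v w v′ = moments-constant-on-lines (λ _ → 𝟘)
  code-planeMoments ((a , u) ∷ hs) v w v′ = moments-⊕ (moments-scale (ι a) (planeMoments-hyperplane u v w v′)) (code-planeMoments hs v w v′)

  combination : ∀ {k} → List (ℕ × Vec K k) → Vec K k → ℕ
  combination []             v = 0
  combination ((a , u) ∷ hs) v = a * on u v + combination hs v

  code≡ι : ∀ {k} (hs : List (ℕ × Vec K k)) v → code hs v ≡ ι (combination hs v)
  code≡ι []             v = refl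
  code≡ι ((a , u) ∷ hs) v = trans (cong₂ _⊕_ (trans (cong (ι a ⊗_) (ind≡ι (does (dot u v ≟ 𝟘)))) (sym (ι-* a _))) (code≡ι hs v)) (sym (ι-+ (a * on u v) _))
    where
    ind≡ι : ∀ b → (if b then 𝟙 else 𝟘) ≡ ι [ b ]
    ind≡ι true  = sym (+-identityʳ 𝟙)
    ind≡ι false = refl

  code-homogeneous : ∀ {k} (hs : List (ℕ × Vec K k)) {c} → c ≢ 𝟘 → ∀ v → code hs (c ·ᵛ v) ≡ code hs v
  code-homogeneous []             c≢0 v = refl
  code-homogeneous ((a , u) ∷ hs) {c} c≢0 v = cong₂ _⊕_ (cong (ι a ⊗_) (trans (cong ind (dot-· u v c)) ind-scale)) (code-homogeneous hs c≢0 v)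
    where
    ind-scale : ind (c ⊗ dot u v) ≡ ind (dot u v)
    ind-scale with dot u v ≟ 𝟘
    ... | yes z = ind-𝟘 (trans (cong (c ⊗_) z) (zeroʳ c))
    ... | no nz = ind-≢ (⊗-≢𝟘 c≢0 nz)

module Characteristic (𝔽 : Field) (p : ℕ) {{_ : NonZero p}} (ι-p : Field.ι 𝔽 p ≡ Field.𝟘 𝔽) where
  open Field 𝔽

  ι-multiple : ∀ x → ι (x * p) ≡ 𝟘
  ι-multiple x = trans (ι-* x p) (trans (cong (ι x ⊗_) ι-p) (zeroʳ (ι x)))

  ι-% : ∀ m → ι m ≡ ι (m % p)
  ι-% m = trans (cong ι (m≡m%n+[m/n]*n m p)) (trans (ι-+ (m % p) _) (trans (cong (ι (m % p) ⊕_) (ι-multiple (m / p))) (+-identityʳ _)))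

-- Removing hyperplanes one at a time

module Decomposition (𝔽 : Field) (B p : ℕ) (4[B+1]²≤q : 4 * (suc B * suc B) ≤ Field.q 𝔽) (p²≤q : p * p ≤ Field.q 𝔽)
    (B≥1 : 1 ≤ B) {{p-nonZero : NonZero p}} (ι-p : Field.ι 𝔽 p ≡ Field.𝟘 𝔽) (n : ℕ) (n≥1 : 1 ≤ n) where
  open Field 𝔽 using (K; 𝟘; 𝟙; _⊕_; _⊗_; ⊖_; ι; ι-+; ι-*; enum; elems; q; _≟_; ∈-elems; 𝟘≢𝟙; invertible; *-comm; *-assoc; *-identityˡ; *-identityʳ;
    zeroˡ; zeroʳ; +-identityˡ; +-identityʳ; -‿inverseʳ; -‿inverseˡ; +-comm; +-assoc; distribʳ)
  open Growth 𝔽 B p 4[B+1]²≤q p²≤q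
  open Hyperplanes 𝔽 using (isNorm; on; code; combination; code≡ι; code-planeMoments; code-homogeneous; normal-vector; count-hyperplane)
  open Characteristic 𝔽 p ι-p
  open ℕₚ.≤-Reasoning
  open +-*-Solver

  N : ℕ
  N = suc n

  V : Set
  V = Vec K N

  weight : List (ℕ × V) → ℕ
  weight hs = ∑ᵛ N (nz ∘ code hs)

  sparse-code : ∀ hs → weight hs ≤ B * q ^ n → Sparse (code hs)
  sparse-code hs small = record
    { planeMoments = code-planeMoments hs
    ; valued       = λ v → combination hs v % p , m%n<n _ p , trans (code≡ι hs v) (ι-% _)
    ; homogeneous  = code-homogeneous hs
    ; sparse       = ℕₚ.≤-trans (ℕₚ.*-monoʳ-≤ q small) (ℕₚ.≤-reflexive (solve 3 (λ q B Q → q :* (B :* Q) := B :* (q :* Q)) refl q B (q ^ n)))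
    }

  Independent : ∀ {d} → Vec V d → Set
  Independent bs = ∀ z → lin bs z ≡ 𝟘ᵛ → z ≡ 𝟘ᵛ

  independent-∷ : ∀ {d} (bs : Vec V d) w → Independent bs → ¬ InSpan bs w → Independent (w ∷ bs)
  independent-∷ bs w ind w∉ (x ∷ z) eq with x ≟ 𝟘
  ... | yes refl = cong (𝟘 ∷_) (ind z (trans (sym (trans (cong (_+ᵛ lin bs z) (·ᵛ-zero w)) (+ᵛ-identityˡ _))) eq))
  ... | no x≢0 = let (i , xi≡1) = invertible x x≢0 in
    ⊥-elim (w∉ (((⊖ i) ·ᵛ z) , trans (lin-· bs (⊖ i) z) (solves i xi≡1 w (lin bs z) eq)))
    where
    solves : ∀ {k} i → x ⊗ i ≡ 𝟙 → (w l : Vec K k) → x ·ᵛ w +ᵛ l ≡ 𝟘ᵛ → (⊖ i) ·ᵛ l ≡ w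
    solves i xi≡1 []      []      _  = refl
    solves i xi≡1 (y ∷ w) (a ∷ l) eq = cong₂ _∷_
      (trans (FS.solve 4 (λ i a x y → FS.:- i FS.:* a FS.:= x FS.:* i FS.:* y FS.:+ FS.:- (i FS.:* (x FS.:* y FS.:+ a))) refl i a x y)
        (trans (cong₂ (λ s t → s ⊗ y ⊕ ⊖ (i ⊗ t)) xi≡1 (cong Vec.head eq)) (trans (cong₂ (λ s t → s ⊕ ⊖ t) (*-identityˡ y) (zeroʳ i))
          (trans (cong (λ t → y ⊕ t) (trans (sym (+-identityˡ _)) (-‿inverseʳ 𝟘))) (+-identityʳ y)))))
      (solves i xi≡1 w l (cong Vec.tail eq))

  independent⇒injective : ∀ {d} (bs : Vec V d) → Independent bs → ∀ z z′ → lin bs z ≡ lin bs z′ → z ≡ z′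
  independent⇒injective bs ind z z′ eq = trans (recover z z′) (trans (cong (z′ +ᵛ_) (ind (z +ᵛ (⊖ 𝟙) ·ᵛ z′)
      (trans (lin-line bs z (⊖ 𝟙) z′) (trans (cong (_+ᵛ (⊖ 𝟙) ·ᵛ lin bs z′) eq) (self (lin bs z′)))))) (+ᵛ-identityʳ z′))
    where
    neg-one : ∀ x → (⊖ 𝟙) ⊗ x ≡ ⊖ x
    neg-one x = trans (FS.solve 2 (λ o x → FS.:- o FS.:* x FS.:= FS.:- (o FS.:* x)) refl 𝟙 x) (cong ⊖_ (*-identityˡ x))
    self : ∀ {k} (v : Vec K k) → v +ᵛ (⊖ 𝟙) ·ᵛ v ≡ 𝟘ᵛ
    self []      = refl
    self (x ∷ v) = cong₂ _∷_ (trans (cong (x ⊕_) (neg-one x)) (-‿inverseʳ x)) (self v)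
    recover : ∀ {k} (z z′ : Vec K k) → z ≡ z′ +ᵛ (z +ᵛ (⊖ 𝟙) ·ᵛ z′)
    recover []      []        = refl
    recover (x ∷ z) (x′ ∷ z′) = cong₂ _∷_ (sym (trans (cong (λ t → x′ ⊕ (x ⊕ t)) (neg-one x′))
      (FS.solve 2 (λ x y → y FS.:+ (x FS.:+ FS.:- y) FS.:= x) refl x x′))) (recover z z′)

  record Dominating (f : V → K) (d : ℕ) : Set where
    field
      basis       : Vec V d
      independent : Independent basis
      value       : K
      value≢𝟘     : value ≢ 𝟘
      dominates   : Dominated (f ∘ lin basis) value

  -- By homogeneity f equals f Q on all nonzero multiples of Q, so at most the zero vector deviates.
  seed : ∀ hs Q → Q ≢ 𝟘ᵛ → code hs Q ≢ 𝟘 → Dominating (code hs) 1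
  seed hs Q Q≢0 fQ≢0 = record
    { basis = Q ∷ [] ; independent = independent-∷ [] Q (λ { [] _ → refl }) (λ { ([] , eq) → Q≢0 (sym eq) })
    ; value = code hs Q ; value≢𝟘 = fQ≢0 ; dominates = begin
      r * ∑ᵛ 1 (λ z → ne (f (lin (Q ∷ []) z)) (f Q))  ≡⟨ cong (r *_) (∑ᵛ-suc 0 _) ⟩
      r * ∑ elems (λ x → ne (f (x ·ᵛ Q +ᵛ 𝟘ᵛ)) (f Q) + 0) ≤⟨ ℕₚ.*-monoʳ-≤ r at-most-one ⟩
      r * 1  ≡⟨ ℕₚ.*-identityʳ r ⟩
      r  ≤⟨ ℕₚ.≤-trans (ℕₚ.n≤1+n r) (ℕₚ.≤-reflexive (sym q≡1+r)) ⟩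
      q  ≡⟨ ℕₚ.*-identityʳ q ⟨
      q ^ 1  ≤⟨ ℕₚ.m≤n*m (q ^ 1) (2 * B) {{>-nonZero (ℕₚ.*-mono-≤ {1} {2} (s≤s z≤n) B≥1)}} ⟩
      2 * B * q ^ 1 ∎ }
    where
    f = code hs
    value-at : K → ℕ
    value-at x = ne (f (x ·ᵛ Q +ᵛ 𝟘ᵛ)) (f Q) + 0
    at-most-one : ∑ elems value-at ≤ 1
    at-most-one = begin
      ∑ elems value-at  ≡⟨ ∑-const-off-𝟘 value-at 0 (λ x x≢0 → trans (ℕₚ.+-identityʳ _) (trans
                                 (cong (λ t → ne t (f Q)) (trans (cong f (+ᵛ-identityʳ _)) (code-homogeneous hs x≢0 Q))) (ne-refl (f Q)))) ⟩
      value-at 𝟘 + r * 0  ≡⟨ trans (cong (value-at 𝟘 +_) (ℕₚ.*-zeroʳ r)) (trans (ℕₚ.+-identityʳ _) (ℕₚ.+-identityʳ _)) ⟩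
      ne (f (𝟘 ·ᵛ Q +ᵛ 𝟘ᵛ)) (f Q) ≤⟨ []≤1 _ ⟩
      1 ∎

  grow : ∀ {f} → Sparse f → ∀ j {d} → d + j ≡ n → Dominating f d → Dominating f n
  grow F zero    {d} eq D = subst (Dominating _) (trans (sym (ℕₚ.+-identityʳ d)) eq) D
  grow {f} F (suc j) {d} eq D =
    let open Dominating D
        (w , w∉ , a′ , a′≢0 , dom′) = enlarge f F basis value value≢𝟘 dominates
          (s≤s (ℕₚ.≤-trans (ℕₚ.m≤m+n (suc d) j) (ℕₚ.≤-reflexive (trans (sym (ℕₚ.+-suc d j)) eq))))
    in grow F j (trans (sym (ℕₚ.+-suc d j)) eq)
         (record { basis = w ∷ basis ; independent = independent-∷ basis w independent w∉ ; value = a′ ; value≢𝟘 = a′≢0 ; dominates = dom′ })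

  8B≤r : 8 * B ≤ r
  8B≤r = ℕₚ.≤-pred (begin
    suc (8 * B)  ≤⟨ ℕₚ.m≤m+n _ (4 * (B * B) + 3) ⟩
    suc (8 * B) + (4 * (B * B) + 3)  ≡⟨ solve 1 (λ B → con 1 :+ con 8 :* B :+ (con 4 :* (B :* B) :+ con 3) := con 4 :* ((con 1 :+ B) :* (con 1 :+ B))) refl B ⟩
    4 * (suc B * suc B)  ≤⟨ 4[B+1]²≤q ⟩
    q  ≡⟨ q≡1+r ⟩
    suc r ∎)

  r≥1 : 1 ≤ r
  r≥1 = ℕₚ.≤-trans (ℕₚ.*-mono-≤ {1} {8} (s≤s z≤n) B≥1) 8B≤r

  -- Subtracting the dominant value on the hyperplane makes f vanish at no fewer than 3/4 of its q^n
  -- vectors and may create support at the others, so the weight drops by at least q^n / 2. The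
  -- residue -m is represented by p - m.
  remove-hyperplane : ∀ hs → Sparse (code hs) → Dominating (code hs) n →
    ∃ λ u → ∃ λ b → ∃ λ b′ → T (isNorm u) × ι b′ ⊕ ι b ≡ 𝟘 × 2 * weight ((b , u) ∷ hs) + q ^ n ≤ 2 * weight hs
  remove-hyperplane hs F H = u , p ∸ m , m , u-norm , cancels , decrease
    where
    f = code hs
    open Dominating H renaming (basis to bs; value to a; value≢𝟘 to a≢0)
    u = proj₁ (normal-vector bs)
    u-norm = proj₁ (proj₂ (normal-vector bs))
    u-⊥ = proj₂ (proj₂ (normal-vector bs))
    D = q ^ n
    agree differ : ℕ
    agree = ∑ᵛ n (λ z → [ does (f (lin bs z) ≟ a) ])
    differ = ∑ᵛ n (λ z → ne (f (lin bs z)) a)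
    agree+differ : differ + agree ≡ D
    agree+differ = trans (sym (∑-⊕ (vecs elems n) _ _)) (trans (∑-cong (vecs elems n) λ z → [¬]+[] (f (lin bs z) ≟ a))
      (trans (∑ᵛ-const n 1) (ℕₚ.*-identityʳ D)))
    4differ≤D : 4 * differ ≤ D
    4differ≤D = ℕₚ.*-cancelˡ-≤ r {{>-nonZero r≥1}} (begin
      r * (4 * differ)  ≡⟨ solve 2 (λ r d → r :* (con 4 :* d) := con 4 :* (r :* d)) refl r differ ⟩
      4 * (r * differ)  ≤⟨ ℕₚ.*-monoʳ-≤ 4 dominates ⟩
      4 * (2 * B * D)  ≡⟨ solve 2 (λ B D → con 4 :* (con 2 :* B :* D) := con 8 :* B :* D) refl B D ⟩
      8 * B * D  ≤⟨ ℕₚ.*-monoˡ-≤ D 8B≤r ⟩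
      r * D ∎)
    -- The dominant value is recognized as a residue modulo p at a vector where f attains it.
    some-z : ∃ λ z → f (lin bs z) ≡ a
    some-z with Enum.search (Vec-enum enum n) (λ z → f (lin bs z) ≟ a)
    ... | yes found = found
    ... | no none = ⊥-elim (ℕₚ.<⇒≱ lt′ ℕₚ.≤-refl)
      where
      eq : differ ≡ D
      eq = trans (sym (ℕₚ.+-identityʳ differ)) (trans (cong (differ +_) (sym (∑-zero (vecs elems n) λ z _ → [no] (f (lin bs z) ≟ a) λ e → none (z , e)))) agree+differ)
      lt′ : suc D ≤ D
      lt′ = begin
        suc D  ≤⟨ ℕₚ.m<m+n D {3 * D} (ℕₚ.*-mono-≤ {1} {3} (s≤s z≤n) (q^≥1 n)) ⟩
        D + 3 * D  ≡⟨⟩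
        4 * D  ≡⟨ cong (4 *_) eq ⟨
        4 * differ  ≤⟨ 4differ≤D ⟩
        D ∎
    m = proj₁ (Sparse.valued F (lin bs (proj₁ some-z)))
    m<p = proj₁ (proj₂ (Sparse.valued F (lin bs (proj₁ some-z))))
    a≡ιm : a ≡ ι m
    a≡ιm = trans (sym (proj₂ some-z)) (proj₂ (proj₂ (Sparse.valued F (lin bs (proj₁ some-z)))))
    cancels : ι m ⊕ ι (p ∸ m) ≡ 𝟘
    cancels = trans (sym (ι-+ m (p ∸ m))) (trans (cong ι (ℕₚ.m+[n∸m]≡n (ℕₚ.<⇒≤ m<p))) ι-p)
    is-a hit : V → ℕ
    is-a v = [ does (f v ≟ a) ]
    hit v = is-a v * on u v
    agree≤ : agree ≤ ∑ᵛ N hit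
    agree≤ = begin
      agree  ≡⟨ ∑-cong (vecs elems n) (λ z → ∑-pick (Vec-enum enum N) (lin bs z) is-a) ⟨
      ∑ᵛ n (λ z → ∑ᵛ N (λ v → at z v))  ≡⟨ ∑-swap (vecs elems n) (vecs elems N) _ ⟩
      ∑ᵛ N (λ v → ∑ᵛ n (λ z → at z v))  ≤⟨ ∑-mono (vecs elems N) pointwise ⟩
      ∑ᵛ N hit ∎
      where
      at : Vec K n → V → ℕ
      at z v = pick (Vec-enum enum N) (lin bs z) is-a v
      pointwise : ∀ v → ∑ᵛ n (λ z → at z v) ≤ hit v
      pointwise v with inSpan? bs v
      ... | no v∉ = ℕₚ.≤-trans (ℕₚ.≤-reflexive (∑-zero (vecs elems n) λ z _ → pick-other (Vec-enum enum N) (lin bs z) is-a v λ e → v∉ (z , sym e))) z≤n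
      ... | yes (z , refl) = ℕₚ.≤-reflexive (trans (∑-single (Enum.complete (Vec-enum enum n) z) (Enum.unique (Vec-enum enum n))
              λ z′ _ z′≢z → pick-other (Vec-enum enum N) (lin bs z′) is-a (lin bs z) λ e → z′≢z (independent⇒injective bs independent z′ z (sym e)))
            (trans (pick-same (Vec-enum enum N) (lin bs z) is-a) (trans (sym (ℕₚ.*-identityʳ _)) (cong ([ does (f (lin bs z) ≟ a) ] *_) (sym ([yes] (dot u (lin bs z) ≟ 𝟘) (u-⊥ z)))))))
    W W′ : ℕ
    W = weight hs
    W′ = weight ((p ∸ m , u) ∷ hs)
    -- On the hyperplane, a vector with value a leaves the support, and any other vector adds at
    -- most 1 to the new weight.
    exchange : ∀ v → nz (code ((p ∸ m , u) ∷ hs) v) + 2 * hit v ≤ nz (f v) + on u v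
    exchange v with dot u v ≟ 𝟘
    ... | no _ = ℕₚ.≤-reflexive (cong₂ _+_ (cong nz (trans (cong (_⊕ f v) (zeroʳ _)) (+-identityˡ _))) (cong (2 *_) (ℕₚ.*-zeroʳ [ does (f v ≟ a) ])))
    ... | yes _ = by-cases (f v ≟ a)
      where
      by-cases : (P? : Dec (f v ≡ a)) → nz (ι (p ∸ m) ⊗ 𝟙 ⊕ f v) + 2 * ([ does P? ] * 1) ≤ nz (f v) + 1
      by-cases (no _) = ℕₚ.≤-trans (ℕₚ.≤-reflexive (ℕₚ.+-identityʳ _)) (ℕₚ.≤-trans (nz≤1 _) (ℕₚ.m≤n+m 1 (nz (f v))))
      by-cases (yes fv≡a) = ℕₚ.≤-reflexive (trans (cong (_+ 2) vanishes) (cong (_+ 1) (sym (ne-≢ (λ fv≡0 → a≢0 (trans (sym fv≡a) fv≡0))))))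
        where
        vanishes : nz (ι (p ∸ m) ⊗ 𝟙 ⊕ f v) ≡ 0
        vanishes = trans (cong nz (trans (cong₂ _⊕_ (*-identityʳ _) (trans fv≡a a≡ιm)) (trans (+-comm _ _) cancels))) (ne-refl 𝟘)
    W′+2agree≤ : W′ + 2 * agree ≤ W + D
    W′+2agree≤ = begin
      W′ + 2 * agree  ≤⟨ ℕₚ.+-monoʳ-≤ W′ (ℕₚ.*-monoʳ-≤ 2 agree≤) ⟩
      W′ + 2 * ∑ᵛ N hit  ≡⟨ cong (W′ +_) (∑-*ˡ (vecs elems N) 2 hit) ⟨
      W′ + ∑ᵛ N (λ v → 2 * hit v)  ≡⟨ ∑-⊕ (vecs elems N) _ _ ⟨
      ∑ᵛ N (λ v → nz (code ((p ∸ m , u) ∷ hs) v) + 2 * hit v)  ≤⟨ ∑-mono (vecs elems N) exchange ⟩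
      ∑ᵛ N (λ v → nz (f v) + on u v)  ≡⟨ ∑-⊕ (vecs elems N) _ _ ⟩
      W + ∑ᵛ N (on u)  ≡⟨ cong (W +_) (count-hyperplane u u-norm) ⟩
      W + D ∎
    decrease : 2 * W′ + D ≤ 2 * W
    decrease = ℕₚ.+-cancelʳ-≤ (2 * D) _ _ (begin
      2 * W′ + D + 2 * D  ≡⟨ solve 2 (λ W D → con 2 :* W :+ D :+ con 2 :* D := con 2 :* W :+ con 3 :* D) refl W′ D ⟩
      2 * W′ + 3 * D  ≤⟨ ℕₚ.+-monoʳ-≤ (2 * W′) 3D≤4agree ⟩
      2 * W′ + 4 * agree  ≡⟨ solve 2 (λ W A → con 2 :* W :+ con 4 :* A := con 2 :* (W :+ con 2 :* A)) refl W′ agree ⟩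
      2 * (W′ + 2 * agree)  ≤⟨ ℕₚ.*-monoʳ-≤ 2 W′+2agree≤ ⟩
      2 * (W + D)  ≡⟨ ℕₚ.*-distribˡ-+ 2 W D ⟩
      2 * W + 2 * D ∎)
      where
      3D≤4agree : 3 * D ≤ 4 * agree
      3D≤4agree = ℕₚ.+-cancelˡ-≤ D _ _ (begin
        D + 3 * D  ≡⟨ cong (4 *_) (sym agree+differ) ⟩
        4 * (differ + agree)  ≡⟨ ℕₚ.*-distribˡ-+ 4 differ agree ⟩
        4 * differ + 4 * agree  ≤⟨ ℕₚ.+-monoˡ-≤ (4 * agree) 4differ≤D ⟩
        D + 4 * agree ∎)

  Valid : List (ℕ × V) → Set
  Valid = All (λ (_ , u) → T (isNorm u))

  -- Each removal lowers twice the weight by q^n, so that j can drop by one; j ≤ 2B keeps every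
  -- intermediate codeword sparse. The zero vector spans no line to start from and is left out.
  decompose : ∀ j hs → j ≤ 2 * B → 2 * weight hs ≤ j * q ^ n →
    ∃ λ hs′ → length hs′ ≤ j × Valid hs′ × ∀ v → v ≢ 𝟘ᵛ → code hs v ≡ code hs′ v
  decompose j hs j≤2B small with Enum.search (Vec-enum enum N) (λ Q → ¬? (Enum._≟_ (Vec-enum enum N) Q 𝟘ᵛ) ×-dec ¬? (code hs Q ≟ 𝟘))
  ... | no none = [] , z≤n , [] , λ v v≢0 → decidable-stable (code hs v ≟ 𝟘) λ fv≢0 → none (v , v≢0 , fv≢0)
  ... | yes (Q , Q≢0 , fQ≢0) with j
  ...   | zero = ⊥-elim (ℕₚ.<⇒≱ (ℕₚ.*-mono-≤ {1} {2} (s≤s z≤n) (ℕₚ.≤-trans (ℕₚ.≤-reflexive (sym (ne-≢ fQ≢0))) (term≤∑ {f = nz ∘ code hs} (Enum.complete (Vec-enum enum N) Q)))) small)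
  ...   | suc j′ =
    let (u , b , b′ , u-norm , cancels , decrease) = remove-hyperplane hs F (grow F (n ∸ 1) (ℕₚ.m+[n∸m]≡n n≥1) (seed hs Q Q≢0 fQ≢0))
        (hs′ , len , valid , agrees) = decompose j′ ((b , u) ∷ hs) (ℕₚ.<⇒≤ j≤2B)
          (ℕₚ.+-cancelˡ-≤ (q ^ n) _ _ (ℕₚ.≤-trans (ℕₚ.≤-reflexive (ℕₚ.+-comm (q ^ n) _)) (ℕₚ.≤-trans decrease small)))
    in (b′ , u) ∷ hs′ , s≤s len , u-norm ∷ valid , λ v v≢0 → sym (trans (cong (ι b′ ⊗ ind (dot u v) ⊕_) (sym (agrees v v≢0)))
         (trans (FS.solve 4 (λ b c i f → b FS.:* i FS.:+ (c FS.:* i FS.:+ f) FS.:= (b FS.:+ c) FS.:* i FS.:+ f) refl (ι b′) (ι b) (ind (dot u v)) (code hs v))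
           (trans (cong (λ t → t ⊗ ind (dot u v) ⊕ code hs v) cancels) (trans (cong (_⊕ code hs v) (zeroˡ _)) (+-identityˡ _)))))
    where
    bound : weight hs ≤ B * q ^ n
    bound = ℕₚ.*-cancelˡ-≤ 2 (ℕₚ.≤-trans small (ℕₚ.≤-trans (ℕₚ.*-monoˡ-≤ (q ^ n) j≤2B) (ℕₚ.≤-reflexive (ℕₚ.*-assoc 2 B (q ^ n)))))
    F = sparse-code hs bound

ceilDiv-unique : ∀ w t k → 1 ≤ t → w ≤ k * t → (∀ k′ → k ≡ suc k′ → k′ * t < w) → k ≡ ceilDiv w t
ceilDiv-unique w (suc b) k _ upper lower = ℕₚ.≤-antisym (k≤ k lower)
  (ℕₚ.≤-pred (m<n*o⇒m/o<n {n = suc k} (ℕₚ.≤-trans (ℕₚ.≤-reflexive (trans (cong suc (ℕₚ.+-comm w b)) refl)) (ℕₚ.+-monoʳ-≤ (suc b) upper))))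
  where
  k≤ : ∀ k → (∀ k′ → k ≡ suc k′ → k′ * suc b < w) → k ≤ (w + b) / suc b
  k≤ zero    _     = z≤n
  k≤ (suc k′) lower = ℕₚ.≤-trans (ℕₚ.≤-reflexive (sym (m*n/n≡m (suc k′) (suc b)))) (/-monoˡ-≤ (suc b)
    (ℕₚ.≤-trans (ℕₚ.≤-reflexive (trans (cong suc (ℕₚ.+-comm b _)) refl)) (ℕₚ.+-monoˡ-≤ b (lower k′ refl))))

-- Counting points of combinations of few hyperplanes

module Counting (𝔽 : Field) where
  open Field 𝔽 using (K; 𝟘; 𝟙; _⊕_; _⊗_; ⊖_; ι; ι-+; enum; elems; q; _≟_; 𝟘≢𝟙; +-identityˡ; +-identityʳ; *-identityʳ; zeroʳ; zeroˡ; distribʳ; +-assoc; +-comm)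
  open Hyperplanes 𝔽
  open ℕₚ.≤-Reasoning
  open +-*-Solver

  module _ {k : ℕ} where
    V : Set
    V = Vec K k

    _≟ᵛ_ : (u v : V) → Dec (u ≡ v)
    _≟ᵛ_ = Enum._≟_ (Vec-enum enum k)

    Valid Distinct Nonzero Reduced : List (ℕ × V) → Set
    Valid    = All (λ (_ , u) → T (isNorm u))
    Distinct = AllPairs (λ (_ , u) (_ , w) → u ≢ w)
    Nonzero  = All (λ (a , _) → ι a ≢ 𝟘)
    Reduced hs = Valid hs × Distinct hs × Nonzero hs

    -- Coefficients of equal hyperplanes are added, and a zero sum removes the entry. The last
    -- component says that no new hyperplanes other than u appear, which keeps the list distinct in
    -- the recursion.
    insert : ∀ a (u : V) hs → T (isNorm u) → ι a ≢ 𝟘 → Reduced hs → ∃ λ hs′ → length hs′ ≤ suc (length hs) × Reduced hs′ ×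
      (∀ v → code ((a , u) ∷ hs) v ≡ code hs′ v) × (∀ {w} → w ≢ u → All (λ (_ , x) → w ≢ x) hs → All (λ (_ , x) → w ≢ x) hs′)
    insert a u [] un a≢0 _ = (a , u) ∷ [] , s≤s z≤n , (un ∷ [] , [] ∷ [] , a≢0 ∷ []) , (λ _ → refl) , λ w≢u _ → w≢u ∷ []
    insert a u ((b , x) ∷ hs) un a≢0 (xn ∷ val , x# ∷ dis , b≢0 ∷ nz) with u ≟ᵛ x
    ... | no u≢x = let (hs′ , len , (val′ , dis′ , nz′) , same , keep) = insert a u hs un a≢0 (val , dis , nz) in
          (b , x) ∷ hs′ , s≤s len , (xn ∷ val′ , keep (λ e → u≢x (sym e)) x# ∷ dis′ , b≢0 ∷ nz′) ,
          (λ v → trans (swap (ι a ⊗ ind (dot u v)) (ι b ⊗ ind (dot x v)) (code hs v)) (cong (ι b ⊗ ind (dot x v) ⊕_) (same v))) ,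
          λ { w≢u (w≢x ∷ w#) → w≢x ∷ keep w≢u w# }
      where
      swap : ∀ s t c → s ⊕ (t ⊕ c) ≡ t ⊕ (s ⊕ c)
      swap = FS.solve 3 (λ s t c → s FS.:+ (t FS.:+ c) FS.:= t FS.:+ (s FS.:+ c)) refl
    ... | yes refl with ι (a + b) ≟ 𝟘
    ...   | yes z = hs , ℕₚ.≤-trans (ℕₚ.n≤1+n _) (ℕₚ.n≤1+n _) , (val , dis , nz) ,
            (λ v → trans (merge v) (trans (cong (λ t → t ⊗ ind (dot u v) ⊕ code hs v) z) (trans (cong (_⊕ code hs v) (zeroˡ _)) (+-identityˡ _)))) ,
            λ { _ (_ ∷ w#) → w# }
      where
      merge : ∀ v → code ((a , u) ∷ (b , u) ∷ hs) v ≡ ι (a + b) ⊗ ind (dot u v) ⊕ code hs v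
      merge v = trans (sym (+-assoc _ _ _)) (cong (_⊕ code hs v) (trans (sym (distribʳ _ _ _)) (cong (_⊗ ind (dot u v)) (sym (ι-+ a b)))))
    ...   | no nonzero = (a + b , u) ∷ hs , ℕₚ.n≤1+n _ , (xn ∷ val , x# ∷ dis , nonzero ∷ nz) ,
            (λ v → trans (sym (+-assoc _ _ _)) (cong (_⊕ code hs v) (trans (sym (distribʳ _ _ _)) (cong (_⊗ ind (dot u v)) (sym (ι-+ a b)))))) ,
            λ { w≢u (_ ∷ w#) → w≢u ∷ w# }

    reduce : ∀ hs → Valid hs → ∃ λ hs′ → length hs′ ≤ length hs × Reduced hs′ × ∀ v → code hs v ≡ code hs′ v
    reduce []             _          = [] , z≤n , ([] , [] , []) , λ _ → refl
    reduce ((a , u) ∷ hs) (un ∷ val) with reduce hs val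
    ... | hs₁ , len₁ , red₁ , same₁ with ι a ≟ 𝟘
    ...   | yes z = hs₁ , ℕₚ.≤-trans len₁ (ℕₚ.n≤1+n _) , red₁ , λ v → trans (cong (_⊕ code hs v) (trans (cong (_⊗ ind (dot u v)) z) (zeroˡ _))) (trans (+-identityˡ _) (same₁ v))
    ...   | no a≢0 = let (hs₂ , len₂ , red₂ , same₂ , _) = insert a u hs₁ un a≢0 red₁ in
            hs₂ , ℕₚ.≤-trans len₂ (s≤s len₁) , red₂ , λ v → trans (cong (ι a ⊗ ind (dot u v) ⊕_) (same₁ v)) (same₂ v)

    multiplicity : List (ℕ × V) → V → ℕ
    multiplicity hs v = ∑ hs (λ (_ , u) → on u v)

    code-multiplicity-0 : ∀ hs v → multiplicity hs v ≡ 0 → code hs v ≡ 𝟘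
    code-multiplicity-0 []             v _ = refl
    code-multiplicity-0 ((a , u) ∷ hs) v eq with dot u v ≟ 𝟘
    ... | no _ = trans (cong₂ _⊕_ (zeroʳ _) (code-multiplicity-0 hs v eq)) (+-identityˡ 𝟘)

    code-multiplicity-1 : ∀ hs v → Nonzero hs → multiplicity hs v ≡ 1 → code hs v ≢ 𝟘
    code-multiplicity-1 ((a , u) ∷ hs) v (a≢0 ∷ nz) eq with dot u v ≟ 𝟘
    ... | yes _ = λ z → a≢0 (trans (sym (trans (cong₂ _⊕_ (*-identityʳ _) (code-multiplicity-0 hs v (ℕₚ.suc-injective eq))) (+-identityʳ _))) z)
    ... | no _ = λ z → code-multiplicity-1 hs v nz eq (trans (sym (trans (cong (_⊕ code hs v) (zeroʳ _)) (+-identityˡ _))) z)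

    nz≤multiplicity : ∀ hs v → nz (code hs v) ≤ multiplicity hs v
    nz≤multiplicity hs v with multiplicity hs v in eq
    ... | zero  = ℕₚ.≤-reflexive ([no] (¬? (code hs v ≟ 𝟘)) λ ne → ne (code-multiplicity-0 hs v eq))
    ... | suc _ = ℕₚ.≤-trans (nz≤1 _) (s≤s z≤n)

    -- m(2 - m) is positive only for m = 1, and there the value is a single nonzero coefficient.
    2multiplicity≤ : ∀ hs v → Nonzero hs → 2 * multiplicity hs v ≤ nz (code hs v) + multiplicity hs v * multiplicity hs v
    2multiplicity≤ hs v nonzero with multiplicity hs v in eq
    ... | zero        = z≤n
    ... | suc zero    = ℕₚ.≤-reflexive (cong (_+ 1) (sym ([yes] (¬? (code hs v ≟ 𝟘)) (code-multiplicity-1 hs v nonzero eq))))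
    ... | suc (suc m) = ℕₚ.≤-trans (ℕₚ.*-monoˡ-≤ (2 + m) {2} {2 + m} (s≤s (s≤s z≤n))) (ℕₚ.m≤n+m _ (nz (code hs v)))

  -- Vectors with nonzero first coordinate scale to first coordinate 1, in q - 1 ways each; those
  -- with first coordinate 0 are handled by induction.
  norm-count : ∀ k (φ : Vec K k → ℕ) → (∀ {c} → c ≢ 𝟘 → ∀ v → φ (c ·ᵛ v) ≡ φ v) →
    ∑ᵛ k (λ v → [ does (¬? (v ≟ᵛ 𝟘ᵛ)) ] * φ v) ≡ r * ∑ᵛ k (λ v → [ isNorm v ] * φ v)
  norm-count zero    φ h = sym (ℕₚ.*-zeroʳ r)
  norm-count (suc k) φ h = begin-equality
    ∑ᵛ (suc k) (λ v → [ does (¬? (v ≟ᵛ 𝟘ᵛ)) ] * φ v)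
      ≡⟨ ∑-product _∷_ elems (vecs elems k) _ ⟩
    ∑ elems (λ x → ∑ᵛ k (λ z → [ does (¬? ((x ∷ z) ≟ᵛ 𝟘ᵛ)) ] * φ (x ∷ z)))
      ≡⟨ ∑-const-off-𝟘 _ affine (λ x x≢0 → trans (∑-cong (vecs elems k) λ z → trans
           (cong (_* φ (x ∷ z)) ([yes] (¬? ((x ∷ z) ≟ᵛ 𝟘ᵛ)) λ e → x≢0 (cong Vec.head e))) (ℕₚ.*-identityˡ _)) (rescale x x≢0)) ⟩
    ∑ᵛ k (λ z → [ does (¬? ((𝟘 ∷ z) ≟ᵛ 𝟘ᵛ)) ] * φ (𝟘 ∷ z)) + r * affine
      ≡⟨ cong (_+ r * affine) (trans (∑-cong (vecs elems k) λ z → cong (_* φ (𝟘 ∷ z)) ([ ¬? ((𝟘 ∷ z) ≟ᵛ 𝟘ᵛ) ]-cong (¬? (z ≟ᵛ 𝟘ᵛ)) (λ ne e → ne (cong (𝟘 ∷_) e)) (λ ne e → ne (cong Vec.tail e))))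
           (norm-count k (λ z → φ (𝟘 ∷ z)) λ {c} c≢0 z → trans (cong (λ t → φ (t ∷ c ·ᵛ z)) (sym (zeroʳ c))) (h c≢0 (𝟘 ∷ z)))) ⟩
    r * infinite + r * affine
      ≡⟨ trans (ℕₚ.+-comm (r * infinite) _) (sym (ℕₚ.*-distribˡ-+ r affine infinite)) ⟩
    r * (affine + infinite)
      ≡⟨ cong (r *_) (sym normalized) ⟩
    r * ∑ᵛ (suc k) (λ v → [ isNorm v ] * φ v) ∎
    where
    affine infinite : ℕ
    affine = ∑ᵛ k (λ z → φ (𝟙 ∷ z))
    infinite = ∑ᵛ k (λ z → [ isNorm z ] * φ (𝟘 ∷ z))
    rescale : ∀ x → x ≢ 𝟘 → ∑ᵛ k (λ z → φ (x ∷ z)) ≡ affine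
    rescale x x≢0 = trans (sym (∑ᵛ-scale x≢0 (λ z → φ (x ∷ z)))) (∑-cong (vecs elems k) λ z → trans (cong (λ t → φ (t ∷ x ·ᵛ z)) (sym (*-identityʳ x))) (h x≢0 (𝟙 ∷ z)))
    normalized : ∑ᵛ (suc k) (λ v → [ isNorm v ] * φ v) ≡ affine + infinite
    normalized = begin-equality
      ∑ᵛ (suc k) (λ v → [ isNorm v ] * φ v)
        ≡⟨ ∑-product _∷_ elems (vecs elems k) _ ⟩
      ∑ elems (λ x → ∑ᵛ k (λ z → [ isNorm (x ∷ z) ] * φ (x ∷ z)))
        ≡⟨ ∑-cong elems (λ x → by-cases x (x ≟ 𝟙) (x ≟ 𝟘)) ⟩
      ∑ elems (λ x → pick enum 𝟙 (λ x → ∑ᵛ k (λ z → φ (x ∷ z))) x + pick enum 𝟘 (λ x → ∑ᵛ k (λ z → [ isNorm z ] * φ (x ∷ z))) x)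
        ≡⟨ trans (∑-⊕ elems _ _) (cong₂ _+_ (∑-pick enum 𝟙 _) (∑-pick enum 𝟘 _)) ⟩
      affine + infinite ∎
      where
      by-cases : ∀ x (d₁ : Dec (x ≡ 𝟙)) (d₂ : Dec (x ≡ 𝟘)) → ∑ᵛ k (λ z → [ does d₁ ∨ (does d₂ ∧ isNorm z) ] * φ (x ∷ z)) ≡
        (if does d₁ then ∑ᵛ k (λ z → φ (x ∷ z)) else 0) + (if does d₂ then ∑ᵛ k (λ z → [ isNorm z ] * φ (x ∷ z)) else 0)
      by-cases x (yes x≡1) (yes x≡0) = ⊥-elim (𝟘≢𝟙 (trans (sym x≡0) x≡1))
      by-cases x (yes _) (no _) = trans (∑-cong (vecs elems k) λ z → ℕₚ.*-identityˡ _) (sym (ℕₚ.+-identityʳ _))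
      by-cases x (no _) (yes _) = refl
      by-cases x (no _) (no _)  = ∑-zero (vecs elems k) λ _ _ → refl

  module _ {n : ℕ} where
    ∑-multiplicity : ∀ hs → Valid hs → ∑ᵛ (suc n) (multiplicity hs) ≡ length hs * q ^ n
    ∑-multiplicity hs val = trans (∑-swap (vecs elems (suc n)) hs _) (go hs val)
      where
      go : ∀ hs → Valid hs → ∑ hs (λ (_ , u) → ∑ᵛ (suc n) (on u)) ≡ length hs * q ^ n
      go []             _          = refl
      go ((_ , u) ∷ hs) (un ∷ val) = cong₂ _+_ (count-hyperplane u un) (go hs val)

    -- Ordered pairs of k hyperplanes: the k diagonal pairs share q^n vectors each, the k(k - 1)
    -- others q^(n-1). The identity is multiplied by q, and the negative term is moved across.
    ∑-multiplicity² : ∀ hs → Valid hs → Distinct hs →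
      q * ∑ᵛ (suc n) (λ v → multiplicity hs v * multiplicity hs v) + length hs * q ^ n ≡
      length hs * (q * q ^ n) + length hs * length hs * q ^ n
    ∑-multiplicity² []             _          _          = trans (cong (λ t → q * t + 0) (∑-ε (vecs elems (suc n)))) (trans (ℕₚ.+-identityʳ _) (ℕₚ.*-zeroʳ q))
    ∑-multiplicity² ((a , u) ∷ hs) (un ∷ val) (u# ∷ dis) = begin-equality
      q * ∑ᵛ (suc n) (λ v → (on u v + multiplicity hs v) * (on u v + multiplicity hs v)) + suc l * D
        ≡⟨ cong (λ t → q * t + suc l * D) (trans (∑-cong (vecs elems (suc n)) expand) (trans (∑-⊕ (vecs elems (suc n)) _ _) (cong (X +_) (trans (∑-⊕ (vecs elems (suc n)) _ _) (cong (_+ M) (∑-*ˡ (vecs elems (suc n)) 2 _)))))) ⟩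
      q * (X + (2 * Y + M)) + suc l * D
        ≡⟨ solve 6 (λ q X Y M l D → q :* (X :+ (con 2 :* Y :+ M)) :+ (con 1 :+ l) :* D := q :* X :+ D :+ con 2 :* (q :* Y) :+ (q :* M :+ l :* D)) refl q X Y M l D ⟩
      q * X + D + 2 * (q * Y) + (q * M + l * D)
        ≡⟨ cong₂ _+_ (cong₂ (λ s t → q * s + D + 2 * t) (count-hyperplane u un) qY≡) (∑-multiplicity² hs val dis) ⟩
      q * D + D + 2 * (l * D) + (l * (q * D) + l * l * D)
        ≡⟨ solve 3 (λ q l D → q :* D :+ D :+ con 2 :* (l :* D) :+ (l :* (q :* D) :+ l :* l :* D) := (con 1 :+ l) :* (q :* D) :+ (con 1 :+ l) :* (con 1 :+ l) :* D) refl q l D ⟩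
      suc l * (q * D) + suc l * suc l * D ∎
      where
      l = length hs
      D = q ^ n
      X = ∑ᵛ (suc n) (on u)
      Y = ∑ᵛ (suc n) (λ v → multiplicity hs v * on u v)
      M = ∑ᵛ (suc n) (λ v → multiplicity hs v * multiplicity hs v)
      expand : ∀ v → (on u v + multiplicity hs v) * (on u v + multiplicity hs v) ≡ on u v + (2 * (multiplicity hs v * on u v) + multiplicity hs v * multiplicity hs v)
      expand v = trans (solve 2 (λ o m → (o :+ m) :* (o :+ m) := o :* o :+ (con 2 :* (m :* o) :+ m :* m)) refl (on u v) (multiplicity hs v)) (cong (_+ (2 * (multiplicity hs v * on u v) + multiplicity hs v * multiplicity hs v)) (idem (does (dot u v ≟ 𝟘))))
        where
        idem : ∀ b → [ b ] * [ b ] ≡ [ b ]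
        idem true  = refl
        idem false = refl
      qY≡ : q * Y ≡ l * D
      qY≡ = trans (cong (q *_) (trans (∑-cong (vecs elems (suc n)) λ v → sym (∑-*ʳ hs (on u v) _)) (∑-swap (vecs elems (suc n)) hs _))) (trans (sym (∑-*ˡ hs q _)) (go hs val u#))
        where
        go : ∀ hs → Valid hs → All (λ (_ , w) → u ≢ w) hs → ∑ hs (λ (_ , w) → q * ∑ᵛ (suc n) (λ v → on w v * on u v)) ≡ length hs * D
        go []             _          _          = refl
        go ((_ , w) ∷ hs) (wn ∷ val) (u≢w ∷ u#) = cong₂ _+_ (count-intersection w u wn un (λ e → u≢w (sym e))) (go hs val u#)

  q-1-θ : ∀ m → suc (r * θ q m) ≡ q ^ suc m
  q-1-θ zero    = trans (cong suc (ℕₚ.*-identityʳ r)) (trans (sym q≡1+r) (sym (ℕₚ.*-identityʳ q)))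
  q-1-θ (suc m) = begin-equality
    suc (r * suc (q * θ q m))  ≡⟨ solve 3 (λ r q t → con 1 :+ r :* (con 1 :+ q :* t) := (con 1 :+ r) :+ q :* (r :* t)) refl r q (θ q m) ⟩
    suc r + q * (r * θ q m)  ≡⟨ cong (_+ q * (r * θ q m)) q≡1+r ⟨
    q + q * (r * θ q m)  ≡⟨ ℕₚ.*-suc q _ ⟨
    q * suc (r * θ q m)  ≡⟨ cong (q *_) (q-1-θ m) ⟩
    q ^ suc (suc m) ∎

  θ≥1 : ∀ m → 1 ≤ θ q m
  θ≥1 zero    = s≤s z≤n
  θ≥1 (suc m) = s≤s z≤n

  module _ {n′ : ℕ} where
    private
      n N : ℕ
      n = suc n′
      N = suc n

    projective-weight : List (ℕ × Vec K N) → ℕ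
    projective-weight hs = ∑ᵛ N (λ v → [ isNorm v ] * nz (code hs v))

    off-zero : List (ℕ × Vec K N) → ℕ
    off-zero hs = ∑ᵛ N (λ v → [ does (¬? (v ≟ᵛ 𝟘ᵛ)) ] * nz (code hs v))

    off-zero≡ : ∀ hs → off-zero hs ≡ r * projective-weight hs
    off-zero≡ hs = norm-count N (nz ∘ code hs) λ c≢0 v → cong nz (code-homogeneous hs c≢0 v)

    vector-weight≤ : ∀ hs → ∑ᵛ N (nz ∘ code hs) ≤ r * projective-weight hs + 1
    vector-weight≤ hs = begin
      ∑ᵛ N (nz ∘ code hs)  ≤⟨ ∑-mono (vecs elems N) (λ v → by-cases v (v ≟ᵛ 𝟘ᵛ)) ⟩
      ∑ᵛ N (λ v → [ does (¬? (v ≟ᵛ 𝟘ᵛ)) ] * nz (code hs v) + pick (Vec-enum enum N) 𝟘ᵛ (λ _ → 1) v)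
                        ≡⟨ trans (∑-⊕ (vecs elems N) _ _) (cong₂ _+_ (off-zero≡ hs) (∑-pick (Vec-enum enum N) 𝟘ᵛ (λ _ → 1))) ⟩
      r * projective-weight hs + 1 ∎
      where
      by-cases : ∀ v (P? : Dec (v ≡ 𝟘ᵛ)) → nz (code hs v) ≤ [ does (¬? P?) ] * nz (code hs v) + (if does P? then 1 else 0)
      by-cases v (yes _) = nz≤1 _
      by-cases v (no _)  = ℕₚ.≤-reflexive (sym (trans (ℕₚ.+-identityʳ _) (ℕₚ.*-identityˡ _)))

    -- The zero vector lies on all k hyperplanes; these k incidences are the difference between k
    -- q^n and (q - 1) k θ.
    weight-upper : 1 ≤ r → ∀ hs → Valid hs → projective-weight hs ≤ length hs * θ q n′
    weight-upper r≥1 hs val = ℕₚ.*-cancelˡ-≤ r {{>-nonZero r≥1}} (ℕₚ.+-cancelʳ-≤ k _ _ (begin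
      r * projective-weight hs + k  ≡⟨ cong₂ _+_ (sym (off-zero≡ hs)) (sym (∑-pick (Vec-enum enum N) 𝟘ᵛ (λ _ → k))) ⟩
      off-zero hs + ∑ᵛ N (pick (Vec-enum enum N) 𝟘ᵛ (λ _ → k)) ≡⟨ ∑-⊕ (vecs elems N) _ _ ⟨
      ∑ᵛ N (λ v → [ does (¬? (v ≟ᵛ 𝟘ᵛ)) ] * nz (code hs v) + pick (Vec-enum enum N) 𝟘ᵛ (λ _ → k) v) ≤⟨ ∑-mono (vecs elems N) (λ v → by-cases v (v ≟ᵛ 𝟘ᵛ)) ⟩
      ∑ᵛ N (multiplicity hs)  ≡⟨ ∑-multiplicity hs val ⟩
      k * q ^ n  ≡⟨ cong (k *_) (q-1-θ n′) ⟨
      k * suc (r * θ q n′)  ≡⟨ solve 3 (λ k r t → k :* (con 1 :+ r :* t) := r :* (k :* t) :+ k) refl k r (θ q n′) ⟩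
      r * (k * θ q n′) + k ∎))
      where
      k = length hs
      at-zero : ∀ hs → multiplicity hs (𝟘ᵛ {N}) ≡ length hs
      at-zero []             = refl
      at-zero ((_ , u) ∷ hs) = cong₂ _+_ ([yes] (dot u 𝟘ᵛ ≟ 𝟘) (dot-𝟘 u)) (at-zero hs)
      by-cases : ∀ v (P? : Dec (v ≡ 𝟘ᵛ)) → [ does (¬? P?) ] * nz (code hs v) + (if does P? then k else 0) ≤ multiplicity hs v
      by-cases v (yes refl) = ℕₚ.≤-reflexive (sym (at-zero hs))
      by-cases v (no _)     = ℕₚ.≤-trans (ℕₚ.≤-reflexive (trans (ℕₚ.+-identityʳ _) (ℕₚ.*-identityˡ _))) (nz≤multiplicity hs v)

    -- For S support vectors and D = q^n, inclusion-exclusion gives q S ≥ k q D - k(k - 1) D. A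
    -- weight of at most (k - 1) θ would give S ≤ (k - 1) D + 1, which is incompatible with k(k - 1)
    -- + 2 ≤ q.
    weight-lower : ∀ hs → Reduced hs → ∀ k′ → length hs ≡ suc k′ → k′ * suc k′ + 2 ≤ q → k′ * θ q n′ < projective-weight hs
    weight-lower hs (val , dis , nonzero) k′ len few = ℕₚ.≰⇒> λ W≤ → ℕₚ.<⇒≱ contradiction (main W≤)
      where
      D = q ^ n
      k = suc k′
      S = ∑ᵛ N (nz ∘ code hs)
      M = ∑ᵛ N (λ v → multiplicity hs v * multiplicity hs v)
      q≤D : q ≤ D
      q≤D = ℕₚ.m≤m*n q (q ^ n′) {{>-nonZero (q^≥1 n′)}}
      inclusion-exclusion : 2 * (k * D) ≤ S + M
      inclusion-exclusion = begin
        2 * (k * D)  ≡⟨ cong (λ l → 2 * (l * D)) len ⟨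
        2 * (length hs * D)  ≡⟨ cong (2 *_) (∑-multiplicity hs val) ⟨
        2 * ∑ᵛ N (multiplicity hs)  ≡⟨ ∑-*ˡ (vecs elems N) 2 _ ⟨
        ∑ᵛ N (λ v → 2 * multiplicity hs v)  ≤⟨ ∑-mono (vecs elems N) (λ v → 2multiplicity≤ hs v nonzero) ⟩
        ∑ᵛ N (λ v → nz (code hs v) + multiplicity hs v * multiplicity hs v) ≡⟨ ∑-⊕ (vecs elems N) _ _ ⟩
        S + M ∎
      second-moment : q * M + k * D ≡ k * (q * D) + k * k * D
      second-moment = subst (λ l → q * M + l * D ≡ l * (q * D) + l * l * D) len (∑-multiplicity² hs val dis)
      lower : k * (q * D) + k * D ≤ q * S + k * k * D
      lower = ℕₚ.+-cancelˡ-≤ (k * (q * D)) _ _ (begin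
        k * (q * D) + (k * (q * D) + k * D)  ≡⟨ solve 3 (λ k q D → k :* (q :* D) :+ (k :* (q :* D) :+ k :* D) := q :* (con 2 :* (k :* D)) :+ k :* D) refl k q D ⟩
        q * (2 * (k * D)) + k * D  ≤⟨ ℕₚ.+-monoˡ-≤ (k * D) (ℕₚ.*-monoʳ-≤ q inclusion-exclusion) ⟩
        q * (S + M) + k * D  ≡⟨ solve 4 (λ q S M x → q :* (S :+ M) :+ x := q :* S :+ (q :* M :+ x)) refl q S M (k * D) ⟩
        q * S + (q * M + k * D)  ≡⟨ cong (q * S +_) second-moment ⟩
        q * S + (k * (q * D) + k * k * D)  ≡⟨ solve 3 (λ x y z → x :+ (y :+ z) := y :+ (x :+ z)) refl (q * S) (k * (q * D)) (k * k * D) ⟩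
        k * (q * D) + (q * S + k * k * D) ∎)
      main : projective-weight hs ≤ k′ * θ q n′ → q * D ≤ q + k′ * k * D
      main W≤ = ℕₚ.+-cancelˡ-≤ (k′ * (q * D) + k * D) _ _ (begin
        k′ * (q * D) + k * D + q * D  ≡⟨ solve 3 (λ k′ x y → k′ :* x :+ y :+ x := (con 1 :+ k′) :* x :+ y) refl k′ (q * D) (k * D) ⟩
        k * (q * D) + k * D  ≤⟨ lower ⟩
        q * S + k * k * D  ≤⟨ ℕₚ.+-monoˡ-≤ (k * k * D) (ℕₚ.*-monoʳ-≤ q S≤) ⟩
        q * (k′ * D + 1) + k * k * D  ≡⟨ solve 3 (λ q k′ D → q :* (k′ :* D :+ con 1) :+ (con 1 :+ k′) :* (con 1 :+ k′) :* D :=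
                        k′ :* (q :* D) :+ (con 1 :+ k′) :* D :+ (q :+ k′ :* (con 1 :+ k′) :* D)) refl q k′ D ⟩
        k′ * (q * D) + k * D + (q + k′ * k * D) ∎)
        where
        S≤ : S ≤ k′ * D + 1
        S≤ = begin
          S  ≤⟨ vector-weight≤ hs ⟩
          r * projective-weight hs + 1  ≤⟨ ℕₚ.+-monoˡ-≤ 1 (ℕₚ.*-monoʳ-≤ r W≤) ⟩
          r * (k′ * θ q n′) + 1  ≡⟨ cong (_+ 1) (solve 3 (λ r k t → r :* (k :* t) := k :* (r :* t)) refl r k′ (θ q n′)) ⟩
          k′ * (r * θ q n′) + 1  ≤⟨ ℕₚ.+-monoˡ-≤ 1 (ℕₚ.*-monoʳ-≤ k′ (ℕₚ.≤-trans (ℕₚ.n≤1+n _) (ℕₚ.≤-reflexive (q-1-θ n′)))) ⟩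
          k′ * D + 1 ∎
      contradiction : q + k′ * k * D < q * D
      contradiction = begin-strict
        q + k′ * k * D  ≤⟨ ℕₚ.+-monoˡ-≤ (k′ * k * D) q≤D ⟩
        D + k′ * k * D  <⟨ ℕₚ.m<m+n (D + k′ * k * D) (q^≥1 n) ⟩
        D + k′ * k * D + D  ≡⟨ solve 2 (λ x D → D :+ x :* D :+ D := (x :+ con 2) :* D) refl (k′ * k) D ⟩
        (k′ * k + 2) * D  ≤⟨ ℕₚ.*-monoˡ-≤ D few ⟩
        q * D ∎

    small-weight : ∀ (B p : ℕ) → 4 * (suc B * suc B) ≤ q → p * p ≤ q → {{NonZero p}} → ι p ≡ 𝟘 →
      ∀ hs → projective-weight hs ≤ B * θ q n′ →
      ∃ λ hs′ → length hs′ ≡ ceilDiv (projective-weight hs) (θ q n′) × Reduced hs′ × ∀ v → T (isNorm v) → code hs v ≡ code hs′ v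
    -- Treated apart because a point counts as dominated only for B ≥ 1; here the weight is 0 and
    -- the empty combination serves.
    small-weight zero p big p²≤q ι-p hs small =
      [] , ceilDiv-unique (projective-weight hs) (θ q n′) 0 (θ≥1 n′) small (λ _ ()) , ([] , [] , []) , λ v norm →
        decidable-stable (code hs v ≟ 𝟘) λ ne → ℕₚ.<⇒≱ {0} {projective-weight hs}
          (ℕₚ.≤-trans (ℕₚ.≤-reflexive (sym (cong₂ _*_ (isNorm-1 norm) ([yes] (¬? (code hs v ≟ 𝟘)) ne))))
            (term≤∑ {f = λ v → [ isNorm v ] * nz (code hs v)} (Enum.complete (Vec-enum enum N) v))) small
      where
      isNorm-1 : ∀ {b} → T b → [ b ] ≡ 1
      isNorm-1 {true} _ = refl
    small-weight B@(suc B′) p big p²≤q ι-p hs small =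
      let (hs₁ , len₁ , val₁ , same₁) = decompose (2 * B) hs ℕₚ.≤-refl bound
          (hs₂ , len₂ , red₂ , same₂) = reduce hs₁ val₁
          same : ∀ v → T (isNorm v) → code hs v ≡ code hs₂ v
          same v norm = trans (same₁ v (norm-≢𝟘 v norm)) (same₂ v)
          W≡ : projective-weight hs ≡ projective-weight hs₂
          W≡ = ∑-cong (vecs elems N) λ v → on-norm {hs₂} v (same v)
      in hs₂ , ceilDiv-unique (projective-weight hs) (θ q n′) (length hs₂) (θ≥1 n′)
           (subst (_≤ length hs₂ * θ q n′) (sym W≡) (weight-upper r≥1 hs₂ (proj₁ red₂)))
           (λ k′ eq → subst (k′ * θ q n′ <_) (sym W≡) (weight-lower hs₂ red₂ k′ eq (few k′ (subst (_≤ 2 * B) eq (ℕₚ.≤-trans len₂ len₁))))) ,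
         red₂ , same
      where
      open Decomposition 𝔽 B p big p²≤q (s≤s z≤n) ι-p n (s≤s z≤n) using (decompose; r≥1)
      on-norm : ∀ {hs₂} v → (T (isNorm v) → code hs v ≡ code hs₂ v) → [ isNorm v ] * nz (code hs v) ≡ [ isNorm v ] * nz (code hs₂ v)
      on-norm v same with isNorm v
      ... | true  = cong (λ t → 1 * nz t) (same tt)
      ... | false = refl
      bound : 2 * ∑ᵛ N (nz ∘ code hs) ≤ 2 * B * q ^ n
      bound = ℕₚ.≤-trans (ℕₚ.*-monoʳ-≤ 2 (begin
        ∑ᵛ N (nz ∘ code hs)  ≤⟨ vector-weight≤ hs ⟩
        r * projective-weight hs + 1  ≤⟨ ℕₚ.+-mono-≤ (ℕₚ.*-monoʳ-≤ r small) (s≤s z≤n) ⟩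
        r * (B * θ q n′) + B  ≡⟨ solve 3 (λ r B t → r :* (B :* t) :+ B := B :* (con 1 :+ r :* t)) refl r B (θ q n′) ⟩
        B * suc (r * θ q n′)  ≡⟨ cong (B *_) (q-1-θ n′) ⟩
        B * q ^ n ∎)) (ℕₚ.≤-reflexive (sym (ℕₚ.*-assoc 2 B (q ^ n))))
      few : ∀ k′ → suc k′ ≤ 2 * B → k′ * suc k′ + 2 ≤ q
      few k′ k≤ = begin
        k′ * suc k′ + 2  ≤⟨ ℕₚ.+-monoˡ-≤ 2 (ℕₚ.*-mono-≤ (ℕₚ.<⇒≤ k≤) k≤) ⟩
        2 * B * (2 * B) + 2  ≤⟨ ℕₚ.m≤m+n _ (8 * B + 2) ⟩
        2 * B * (2 * B) + 2 + (8 * B + 2) ≡⟨ solve 1 (λ B → con 2 :* B :* (con 2 :* B) :+ con 2 :+ (con 8 :* B :+ con 2) := con 4 :* ((con 1 :+ B) :* (con 1 :+ B))) refl B ⟩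
        4 * (suc B * suc B)  ≤⟨ big ⟩
        q ∎

-- Integer square roots and sums over lists of points

record SquareAtMost (s y : ℕ) : Set where
  constructor square≤
  field bound : s * s ≤ y

-- The search loop of floorSqrt is private; W stands for its auxiliary function, whose third
-- argument is the outcome of the test at k + 1.
descent : (W : ℕ → ℕ → Bool → ℕ) → (∀ k y → W k y true ≡ suc k) → (∀ y → W 0 y false ≡ 0) →
  (∀ k y → W (suc k) y false ≡ W k y (does (suc k * suc k ≤? y))) →
  ∀ k y b → does (suc k * suc k ≤? y) ≡ b → SquareAtMost (W k y b) y
descent W hit bottom next k       y true  eq =
  subst (λ t → SquareAtMost t y) (sym (hit k y)) (square≤ (ℕₚ.≤ᵇ⇒≤ (suc k * suc k) y (subst T (sym eq) tt)))
descent W hit bottom next zero    y false eq = subst (λ t → SquareAtMost t y) (sym (bottom y)) (square≤ z≤n)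
descent W hit bottom next (suc k) y false eq =
  subst (λ t → SquareAtMost t y) (sym (next k y)) (descent W hit bottom next k y _ refl)

mutual
  loop : ℕ → ℕ → Bool → ℕ
  loop = _

  -- Naming the test b and the argument y turns the goal into the search loop applied to distinct
  -- variables, from which unification determines `loop`. The record `SquareAtMost` exposes the root
  -- as an argument, where the bare product s * s would hide it.
  floorSqrt²≤ : ∀ x → SquareAtMost (floorSqrt x) x
  floorSqrt²≤ zero = square≤ z≤n
  floorSqrt²≤ (suc x) with does (suc x * suc x ≤? suc x) in eq
  ... | b with suc x in eq′
  ... | y = descent loop (λ _ _ → refl) (λ _ → refl) (λ _ _ → refl) x y b (trans (cong (λ t → (x + x * t) <ᵇ y) eq′) eq)

∑-concatMap : {A B : Set} (h : A → List B) (xs : List A) (f : B → ℕ) → ∑ (concatMap h xs) f ≡ ∑ xs (λ x → ∑ (h x) f)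
∑-concatMap h []       f = refl
∑-concatMap h (x ∷ xs) f = trans (∑-++ (h x) (concatMap h xs) f) (cong (∑ (h x) f +_) (∑-concatMap h xs f))

∑-filterᵇ : {A : Set} (P : A → Bool) (xs : List A) (f : A → ℕ) → ∑ (filterᵇ P xs) f ≡ ∑ xs (λ x → [ P x ] * f x)
∑-filterᵇ P []       f = refl
∑-filterᵇ P (x ∷ xs) f with P x
... | true  = cong₂ _+_ (sym (ℕₚ.+-identityʳ (f x))) (∑-filterᵇ P xs f)
... | false = ∑-filterᵇ P xs f

length-filterᵇ : {A : Set} (P : A → Bool) (xs : List A) → length (filterᵇ P xs) ≡ ∑ xs (λ x → [ P x ])
length-filterᵇ P xs = trans (sym (trans (∑-const (filterᵇ P xs) 1) (ℕₚ.*-identityʳ _)))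
  (trans (∑-filterᵇ P xs (λ _ → 1)) (∑-cong xs λ x → ℕₚ.*-identityʳ _))

mod≡% : ∀ m p {{_ : NonZero p}} → m mod p ≡ m % p
mod≡% m (suc p) = refl

-- The field with q elements on Fin q, with propositional equality

module Transfer (F : FiniteField) where
  open FiniteField F hiding (_≟_)
  open CommutativeRing ring using (rawRing; -_; +-cong; *-cong; -‿cong)
    renaming (refl to ≈-refl; sym to ≈-sym; trans to ≈-trans; isCommutativeRing to F-isCommutativeRing)

  toF : Fin order → Carrier
  toF = lookup elems

  index : Carrier → Fin order
  index x = Any.index (complete x)

  toF-index : ∀ x → x ≈ toF (index x)
  toF-index x = Anyₚ.lookup-index (complete x)

  toF-injective : ∀ {i j} → toF i ≈ toF j → i ≡ j
  toF-injective = go distinct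
    where
    at : ∀ {xs : List Carrier} {P : Carrier → Set} → All P xs → ∀ j → P (lookup xs j)
    at (p ∷ ps) zero    = p
    at (p ∷ ps) (suc j) = at ps j
    go : ∀ {xs} → AllPairs (λ x y → ¬ (x ≈ y)) xs → ∀ {i j} → lookup xs i ≈ lookup xs j → i ≡ j
    go (x# ∷ xs#) {zero}  {zero}  _  = refl
    go (x# ∷ xs#) {zero}  {suc j} eq = ⊥-elim (at x# j eq)
    go (x# ∷ xs#) {suc i} {zero}  eq = ⊥-elim (at x# i (≈-sym eq))
    go (x# ∷ xs#) {suc i} {suc j} eq = cong suc (go xs# eq)

  finRing : RawRing 0ℓ 0ℓ
  finRing = record
    { Carrier = Fin order
    ; _≈_     = _≡_
    ; _+_     = λ i j → index (toF i +F toF j)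
    ; _*_     = λ i j → index (toF i *F toF j)
    ; -_      = λ i → index (- toF i)
    ; 0#      = index 0#
    ; 1#      = index 1#
    }

  toF-isMonomorphism : IsRingMonomorphism finRing rawRing toF
  toF-isMonomorphism = record
    { isRingHomomorphism = record
      { isSemiringHomomorphism = record
        { isNearSemiringHomomorphism = record
          { +-isMonoidHomomorphism = record
            { isMagmaHomomorphism = record
              { isRelHomomorphism = record { cong = λ { refl → ≈-refl } }
              ; homo = λ i j → ≈-sym (toF-index _) }
            ; ε-homo = ≈-sym (toF-index _) }
          ; *-homo = λ i j → ≈-sym (toF-index _) }
        ; 1#-homo = ≈-sym (toF-index _) }
      ; -‿homo = λ i → ≈-sym (toF-index _) }
    ; injective = toF-injective }

  𝔽 : Field
  𝔽 = record
    { isCommutativeRing = RingMonomorphism.isCommutativeRing toF-isMonomorphism F-isCommutativeRing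
    ; enum = record { list = allFin order ; _≟_ = Finₚ._≟_ ; complete = ∈-allFin ; unique = Uniqueₚ.allFin⁺ order }
    ; 𝟘≢𝟙 = λ eq → 0≉1 (≈-trans (toF-index 0#) (≈-trans (≈-reflexive (cong toF eq)) (≈-sym (toF-index 1#))))
    ; invertible = λ i i≢0 → let (y , eq) = inverse (toF i) (λ z → i≢0 (toF-injective (≈-trans z (toF-index 0#)))) in
        index y , toF-injective (≈-trans (≈-sym (toF-index _)) (≈-trans (*-cong ≈-refl (≈-sym (toF-index y))) (≈-trans eq (toF-index 1#))))
    }
    where
    ≈-reflexive : ∀ {x y} → x ≡ y → x ≈ y
    ≈-reflexive refl = ≈-refl

  open Field 𝔽 using (K; _⊕_; _⊗_; 𝟘; 𝟙; ι; _≟_; ι-+; ι-*; q) renaming (elems to allK)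
  open Counting 𝔽
  open Hyperplanes 𝔽

  q≡order : q ≡ order
  q≡order = length-tabulate id

  infix 4 _∼_
  -- A relation rather than a function, since coding and decoding a setoid element returns it only
  -- up to ≈.
  _∼_ : ∀ {k} → Vec Carrier k → Vec K k → Set
  _∼_ = Pointwise (λ x i → x ≈ toF i)

  fromV : ∀ {k} → Vec Carrier k → Vec K k
  fromV = Vec.map index

  toV : ∀ {k} → Vec K k → Vec Carrier k
  toV = Vec.map toF

  fromV-∼ : ∀ {k} (v : Vec Carrier k) → v ∼ fromV v
  fromV-∼ []      = []
  fromV-∼ (x ∷ v) = toF-index x ∷ fromV-∼ v

  toV-∼ : ∀ {k} (v : Vec K k) → toV v ∼ v
  toV-∼ []      = []
  toV-∼ (i ∷ v) = ≈-refl ∷ toV-∼ v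

  toV-injective : ∀ {k} (u v : Vec K k) → Pointwise _≈_ (toV u) (toV v) → u ≡ v
  toV-injective []      []      []       = refl
  toV-injective (i ∷ u) (j ∷ v) (e ∷ es) = cong₂ _∷_ (toF-injective e) (toV-injective u v es)

  does-∼ : ∀ {x i z j} → x ≈ toF i → z ≈ toF j → does (FiniteField._≟_ F x z) ≡ does (i ≟ j)
  does-∼ {x} {i} {z} {j} xi zj with FiniteField._≟_ F x z | i ≟ j
  ... | yes _ | yes _ = refl
  ... | no _  | no _  = refl
  ... | yes e | no ne = ⊥-elim (ne (toF-injective (≈-trans (≈-sym xi) (≈-trans e zj))))
  ... | no ne | yes refl = ⊥-elim (ne (≈-trans xi (≈-sym zj)))

  module Space (n : ℕ) where
    module P = Projective F n

    dot-∼ : ∀ {k} {u v : Vec Carrier k} {u′ v′} → u ∼ u′ → v ∼ v′ → P.dot u v ≈ toF (dot u′ v′)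
    dot-∼ []       []       = toF-index 0#
    dot-∼ (e ∷ es) (f ∷ fs) = ≈-trans (+-cong (≈-trans (*-cong e f) (toF-index _)) (dot-∼ es fs)) (toF-index _)

    isNorm-∼ : ∀ {k} {u : Vec Carrier k} {u′} → u ∼ u′ → P.isNorm u ≡ isNorm u′
    isNorm-∼ []       = refl
    isNorm-∼ (e ∷ es) = cong₂ _∨_ (does-∼ e (toF-index 1#)) (cong₂ _∧_ (does-∼ e (toF-index 0#)) (isNorm-∼ es))

    charH-∼ : ∀ {u v : P.Vect} {u′ v′} → u ∼ u′ → v ∼ v′ → P.charH u v ≡ on u′ v′
    charH-∼ {u} {v} e f = trans (charH≡ u v) (cong [_] (does-∼ (dot-∼ e f) (toF-index 0#)))
      where
      charH≡ : ∀ u v → P.charH u v ≡ [ P.incident u v ]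
      charH≡ u v with P.incident u v
      ... | true  = refl
      ... | false = refl

    fromHs : List (ℕ × P.Vect) → List (ℕ × Vec K (suc n))
    fromHs = map (λ (a , u) → a , fromV u)

    toHs : List (ℕ × Vec K (suc n)) → List (ℕ × P.Vect)
    toHs = map (λ (a , u) → a , toV u)

    combo-fromHs : ∀ hs {v v′} → v ∼ v′ → P.combo hs v ≡ combination (fromHs hs) v′
    combo-fromHs []             e = refl
    combo-fromHs ((a , u) ∷ hs) e = cong₂ _+_ (cong (a *_) (charH-∼ (fromV-∼ u) e)) (combo-fromHs hs e)

    combo-toHs : ∀ hs {v v′} → v ∼ v′ → P.combo (toHs hs) v ≡ combination hs v′
    combo-toHs []             e = refl
    combo-toHs ((a , u) ∷ hs) e = cong₂ _+_ (cong (a *_) (charH-∼ (toV-∼ u) e)) (combo-toHs hs e)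

    ∑-allVecs : ∀ k φ → ∑ (P.allVecs k) φ ≡ ∑ᵛ k (φ ∘ toV)
    ∑-allVecs zero    φ = refl
    ∑-allVecs (suc k) φ = begin
      ∑ (P.allVecs (suc k)) φ  ≡⟨ ∑-concatMap (λ x → map (x ∷_) (P.allVecs k)) elems φ ⟩
      ∑ elems (λ x → ∑ (map (x ∷_) (P.allVecs k)) φ)  ≡⟨ ∑-cong elems (λ x → trans (∑-map (x ∷_) (P.allVecs k) φ) (∑-allVecs k (λ v → φ (x ∷ v)))) ⟩
      ∑ elems (λ x → ∑ᵛ k (λ v → φ (x ∷ toV v)))  ≡⟨ cong (λ xs → ∑ xs (λ x → ∑ᵛ k (λ v → φ (x ∷ toV v)))) (sym (trans (map-tabulate id toF) (tabulate-lookup elems))) ⟩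
      ∑ (map toF allK) (λ x → ∑ᵛ k (λ v → φ (x ∷ toV v)))  ≡⟨ ∑-map toF allK _ ⟩
      ∑ allK (λ i → ∑ᵛ k (λ v → φ (toF i ∷ toV v)))  ≡⟨ sym (∑-product _∷_ allK (vecs allK k) (φ ∘ toV)) ⟩
      ∑ᵛ (suc k) (φ ∘ toV) ∎
      where open ≡-Reasoning

    module _ (p : ℕ) (p-prime : Prime p) (h : ℕ) (order≡ : order ≡ p ^ h) where
      instance
        p-nonZero : NonZero p
        p-nonZero = prime⇒nonZero p-prime

      -- The h-th power of p · 1 is q · 1 = 0, and a field has no zero divisors.
      ι-p : ι p ≡ 𝟘
      ι-p = decidable-stable (ι p ≟ 𝟘) λ ιp≢0 → powers ιp≢0 h (trans (cong ι (sym (trans q≡order order≡))) ι-q)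
        where
        powers : ι p ≢ 𝟘 → ∀ h → ι (p ^ h) ≢ 𝟘
        powers ιp≢0 zero    z = Field.𝟘≢𝟙 𝔽 (trans (sym z) (Field.+-identityʳ 𝔽 𝟙))
        powers ιp≢0 (suc h) z = ⊗-≢𝟘 ιp≢0 (powers ιp≢0 h) (trans (sym (ι-* p (p ^ h))) z)

      open Characteristic 𝔽 p ι-p

      -- A positive m below the prime p is coprime to it, so a Bézout identity would yield 1 = 0 in
      -- K.
      ι-small : ∀ m → m < p → ι m ≡ 𝟘 → m ≡ 0
      ι-small zero    _   _ = refl
      ι-small (suc m) m<p z = ⊥-elim (bezout (coprime-Bézout (prime⇒coprime p-prime m<p)))
        where
        multiple-of-m : ∀ y → ι (y * suc m) ≡ 𝟘
        multiple-of-m y = trans (ι-* y (suc m)) (trans (cong (ι y ⊗_) z) (Field.zeroʳ 𝔽 (ι y)))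
        one : ∀ {x y} → suc x ≡ y → ι x ≡ 𝟘 → ι y ≡ 𝟘 → ⊥
        one eq x0 y0 = Field.𝟘≢𝟙 𝔽 (trans (sym y0) (trans (cong ι (sym eq)) (trans (cong (𝟙 ⊕_) x0) (Field.+-identityʳ 𝔽 𝟙))))
        bezout : Bézout.Identity 1 p (suc m) → ⊥
        bezout (Bézout.+- x y eq) = one eq (multiple-of-m y) (ι-multiple x)
        bezout (Bézout.-+ x y eq) = one eq (ι-multiple x) (multiple-of-m y)

      ι-injective-≤ : ∀ a b → a ≤ b → b < p → ι a ≡ ι b → a ≡ b
      ι-injective-≤ a b a≤b b<p eq = trans (sym (ℕₚ.+-identityʳ a))
        (trans (cong (a +_) (sym (ι-small (b ∸ a) (ℕₚ.≤-<-trans (ℕₚ.m∸n≤m b a) b<p) difference))) (ℕₚ.m+[n∸m]≡n a≤b))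
        where
        cancel : ∀ {x y} → x ⊕ y ≡ x → y ≡ 𝟘
        cancel {x} {y} e = trans (FS.solve 2 (λ x y → y FS.:= (x FS.:+ y) FS.:+ FS.:- x) refl x y) (trans (cong (_⊕ Field.⊖_ 𝔽 x) e) (Field.-‿inverseʳ 𝔽 x))
        difference : ι (b ∸ a) ≡ 𝟘
        difference = cancel (trans (sym (ι-+ a (b ∸ a))) (trans (cong ι (ℕₚ.m+[n∸m]≡n a≤b)) (sym eq)))

      ι-injective : ∀ a b → a < p → b < p → ι a ≡ ι b → a ≡ b
      ι-injective a b a<p b<p eq with ℕₚ.≤-total a b
      ... | inj₁ a≤b = ι-injective-≤ a b a≤b b<p eq
      ... | inj₂ b≤a = sym (ι-injective-≤ b a b≤a a<p (sym eq))

      ι-%-injective : ∀ a b → ι a ≡ ι b → a mod p ≡ b mod p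
      ι-%-injective a b eq = trans (mod≡% a p) (trans (ι-injective (a % p) (b % p) (m%n<n a p) (m%n<n b p) (trans (sym (ι-% a)) (trans eq (ι-% b)))) (sym (mod≡% b p)))

      mod⇒ι : ∀ a → a mod p ≡ 0 → ι a ≡ 𝟘
      mod⇒ι a z = trans (ι-% a) (cong ι (trans (sym (mod≡% a p)) z))

      ι⇒mod : ∀ a → ι a ≡ 𝟘 → a mod p ≡ 0
      ι⇒mod a z = trans (ι-%-injective a 0 z) (trans (mod≡% 0 p) (m<n⇒m%n≡m (>-nonZero⁻¹ p)))

      wt≡ : ∀ c hs → P.Represents p c hs → P.wt p c ≡ ∑ᵛ (suc n) (λ v → [ isNorm v ] * nz (code (fromHs hs) v))
      wt≡ c hs rep = trans (length-filterᵇ _ P.points) (trans (∑-filterᵇ P.isNorm (P.allVecs (suc n)) _) (trans (∑-allVecs (suc n) _) (∑-cong (vecs allK (suc n)) pointwise)))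
        where
        f = code (fromHs hs)
        nonzero : ∀ v → T (P.isNorm (toV v)) → [ not (does (c (toV v) mod p ℕₚ.≟ 0)) ] ≡ nz (f v)
        nonzero v norm = [ ¬? (c (toV v) mod p ℕₚ.≟ 0) ]-cong (¬? (f v ≟ 𝟘))
          (λ ne z → ne (trans value (ι⇒mod (combination (fromHs hs) v) (trans (sym (code≡ι (fromHs hs) v)) z))))
          (λ ne z → ne (trans (code≡ι (fromHs hs) v) (mod⇒ι (combination (fromHs hs) v) (trans (sym value) z))))
          where
          value : c (toV v) mod p ≡ combination (fromHs hs) v mod p
          value = trans (rep (toV v) norm) (cong (_mod p) (combo-fromHs hs (toV-∼ v)))
        pointwise : ∀ v → [ P.isNorm (toV v) ] * [ not (does (c (toV v) mod p ℕₚ.≟ 0)) ] ≡ [ isNorm v ] * nz (f v)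
        pointwise v with P.isNorm (toV v) in eq | isNorm-∼ (toV-∼ v)
        ... | true  | refl′ = trans (cong (1 *_) (nonzero v (subst T (sym eq) tt))) (cong (λ b → [ b ] * nz (f v)) refl′)
        ... | false | refl′ = cong (λ b → [ b ] * nz (f v)) refl′

      realize : ∀ c hs → P.Represents p c hs → ∀ hs′ → Reduced hs′ → (∀ v → T (isNorm v) → code (fromHs hs) v ≡ code hs′ v) →
        P.LinCombOfExactly p c (length hs′)
      realize c hs rep hs′ (valid , dist , nonzero) same = toHs hs′ , length-map _ hs′ ,
        Allₚ.map⁺ (All.map (λ {(_ , u)} → subst T (sym (isNorm-∼ (toV-∼ u)))) valid) ,
        AllPairsₚ.map⁺ (AllPairs.map (λ {(_ , u)} {(_ , w)} u≢w same → u≢w (toV-injective u w same)) dist) ,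
        Allₚ.map⁺ (All.map (λ {(a , _)} a≢0 z → a≢0 (mod⇒ι a z)) nonzero) ,
        λ v norm → let v′ = fromV v in trans (rep v norm) (trans (cong (_mod p) (combo-fromHs hs (fromV-∼ v)))
          (trans (ι-%-injective (combination (fromHs hs) v′) (combination hs′ v′)
            (trans (sym (code≡ι (fromHs hs) v′)) (trans (same v′ (subst T (isNorm-∼ (fromV-∼ v)) norm)) (code≡ι hs′ v′))))
            (cong (_mod p) (sym (combo-toHs hs′ (fromV-∼ v))))))

div2^≤ : ∀ x k → x div2^ k ≤ x
div2^≤ x zero    = ℕₚ.≤-refl
div2^≤ x (suc k) = ℕₚ.≤-trans (m/n≤m (x div2^ k) 2) (div2^≤ x k)

-- At least one halving takes place, so 2t ≤ x.
square-half : ∀ x k q → x * x ≤ q → 4 * ((x div2^ suc k) * (x div2^ suc k)) ≤ q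
square-half x k q x²≤q = begin
  4 * (t * t)  ≡⟨ solve 1 (λ t → con 4 :* (t :* t) := t :* con 2 :* (t :* con 2)) refl t ⟩
  t * 2 * (t * 2)  ≤⟨ ℕₚ.*-mono-≤ 2t≤x 2t≤x ⟩
  x * x  ≤⟨ x²≤q ⟩
  q ∎
  where
  open ℕₚ.≤-Reasoning
  open +-*-Solver
  t = x div2^ suc k
  2t≤x : t * 2 ≤ x
  2t≤x = ℕₚ.≤-trans (m/n*n≤m (x div2^ k) 2) (div2^≤ x k)

theorem1p5 : (F : FiniteField) (n p h : ℕ) → 3 ≤ n → Prime p → 2 ≤ h
    → FiniteField.order F ≡ p ^ h → 27 < FiniteField.order F
    → (c : Projective.Vect F n → ℕ) → Projective.InCode F n p c
    → (2 < h → Projective.wt F n p c + θ (FiniteField.order F) (n ∸ 1)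
    ≤ (floorSqrt (FiniteField.order F) div2^ (n ∸ 2)) * θ (FiniteField.order F) (n ∸ 1))
    → (h ≡ 2 → Projective.wt F n p c + θ (FiniteField.order F) (n ∸ 1)
    ≤ (p div2^ n) * θ (FiniteField.order F) (n ∸ 1))
    → Projective.LinCombOfExactly F n p c
    (ceilDiv (Projective.wt F n p c) (θ (FiniteField.order F) (n ∸ 1)))
theorem1p5 F n@(suc n′@(suc (suc n″))) p h (s≤s (s≤s (s≤s _))) p-prime 2≤h order≡ _ c (hs , _ , rep) large-h h≡2 =
  conclude (threshold (ℕₚ.m≤n⇒m<n∨m≡n 2≤h))
  where
  open FiniteField F using (order)
  open Transfer F
  open Space n
  open Counting 𝔽
  instance _ = prime⇒nonZero p-prime

  w : ℕ
  w = Projective.wt F n p c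

  p²≤order : p * p ≤ order
  p²≤order = ℕₚ.≤-trans (ℕₚ.≤-reflexive (cong (p *_) (sym (ℕₚ.*-identityʳ p)))) (ℕₚ.≤-trans (ℕₚ.^-monoʳ-≤ p 2≤h) (ℕₚ.≤-reflexive (sym order≡)))

  -- Here t = B + 1, the floor in the hypothesis, with the subtracted θ moved across. As n ≥ 3, both
  -- exponents n - 2 and n are positive, so that t is at most half of √q, respectively of p.
  threshold : 2 < h ⊎ 2 ≡ h → ∃ λ t → 4 * (t * t) ≤ order × w + θ order n′ ≤ t * θ order n′
  threshold (inj₁ 2<h) = floorSqrt order div2^ suc n″ , square-half (floorSqrt order) n″ order (SquareAtMost.bound (floorSqrt²≤ order)) , large-h 2<h
  threshold (inj₂ 2≡h) = p div2^ n , square-half p (suc (suc n″)) order p²≤order , h≡2 (sym 2≡h)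

  conclude : (∃ λ t → 4 * (t * t) ≤ order × w + θ order n′ ≤ t * θ order n′) → Projective.LinCombOfExactly F n p c (ceilDiv w (θ order n′))
  conclude (zero  , _   , small) = ⊥-elim (ℕₚ.<⇒≱ (ℕₚ.≤-trans (subst (λ q → 1 ≤ θ q n′) q≡order (θ≥1 n′)) (ℕₚ.m≤n+m _ w)) small)
  conclude (suc B , big , small) =
    let (hs′ , len , reduced , same) = small-weight {n′} B p (subst (4 * (suc B * suc B) ≤_) (sym q≡order) big) (subst (p * p ≤_) (sym q≡order) p²≤order)
          (ι-p p p-prime h order≡) (fromHs hs)
          (subst (λ x → x ≤ B * θ (Field.q 𝔽) n′) w≡ (subst (λ q → w ≤ B * θ q n′) (sym q≡order)
            (ℕₚ.+-cancelʳ-≤ (θ order n′) _ _ (ℕₚ.≤-trans small (ℕₚ.≤-reflexive (ℕₚ.+-comm (θ order n′) _))))))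
    in subst (Projective.LinCombOfExactly F n p c) (trans len (cong₂ ceilDiv (sym w≡) (cong (λ q → θ q n′) q≡order)))
         (realize p p-prime h order≡ c hs rep hs′ reduced same)
    where
    w≡ : w ≡ projective-weight (fromHs hs)
    w≡ = wt≡ p p-prime h order≡ c hs rep
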